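{- Let $\tau_3(n)$ denote the maximum number of rainbow triangles in an almost $3$-Gallai colouring of $E(K_n)$. Then \[ \left(\tfrac{1}{2} - o(1)\right) n \log n \le \tau_3(n) \le O\big(n^{\sqrt{2}} \log n\big). \] Moreover, the lower bound is attained by almost $3$-Gallai colourings of $E(K_n)$ that use only three colours.
   Context: A colouring $c : E(K_n) \to \mathbb{N}$ of the edges of $K_n$ is almost $3$-Gallai if no two rainbow triangles share an edge, where a triangle is rainbow if its three edges have pairwise distinct colours. All logarithms are in base $2$. -}

module Defs where

open import Data.Fin as Fin using (Fin)
import Data.Fin.Properties as Fin
open import Data.Integer as ℤ using (+_; -[1+_]; +<+; +≤+)
import Data.Integer.Properties as ℤ
open import Data.List using (List; []; _∷_; allFin; cartesianProduct; filter; length; mapMaybe)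
open import Data.List.Membership.Propositional using (_∈_)
open import Data.Maybe using (Maybe; just; nothing)
open import Data.Nat using (ℕ; zero; suc; _+_; _*_; _^_; _≤_; _<_; z≤n; s≤s; z<s)
import Data.Nat as ℕ
open import Data.Nat.Properties
open import Data.Nat.Solver using (module +-*-Solver)
open import Data.Product using (Σ; _×_; _,_; proj₁; proj₂; ∃; ∃₂)
open import Data.Rational.Unnormalised as ℚ using (ℚᵘ; mkℚᵘ; 0ℚᵘ; 1ℚᵘ; ↥_; ↧ₙ_; *<*; *≤*)
import Data.Rational.Unnormalised.Properties as ℚ
open import Data.Sum using (_⊎_)
open import Relation.Binary.PropositionalEquality using (_≡_; _≢_; refl; sym; cong; subst; subst₂)
open import Relation.Nullary using (¬_; Dec; yes; no; ¬?; _×-dec_)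

-- The vertex set is Fin n, and an unordered pair is written in
-- increasing order.

record Edge (n : ℕ) : Set where
  constructor edge
  field
    {u v} : Fin n
    .u<v  : u Fin.< v

record Triangle (n : ℕ) : Set where
  constructor triangle
  field
    {x y z} : Fin n
    .x<y    : x Fin.< y
    .y<z    : y Fin.< z

module _ {n : ℕ} where

  xy yz xz : Triangle n → Edge n
  xy (triangle x<y _)               = edge x<y
  yz (triangle _ y<z)               = edge y<z
  xz (triangle {x} {y} {z} x<y y<z) = edge {u = x} {v = z} (Fin.<-trans {i = x} {j = y} {k = z} x<y y<z)

  edges : Triangle n → List (Edge n)
  edges T = xy T ∷ yz T ∷ xz T ∷ []

Colouring : ℕ → Set
Colouring n = Edge n → ℕ

module _ {n : ℕ} where

  ShareEdge : Triangle n → Triangle n → Set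
  ShareEdge S T = ∃ λ e → e ∈ edges S × e ∈ edges T

  Rainbow : Colouring n → Triangle n → Set
  Rainbow c T = c (xy T) ≢ c (yz T) × c (yz T) ≢ c (xz T) × c (xy T) ≢ c (xz T)

  rainbow? : ∀ c T → Dec (Rainbow c T)
  rainbow? c T =
    ¬? (c (xy T) ≟ c (yz T)) ×-dec ¬? (c (yz T) ≟ c (xz T)) ×-dec ¬? (c (xy T) ≟ c (xz T))

  Almost3Gallai : Colouring n → Set
  Almost3Gallai c = ∀ S T → Rainbow c S → Rainbow c T → S ≢ T → ¬ ShareEdge S T

  UsesOnlyThreeColours : Colouring n → Set
  UsesOnlyThreeColours c =
    Σ ℕ λ α → Σ ℕ λ β → Σ ℕ λ γ → ∀ e → c e ≡ α ⊎ c e ≡ β ⊎ c e ≡ γ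

increasing : ∀ {n} → Fin n × Fin n × Fin n → Maybe (Triangle n)
increasing (x , y , z) with x Fin.<? y | y Fin.<? z
... | yes x<y | yes y<z = just (triangle x<y y<z)
... | yes _   | no  _   = nothing
... | no  _   | _       = nothing

triangles : ∀ n → List (Triangle n)
triangles n =
  mapMaybe increasing (cartesianProduct (allFin n) (cartesianProduct (allFin n) (allFin n)))

#rainbow : ∀ {n} → Colouring n → ℕ
#rainbow {n} c = length (filter (rainbow? c) (triangles n))

-- t = τ₃(n)
IsMaxRainbow : ℕ → ℕ → Set
IsMaxRainbow n t =
  (Σ (Colouring n) λ c → Almost3Gallai c × #rainbow c ≡ t) ×
  (∀ (c : Colouring n) → Almost3Gallai c → #rainbow c ≤ t)

-- A real x ≥ 0 is given by the set  x <_  of the rationals above it.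
-- Classically, the sets of positive rationals that are inhabited, upward
-- closed and without least element are exactly the sets {r | x < r} with
-- x ∈ [0,∞), and x ≤ y holds iff every rational above y is above x.

record ℝ₊ : Set₁ where
  field
    Above     : ℚᵘ → Set
    positive  : ∀ {r} → Above r → 0ℚᵘ ℚ.< r
    inhabited : ∃ Above
    upward    : ∀ {r s} → Above r → r ℚ.≤ s → Above s
    open′     : ∀ {r} → Above r → ∃ λ s → s ℚ.< r × Above s

open ℝ₊ using (Above)

infix 4 _≤ʳ_

_≤ʳ_ : ℝ₊ → ℝ₊ → Set
x ≤ʳ y = ∀ r → Above y r → Above x r

-- Negative rationals are sent to 0.
fromℚ : ℚᵘ → ℝ₊
fromℚ q = record
  { Above     = λ r → 0ℚᵘ ℚ.⊔ q ℚ.< r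
  ; positive  = ℚ.≤-<-trans (ℚ.p≤p⊔q 0ℚᵘ q)
  ; inhabited = 0ℚᵘ ℚ.⊔ q ℚ.+ 1ℚᵘ
              , ℚ.<-respˡ-≃ (ℚ.+-identityʳ (0ℚᵘ ℚ.⊔ q))
                  (ℚ.+-monoʳ-< (0ℚᵘ ℚ.⊔ q) {0ℚᵘ} {1ℚᵘ} (*<* (+<+ z<s)))
  ; upward    = ℚ.<-≤-trans
  ; open′     = λ q<r → let s , q<s , s<r = ℚ.<-dense q<r in s , s<r , q<s
  }

fromℕ : ℕ → ℝ₊
fromℕ k = fromℚ (+ k ℚ./ 1)

infixl 7 _*ʳ_

_*ʳ_ : ℝ₊ → ℝ₊ → ℝ₊
x *ʳ y = record
  { Above     = λ r → ∃₂ λ a b → Above x a × Above y b × a ℚ.* b ℚ.≤ r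
  ; positive  = λ (a , b , x<a , y<b , ab≤r) → ℚ.<-≤-trans
      (ℚ.positive⁻¹ (a ℚ.* b)
        {{ℚ.pos*pos⇒pos a {{ℚ.positive (X.positive x<a)}} b {{ℚ.positive (Y.positive y<b)}}}})
      ab≤r
  ; inhabited = let a , x<a = X.inhabited ; b , y<b = Y.inhabited in
      a ℚ.* b , a , b , x<a , y<b , ℚ.≤-refl
  ; upward    = λ (a , b , x<a , y<b , ab≤r) r≤s → a , b , x<a , y<b , ℚ.≤-trans ab≤r r≤s
  ; open′     = λ (a , b , x<a , y<b , ab≤r) → let a′ , a′<a , x<a′ = X.open′ x<a in
      a′ ℚ.* b
    , ℚ.<-≤-trans (ℚ.*-monoˡ-<-pos b {{ℚ.positive (Y.positive y<b)}} a′<a) ab≤r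
    , a′ , b , x<a′ , y<b , ℚ.≤-refl
  }
  where module X = ℝ₊ x
        module Y = ℝ₊ y

-- For r > 0 we have r = ↥ₙ r / ↧ₙ r.
↥ₙ_ : ℚᵘ → ℕ
↥ₙ r = ℤ.∣ ↥ r ∣

↥ₙ>0 : ∀ {r} → 0ℚᵘ ℚ.< r → 0 < ↥ₙ r
↥ₙ>0 {mkℚᵘ (+ 0)       _} (*<* (+<+ ()))
↥ₙ>0 {mkℚᵘ (+ (suc _)) _} _         = z<s
↥ₙ>0 {mkℚᵘ -[1+ _ ]    _} (*<* ())

cross-≤ : ∀ {r s} → 0ℚᵘ ℚ.< r → r ℚ.≤ s → ↥ₙ r * ↧ₙ s ≤ ↥ₙ s * ↧ₙ r
cross-≤ {mkℚᵘ (+ a) b} {mkℚᵘ (+ c) d} _ (*≤* p) =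
  ℤ.drop‿+≤+ (subst₂ ℤ._≤_ (sym (ℤ.pos-* a (suc d))) (sym (ℤ.pos-* c (suc b))) p)
cross-≤ {mkℚᵘ (+ 0) _}       {mkℚᵘ -[1+ _ ] _} (*<* (+<+ ())) _
cross-≤ {mkℚᵘ (+ (suc _)) _} {mkℚᵘ -[1+ _ ] _} _ (*≤* ())
cross-≤ {mkℚᵘ -[1+ _ ] _}    (*<* ()) _

fraction-positive : ∀ {a} b → 0 < a → 0ℚᵘ ℚ.< mkℚᵘ (+ a) b
fraction-positive {suc _} _ _ = *<* (+<+ z<s)

fraction-< : ∀ {r} → 0ℚᵘ ℚ.< r → ∀ {a} b → a * ↧ₙ r < ↥ₙ r * suc b → mkℚᵘ (+ a) b ℚ.< r
fraction-< {mkℚᵘ (+ c) d}    _        {a} b p =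
  *<* (subst₂ ℤ._<_ (ℤ.pos-* a (suc d)) (ℤ.pos-* c (suc b)) (+<+ p))
fraction-< {mkℚᵘ -[1+ _ ] _} (*<* ())

^-distribʳ-* : ∀ a b k → (a * b) ^ k ≡ a ^ k * b ^ k
^-distribʳ-* a b zero    = refl
^-distribʳ-* a b (suc k) rewrite ^-distribʳ-* a b k =
  solve 4 (λ a b c d → a :* b :* (c :* d) := a :* c :* (b :* d)) refl a b (a ^ k) (b ^ k)
  where open +-*-Solver

^-cancelˡ-< : ∀ {a b} k → a ^ k < b ^ k → a < b
^-cancelˡ-< k p = ≰⇒> λ b≤a → <⇒≱ p (^-monoˡ-≤ k b≤a)

power-step-≤ : ∀ y k → suc y ^ suc k ≤ y ^ suc k + suc k * suc y ^ k
power-step-≤ y zero    = ≤-reflexive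
  (solve 1 (λ y → (con 1 :+ y) :* con 1 := y :* con 1 :+ con 1) refl y)
  where open +-*-Solver
power-step-≤ y (suc k) = begin
  suc y * P                             ≡⟨⟩
  P + y * P                             ≤⟨ +-monoʳ-≤ P (*-monoʳ-≤ y (power-step-≤ y k)) ⟩
  P + y * (Y + suc k * p)               ≡⟨ solve 5 (λ P y Y k p → P :+ y :* (Y :+ k :* p)
                                             := y :* Y :+ (P :+ k :* (y :* p))) refl P y Y (suc k) p ⟩
  y * Y + (P + suc k * (y * p))         ≤⟨ +-monoʳ-≤ (y * Y) (+-monoʳ-≤ P
                                             (*-monoʳ-≤ (suc k) (*-monoˡ-≤ p (n≤1+n y)))) ⟩
  y * Y + (P + suc k * P)               ∎
  where
  open ≤-Reasoning
  open +-*-Solver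
  p = suc y ^ k
  P = suc y ^ suc k
  Y = y ^ suc k

power-step-≥ : ∀ y k → y ^ suc k + suc k * y ^ k ≤ suc y ^ suc k
power-step-≥ y zero    = ≤-reflexive
  (solve 1 (λ y → y :* con 1 :+ con 1 := (con 1 :+ y) :* con 1) refl y)
  where open +-*-Solver
power-step-≥ y (suc k) = begin
  y * (y * p) + suc (suc k) * (y * p)         ≤⟨ m≤m+n _ (suc k * p) ⟩
  y * (y * p) + suc (suc k) * (y * p) + suc k * p
    ≡⟨ solve 3 (λ y p k → y :* (y :* p) :+ (con 1 :+ k) :* (y :* p) :+ k :* p
         := (con 1 :+ y) :* (y :* p :+ k :* p)) refl y p (suc k) ⟩
  suc y * (y * p + suc k * p)                 ≤⟨ *-monoʳ-≤ (suc y) (power-step-≥ y k) ⟩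
  suc y * suc y ^ suc k                       ∎
  where
  open ≤-Reasoning
  open +-*-Solver
  p = y ^ k

-- M < r ^ k
PowerAbove : (M k : ℕ) → ℚᵘ → Set
PowerAbove M k r = M * (↧ₙ r) ^ k < (↥ₙ r) ^ k

PowerAbove-upward : ∀ M k {r s} → 0ℚᵘ ℚ.< r → PowerAbove M k r → r ℚ.≤ s → PowerAbove M k s
PowerAbove-upward M k {r} {s} 0<r p r≤s = *-cancelʳ-< (d ^ k) _ _ (begin-strict
  M * d′ ^ k * d ^ k    ≡⟨ solve 3 (λ M a b → M :* a :* b := M :* b :* a) refl M (d′ ^ k) (d ^ k) ⟩
  M * d ^ k * d′ ^ k    <⟨ *-monoˡ-< (d′ ^ k) {{m^n≢0 d′ k}} p ⟩
  (↥ₙ r) ^ k * d′ ^ k   ≡⟨ ^-distribʳ-* (↥ₙ r) d′ k ⟨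
  (↥ₙ r * d′) ^ k       ≤⟨ ^-monoˡ-≤ k (cross-≤ 0<r r≤s) ⟩
  (↥ₙ s * d) ^ k        ≡⟨ ^-distribʳ-* (↥ₙ s) d k ⟩
  (↥ₙ s) ^ k * d ^ k    ∎)
  where
  open ≤-Reasoning
  open +-*-Solver
  d = suc (ℚᵘ.denominator-1 r)
  d′ = suc (ℚᵘ.denominator-1 s)

PowerAbove-open : ∀ M j {r} → 0ℚᵘ ℚ.< r → PowerAbove M (suc j) r →
                  ∃ λ s → s ℚ.< r × 0ℚᵘ ℚ.< s × PowerAbove M (suc j) s
PowerAbove-open M j {mkℚᵘ (+ 0) e}       (*<* (+<+ ()))
PowerAbove-open M j {mkℚᵘ -[1+ _ ] e}    (*<* ())
PowerAbove-open M j {r@(mkℚᵘ (+ (suc m′)) e)} 0<r p =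
  mkℚᵘ (+ y) e′ , fraction-< 0<r e′ below , fraction-positive e′ (y>0 y key) , key
  where
  open ≤-Reasoning
  open +-*-Solver
  m = suc m′
  d = suc e
  k = suc j
  K′ = k * m ^ j
  K = suc K′
  y = K′ + m′ * K
  e′ = K′ + e * K
  below : y * d < m * (d * K)
  below = begin-strict
    y * d        <⟨ *-monoˡ-< d (n<1+n y) ⟩
    m * K * d    ≡⟨ solve 3 (λ m K d → m :* K :* d := m :* (d :* K)) refl m K d ⟩
    m * (d * K)  ∎
  key : M * (d * K) ^ k < y ^ k
  key = +-cancelʳ-< (K′ * K ^ j) _ _ (begin-strict
    M * (d * K) ^ k + K′ * K ^ j   <⟨ +-monoʳ-< (M * (d * K) ^ k)
                                        (*-monoˡ-< (K ^ j) {{m^n≢0 K j}} (n<1+n K′)) ⟩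
    M * (d * K) ^ k + K ^ k        ≡⟨ cong (λ t → M * t + K ^ k) (^-distribʳ-* d K k) ⟩
    M * (d ^ k * K ^ k) + K ^ k    ≡⟨ solve 3 (λ M a b → M :* (a :* b) :+ b := (con 1 :+ M :* a) :* b)
                                        refl M (d ^ k) (K ^ k) ⟩
    suc (M * d ^ k) * K ^ k        ≤⟨ *-monoˡ-≤ (K ^ k) p ⟩
    m ^ k * K ^ k                  ≡⟨ ^-distribʳ-* m K k ⟨
    (m * K) ^ k                    ≤⟨ power-step-≤ y j ⟩
    y ^ k + k * (m * K) ^ j        ≡⟨ cong (λ t → y ^ k + k * t) (^-distribʳ-* m K j) ⟩
    y ^ k + k * (m ^ j * K ^ j)    ≡⟨ cong (y ^ k ℕ.+_) (sym (*-assoc k (m ^ j) (K ^ j))) ⟩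
    y ^ k + K′ * K ^ j             ∎)
  y>0 : ∀ y → M * (d * K) ^ k < y ^ k → 0 < y
  y>0 zero    ()
  y>0 (suc _) _  = z<s

√_ : ℕ → ℝ₊
√ m = record
  { Above     = λ r → 0ℚᵘ ℚ.< r × PowerAbove m 2 r
  ; positive  = proj₁
  ; inhabited = mkℚᵘ (+ suc m) 0 , *<* (+<+ z<s) , m<[1+m]²
  ; upward    = λ (0<r , p) r≤s → ℚ.<-≤-trans 0<r r≤s , PowerAbove-upward m 2 0<r p r≤s
  ; open′     = λ (0<r , p) → PowerAbove-open m 1 0<r p
  }
  where
  open ≤-Reasoning
  m<[1+m]² : m * 1 ^ 2 < suc m ^ 2
  m<[1+m]² = begin-strict
    m * 1 ^ 2          ≡⟨ *-identityʳ m ⟩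
    m                  <⟨ n<1+n m ⟩
    suc m              ≤⟨ m≤m*n (suc m) (suc m * 1) ⟩
    suc m ^ 2          ∎

-- n ^ x is the infimum of n ^ s over the rationals s > x (for n ≥ 1,
-- where t ↦ n ^ t is continuous and non-decreasing), and n ^ (p / q) < r
-- means n ^ p < r ^ q.
infixr 8 _^ʳ_

_^ʳ_ : ℕ → ℝ₊ → ℝ₊
n ^ʳ x = record
  { Above     = λ r → 0ℚᵘ ℚ.< r × ∃ λ s → Above x s × PowerAbove (n ^ ↥ₙ s) (↧ₙ s) r
  ; positive  = proj₁
  ; inhabited = let s , x<s = X.inhabited in
      mkℚᵘ (+ suc (n ^ ↥ₙ s)) 0 , *<* (+<+ z<s) , s , x<s , bound (n ^ ↥ₙ s) (ℚᵘ.denominator-1 s)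
  ; upward    = λ (0<r , s , x<s , p) r≤r′ →
      ℚ.<-≤-trans 0<r r≤r′ , s , x<s , PowerAbove-upward (n ^ ↥ₙ s) (↧ₙ s) 0<r p r≤r′
  ; open′     = λ (0<r , s , x<s , p) →
      let r′ , r′<r , 0<r′ , p′ = PowerAbove-open (n ^ ↥ₙ s) (ℚᵘ.denominator-1 s) 0<r p in
      r′ , r′<r , 0<r′ , s , x<s , p′
  }
  where
  module X = ℝ₊ x
  open ≤-Reasoning
  bound : ∀ M j → M * 1 ^ suc j < suc M ^ suc j
  bound M j = begin-strict
    M * 1 ^ suc j      ≡⟨ cong (M ℕ.*_) (^-zeroˡ (suc j)) ⟩
    M * 1              ≡⟨ *-identityʳ M ⟩
    M                  <⟨ n<1+n M ⟩
    suc M              ≤⟨ m≤m*n (suc M) (suc M ^ j) {{m^n≢0 (suc M) j}} ⟩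
    suc M ^ suc j      ∎

-- log₂ n < p / q  means  n ^ q < 2 ^ p.
LogAbove : ℕ → ℚᵘ → Set
LogAbove n r = n ^ ↧ₙ r < 2 ^ ↥ₙ r

LogAbove-upward : ∀ n {r s} → 0ℚᵘ ℚ.< r → LogAbove n r → r ℚ.≤ s → LogAbove n s
LogAbove-upward n {r} {s} 0<r p r≤s = ^-cancelˡ-< d (begin-strict
  (n ^ d′) ^ d       ≡⟨ ^-*-assoc n d′ d ⟩
  n ^ (d′ * d)       ≡⟨ cong (n ^_) (*-comm d′ d) ⟩
  n ^ (d * d′)       ≡⟨ ^-*-assoc n d d′ ⟨
  (n ^ d) ^ d′       <⟨ ^-monoˡ-< d′ p ⟩
  (2 ^ ↥ₙ r) ^ d′    ≡⟨ ^-*-assoc 2 (↥ₙ r) d′ ⟩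
  2 ^ (↥ₙ r * d′)    ≤⟨ ^-monoʳ-≤ 2 (cross-≤ 0<r r≤s) ⟩
  2 ^ (↥ₙ s * d)     ≡⟨ ^-*-assoc 2 (↥ₙ s) d ⟨
  (2 ^ ↥ₙ s) ^ d     ∎)
  where
  open ≤-Reasoning
  d = suc (ℚᵘ.denominator-1 r)
  d′ = suc (ℚᵘ.denominator-1 s)

LogAbove-open : ∀ n {r} → 0ℚᵘ ℚ.< r → LogAbove n r →
                ∃ λ s → s ℚ.< r × 0ℚᵘ ℚ.< s × LogAbove n s
LogAbove-open n {mkℚᵘ (+ 0) e}       (*<* (+<+ ()))
LogAbove-open n {mkℚᵘ -[1+ _ ] e}    (*<* ())
LogAbove-open n {r@(mkℚᵘ (+ (suc m′)) e)} 0<r p =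
  mkℚᵘ (+ y) e′ , fraction-< 0<r e′ below , fraction-positive e′ z<s , key
  where
  open ≤-Reasoning
  open +-*-Solver
  m = suc m′
  d = suc e
  A = n ^ d
  K′ = suc A
  K = suc K′
  y = K′ + m′ * K
  e′ = K′ + e * K
  below : y * d < m * (d * K)
  below = begin-strict
    y * d        <⟨ *-monoˡ-< d (n<1+n y) ⟩
    m * K * d    ≡⟨ solve 3 (λ m K d → m :* K :* d := m :* (d :* K)) refl m K d ⟩
    m * (d * K)  ∎
  double : ∀ A → 2 * A ^ suc (suc A) < suc A ^ suc (suc A)
  double zero      = z<s
  double A@(suc _) = begin-strict
    2 * (A * A ^ suc A)                    ≡⟨ solve 2 (λ A P → con 2 :* (A :* P) := A :* P :+ A :* P)
                                                refl A (A ^ suc A) ⟩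
    A * A ^ suc A + A * A ^ suc A          <⟨ +-monoʳ-< (A * A ^ suc A)
                                                (*-monoˡ-< (A ^ suc A) {{m^n≢0 A (suc A)}} (m<n⇒m<1+n (n<1+n A))) ⟩
    A * A ^ suc A + suc (suc A) * A ^ suc A ≤⟨ power-step-≥ A (suc A) ⟩
    suc A ^ suc (suc A)                    ∎
  key : n ^ (d * K) < 2 ^ y
  key = *-cancelˡ-< 2 _ _ (begin-strict
    2 * n ^ (d * K)   ≡⟨ cong (2 ℕ.*_) (^-*-assoc n d K) ⟨
    2 * A ^ K         <⟨ double A ⟩
    suc A ^ K         ≤⟨ ^-monoˡ-≤ K p ⟩
    (2 ^ m) ^ K       ≡⟨ ^-*-assoc 2 m K ⟩
    2 ^ (m * K)       ∎)

-- For n ≥ 1; log₂ 0 is given the value 0.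
log₂ : ℕ → ℝ₊
log₂ n = record
  { Above     = λ r → 0ℚᵘ ℚ.< r × LogAbove n r
  ; positive  = proj₁
  ; inhabited = mkℚᵘ (+ suc n) 0 , *<* (+<+ z<s) , subst (_< 2 ^ suc n) (sym (*-identityʳ n)) (n<2^1+n n)
  ; upward    = λ (0<r , p) r≤s → ℚ.<-≤-trans 0<r r≤s , LogAbove-upward n 0<r p r≤s
  ; open′     = λ (0<r , p) → LogAbove-open n 0<r p
  }
  where
  open ≤-Reasoning
  n<2^1+n : ∀ n → n < 2 ^ suc n
  n<2^1+n zero    = z<s
  n<2^1+n (suc n) = begin-strict
    suc n                      ≤⟨ n<2^1+n n ⟩
    2 ^ suc n                  <⟨ ^-monoʳ-< 2 (s≤s (s≤s z≤n)) (n<1+n (suc n)) ⟩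
    2 ^ suc (suc n)            ∎

-- (1/2 − o(1)) n log n ≤ f(n).  For ε ≥ 1/2 the truncation in fromℚ turns a
-- non-positive left-hand side into 0, and both versions hold trivially.
AtLeastHalfNLogN : (ℕ → ℕ) → Set
AtLeastHalfNLogN f =
  ∀ ε → 0ℚᵘ ℚ.< ε → ∃ λ N → ∀ n → N ≤ n →
    fromℚ (ℚ.½ ℚ.- ε) *ʳ fromℕ n *ʳ log₂ n ≤ʳ fromℕ (f n)

BigO : (ℕ → ℕ) → (ℕ → ℝ₊) → Set
BigO f g = Σ ℕ λ C → ∃ λ N → ∀ n → N ≤ n → fromℕ (f n) ≤ʳ fromℕ C *ʳ g n

{-# OPTIONS --safe #-}
module Submission where

-- Lower bound.  Take the vertices of a cube together with its coordinates; colour the edge between a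
-- coordinate j and a vertex v by the j-th digit of v, the edges of the cube by a third colour, and
-- everything else by 0.  The rainbow triangles consist of an edge of the cube and its direction.
--
-- Upper bound.  Merge the colours into three, losing a constant factor.  If col q p ≠ col q r, then p r
-- repeats one of these colours unless q p r is rainbow.  So the colour classes at a vertex v are joined
-- pairwise by two colours, up to a matching, and the edge-isoperimetric inequality of the cube shows that
-- only O(n log n) rainbow triangles meet several classes.  One may therefore split at v whenever two
-- classes at v have size a = n / n^(√2−1).  Otherwise essentially all vertices have the same majority
-- colour i, and at most 2a edges of the other colours j, k.  Call a vertex rich if it sends edges of
-- colours j and k into more than d rainbow triangles.  If u and w are joined in colours j and k,
-- respectively, to each of many rich vertices, then nearly all triangles at these lie in the 4a neighbours
-- of u and w in the colours j, k, where by induction there are at most about a^√2 = n^(2(√2−1)) of them;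
-- and such a pair exists as soon as there are more than about d n triangles, with d = n^(√2−1).

open import Defs
open import Data.Bool using (Bool; true; false; not; _∧_; _∨_)
import Data.Bool.Properties as Bool
open import Data.Empty using (⊥; ⊥-elim)
open import Data.Fin as Fin using (Fin; zero; suc; toℕ; fromℕ<; combine; remQuot; _≟_)
open import Data.Fin.Patterns using (0F; 1F; 2F; 3F)
import Data.Fin.Properties as Fin
open import Data.Fin.Properties using (all?; any?)
open import Data.Integer as ℤ using (-[1+_]; +<+; +≤+)
import Data.Integer.Properties as ℤ
open import Data.List using (List; []; _∷_; _++_; length; filter; map; mapMaybe; allFin; cartesianProduct; tabulate)
open import Data.List.Membership.Propositional using (_∈_; find; lose)
open import Data.List.Membership.Propositional.Properties using (∈-filter⁻; ∈-cartesianProduct⁺; ∈-allFin)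
open import Data.List.Properties using (length-filter; length-tabulate)
open import Data.List.Relation.Unary.All as All using (All; []; _∷_)
open import Data.List.Relation.Unary.Any as Any using (here; there)
open import Data.List.Relation.Unary.Unique.Propositional using (Unique; []; _∷_)
import Data.List.Relation.Unary.Unique.Propositional.Properties as Unique
open import Data.Maybe using (Maybe; just; nothing)
open import Data.Nat as ℕ using (ℕ; zero; suc; _+_; _*_; _∸_; _^_; _≤_; _<_; z≤n; s≤s; z<s; _≤?_; _<?_; ⌊_/2⌋)
open import Data.Nat.Induction using (<-wellFounded; Acc; acc)
open import Data.Nat.Properties hiding (_≟_; suc-injective)
open import Data.Nat.Tactic.RingSolver using (solve-∀)
open import Data.Product using (Σ; ∃; _×_; _,_; proj₁; proj₂)
open import Data.Rational.Unnormalised as ℚ using (ℚᵘ; mkℚᵘ; 0ℚᵘ; ↧ₙ_; *<*; *≤*)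
import Data.Rational.Unnormalised.Properties as ℚ
open import Data.Sum using (_⊎_; inj₁; inj₂; [_,_]′)
open import Data.Unit using (tt)
open import Data.Vec as Vec using (Vec; []; _∷_; lookup)
open import Data.Vec.Properties using (lookup∘tabulate)
open import Function using (_∘_; id; case_of_)
open import Relation.Binary.Definitions using (Tri; tri<; tri≈; tri>)
open import Relation.Binary.PropositionalEquality using (_≡_; _≢_; refl; sym; trans; cong; cong₂; subst; subst₂; ≢-sym; module ≡-Reasoning)
open import Relation.Nullary using (¬_; Dec; yes; no; does; ¬?; _×-dec_; _⊎-dec_)
open import Relation.Nullary.Decidable using (dec-true; dec-false; from-yes; map′; recompute; _→-dec_)
open import Relation.Unary using (Decidable)

-- Why √2: aim at a bound n^(1+γ) log n, with a = n^(1-γ) and d = n^γ. Separating a vertices from n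
-- raises this function by about a · n^γ · log n = n log n, the cost of a cut; without the logarithm
-- the gain would be too small. In the sparse case, d vertices with d triangles each must not fit
-- into 4a vertices, so d² has to exceed a^(1+γ): 2γ ≥ (1-γ)(1+γ), that is (1+γ)² ≥ 2. The least
-- such γ is √2 - 1. The argument stays within natural numbers: powers of n become powers of 2 with
-- rounded exponents, and √2 enters through inequalities between squares. The potential `F` is a sum
-- over i < n of a nondecreasing function of the bit length of i, so that F(a) + F(b) and F(a + b)
-- can be compared term by term. In the upper bound, rainbow triangles are counted as ordered
-- triples within subsets of one vertex set, and almost 3-Gallai means that two vertices have at
-- most one third vertex completing a rainbow triple.

-- Finite sums and counting

∑ : ∀ {A : Set} → List A → (A → ℕ) → ℕ
∑ []       f = 0
∑ (x ∷ xs) f = f x + ∑ xs f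

⟦_⟧ : ∀ {P : Set} → Dec P → ℕ
⟦ yes _ ⟧ = 1
⟦ no _ ⟧  = 0

⟦⟧≤1 : ∀ {P : Set} (p : Dec P) → ⟦ p ⟧ ≤ 1
⟦⟧≤1 (yes _) = ≤-refl
⟦⟧≤1 (no _)  = z≤n

⟦⟧-yes : ∀ {P : Set} (p : Dec P) → P → ⟦ p ⟧ ≡ 1
⟦⟧-yes (yes _) _ = refl
⟦⟧-yes (no ¬p) p = ⊥-elim (¬p p)

⟦⟧-no : ∀ {P : Set} (p : Dec P) → ¬ P → ⟦ p ⟧ ≡ 0
⟦⟧-no (yes p) ¬p = ⊥-elim (¬p p)
⟦⟧-no (no _)  _  = refl

⟦⟧-mono : ∀ {P Q : Set} (p : Dec P) (q : Dec Q) → (P → Q) → ⟦ p ⟧ ≤ ⟦ q ⟧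
⟦⟧-mono (yes p) q f = ≤-reflexive (sym (⟦⟧-yes q (f p)))
⟦⟧-mono (no _)  q f = z≤n

⟦⟧-cover : ∀ {P Q Q′ : Set} (p : Dec P) (q : Dec Q) (q′ : Dec Q′) → (P → Q ⊎ Q′) → ⟦ p ⟧ ≤ ⟦ q ⟧ + ⟦ q′ ⟧
⟦⟧-cover (no _)  q q′ f = z≤n
⟦⟧-cover (yes p) q q′ f with f p
... | inj₁ x rewrite ⟦⟧-yes q x = s≤s z≤n
... | inj₂ x rewrite ⟦⟧-yes q′ x = m≤n+m 1 _

⟦⟧-× : ∀ {P Q : Set} (p : Dec P) (q : Dec Q) → ⟦ p ×-dec q ⟧ ≡ ⟦ p ⟧ * ⟦ q ⟧
⟦⟧-× (yes _) (yes _) = refl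
⟦⟧-× (yes _) (no _)  = refl
⟦⟧-× (no _)  _       = refl

⟦⟧-pos : ∀ {P : Set} (p : Dec P) → 0 < ⟦ p ⟧ → P
⟦⟧-pos (yes p) _ = p

⟦⟧-≤ : ∀ {P : Set} (p : Dec P) → ∀ {n} → (P → 1 ≤ n) → ⟦ p ⟧ ≤ n
⟦⟧-≤ (yes p) f = f p
⟦⟧-≤ (no _)  f = z≤n

1≤⟦⟧ : ∀ {P : Set} (p : Dec P) → P → 1 ≤ ⟦ p ⟧
1≤⟦⟧ d p = ≤-reflexive (sym (⟦⟧-yes d p))

# : ∀ {A : Set} {P : A → Set} → List A → Decidable P → ℕ
# xs P? = ∑ xs λ x → ⟦ P? x ⟧

module _ {A : Set} where

  ∑-mono-∈ : ∀ (xs : List A) {f g : A → ℕ} → (∀ {x} → x ∈ xs → f x ≤ g x) → ∑ xs f ≤ ∑ xs g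
  ∑-mono-∈ []       h = z≤n
  ∑-mono-∈ (x ∷ xs) h = +-mono-≤ (h (here refl)) (∑-mono-∈ xs (h ∘ there))

  ∑-mono : ∀ (xs : List A) {f g : A → ℕ} → (∀ x → f x ≤ g x) → ∑ xs f ≤ ∑ xs g
  ∑-mono xs h = ∑-mono-∈ xs λ {x} _ → h x

  ∑-cong-∈ : ∀ (xs : List A) {f g : A → ℕ} → (∀ {x} → x ∈ xs → f x ≡ g x) → ∑ xs f ≡ ∑ xs g
  ∑-cong-∈ []       h = refl
  ∑-cong-∈ (x ∷ xs) h = cong₂ _+_ (h (here refl)) (∑-cong-∈ xs (h ∘ there))

  ∑-cong : ∀ (xs : List A) {f g : A → ℕ} → (∀ x → f x ≡ g x) → ∑ xs f ≡ ∑ xs g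
  ∑-cong xs h = ∑-cong-∈ xs λ {x} _ → h x

  ∑-const : ∀ (xs : List A) k → ∑ xs (λ _ → k) ≡ length xs * k
  ∑-const []       k = refl
  ∑-const (x ∷ xs) k = cong (k +_) (∑-const xs k)

  ∑-zero : ∀ (xs : List A) → ∑ xs (λ _ → 0) ≡ 0
  ∑-zero xs = trans (∑-const xs 0) (*-zeroʳ (length xs))

  ∑-≤-const : ∀ (xs : List A) {f} {k} → (∀ {x} → x ∈ xs → f x ≤ k) → ∑ xs f ≤ length xs * k
  ∑-≤-const xs {k = k} h = ≤-trans (∑-mono-∈ xs h) (≤-reflexive (∑-const xs k))

  ∑-≤-length : ∀ (xs : List A) {f} → (∀ {x} → x ∈ xs → f x ≤ 1) → ∑ xs f ≤ length xs
  ∑-≤-length xs h = ≤-trans (∑-≤-const xs h) (≤-reflexive (*-identityʳ _))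

  ∑-+ : ∀ (xs : List A) (f g : A → ℕ) → ∑ xs (λ x → f x + g x) ≡ ∑ xs f + ∑ xs g
  ∑-+ []       f g = refl
  ∑-+ (x ∷ xs) f g rewrite ∑-+ xs f g = lemma (f x) (g x) (∑ xs f) (∑ xs g)
    where
    lemma : ∀ a b c d → a + b + (c + d) ≡ a + c + (b + d)
    lemma = solve-∀

  ∑-*ˡ : ∀ (xs : List A) k (f : A → ℕ) → ∑ xs (λ x → k * f x) ≡ k * ∑ xs f
  ∑-*ˡ []       k f = sym (*-zeroʳ k)
  ∑-*ˡ (x ∷ xs) k f rewrite ∑-*ˡ xs k f = sym (*-distribˡ-+ k (f x) (∑ xs f))

  ∑-filter : ∀ {P : A → Set} (P? : Decidable P) (xs : List A) (f : A → ℕ) →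
             ∑ (filter P? xs) f ≡ ∑ xs (λ x → ⟦ P? x ⟧ * f x)
  ∑-filter P? []       f = refl
  ∑-filter P? (x ∷ xs) f with P? x
  ... | yes _ = cong₂ _+_ (sym (+-identityʳ (f x))) (∑-filter P? xs f)
  ... | no _  = ∑-filter P? xs f

  ∑-filter-split : ∀ {P : A → Set} (P? : Decidable P) (xs : List A) (f : A → ℕ) →
                   ∑ xs f ≡ ∑ (filter P? xs) f + ∑ (filter (¬? ∘ P?) xs) f
  ∑-filter-split P? []       f = refl
  ∑-filter-split P? (x ∷ xs) f with P? x
  ... | yes _ = trans (cong (f x +_) (∑-filter-split P? xs f)) (sym (+-assoc (f x) _ _))
  ... | no _  = trans (cong (f x +_) (∑-filter-split P? xs f)) (lemma (f x) (∑ (filter P? xs) f) _)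
    where
    lemma : ∀ a b c → a + (b + c) ≡ b + (a + c)
    lemma = solve-∀

  ∑-positive : ∀ (xs : List A) (f : A → ℕ) → 0 < ∑ xs f → ∃ λ x → x ∈ xs × 0 < f x
  ∑-positive (x ∷ xs) f p with f x in eq
  ... | suc k = x , here refl , subst (0 <_) (sym eq) z<s
  ... | zero  = let y , y∈ , q = ∑-positive xs f p in y , there y∈ , q

  length-# : ∀ {P : A → Set} (P? : Decidable P) (xs : List A) → length (filter P? xs) ≡ # xs P?
  length-# P? []       = refl
  length-# P? (x ∷ xs) with P? x
  ... | yes _ = cong suc (length-# P? xs)
  ... | no _  = length-# P? xs

  length-filter-split : ∀ {P : A → Set} (P? : Decidable P) (xs : List A) →
                        length xs ≡ length (filter P? xs) + length (filter (¬? ∘ P?) xs)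
  length-filter-split P? []       = refl
  length-filter-split P? (x ∷ xs) with P? x
  ... | yes _ = cong suc (length-filter-split P? xs)
  ... | no _  = trans (cong suc (length-filter-split P? xs)) (sym (+-suc _ _))

  module _ {P Q : A → Set} (P? : Decidable P) (Q? : Decidable Q) where

    #-mono : ∀ xs → (∀ {x} → x ∈ xs → P x → Q x) → # xs P? ≤ # xs Q?
    #-mono xs h = ∑-mono-∈ xs λ x∈ → ⟦⟧-mono (P? _) (Q? _) (h x∈)

    #-cover : ∀ {R : A → Set} (R? : Decidable R) xs → (∀ {x} → x ∈ xs → P x → Q x ⊎ R x) →
              # xs P? ≤ # xs Q? + # xs R?
    #-cover R? xs h = ≤-trans (∑-mono-∈ xs λ {x} x∈ → ⟦⟧-cover (P? x) (Q? x) (R? x) (h x∈))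
                              (≤-reflexive (∑-+ xs _ _))

  #-zero : ∀ {P : A → Set} (P? : Decidable P) xs → (∀ {x} → x ∈ xs → ¬ P x) → # xs P? ≡ 0
  #-zero P? []       h = refl
  #-zero P? (x ∷ xs) h = cong₂ _+_ (⟦⟧-no (P? x) (h (here refl))) (#-zero P? xs (h ∘ there))

  #-one : ∀ {P : A → Set} (P? : Decidable P) {xs x} → x ∈ xs → P x → 1 ≤ # xs P?
  #-one P? {y ∷ xs} (here refl) p = ≤-trans (≤-reflexive (sym (⟦⟧-yes (P? y) p))) (m≤m+n _ _)
  #-one P? {y ∷ xs} (there x∈)  p = ≤-trans (#-one P? x∈ p) (m≤n+m _ _)

  #-unique : ∀ {P : A → Set} (P? : Decidable P) {xs} → Unique xs →
             (∀ {x y} → P x → P y → x ≡ y) → # xs P? ≤ 1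
  #-unique P? []              h = z≤n
  #-unique P? {x ∷ xs} (x∉ ∷ u) h with P? x
  ... | no _  = #-unique P? u h
  ... | yes p = ≤-reflexive (cong suc (#-zero P? xs λ y∈ q → All.lookup x∉ y∈ (h p q)))

  unique-filter : ∀ {P : A → Set} (P? : Decidable P) {xs} → Unique xs → Unique (filter P? xs)
  unique-filter P? u = Unique.filter⁺ P? u

  filter-⊆ : ∀ {P : A → Set} (P? : Decidable P) xs {x} → x ∈ filter P? xs → x ∈ xs
  filter-⊆ P? xs x∈ = proj₁ (∈-filter⁻ P? {xs = xs} x∈)

  filter-P : ∀ {P : A → Set} (P? : Decidable P) xs {x} → x ∈ filter P? xs → P x
  filter-P P? xs x∈ = proj₂ (∈-filter⁻ P? {xs = xs} x∈)

∑-swap : ∀ {A B : Set} (xs : List A) (ys : List B) (f : A → B → ℕ) →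
         (∑ xs λ x → ∑ ys λ y → f x y) ≡ (∑ ys λ y → ∑ xs λ x → f x y)
∑-swap []       ys f = sym (∑-zero ys)
∑-swap (x ∷ xs) ys f rewrite ∑-swap xs ys f = sym (∑-+ ys (f x) _)

#-restrict : ∀ {A B : Set} {P : A → Set} {Q : A → B → Set} (xs : List A) (ys : List B) (P? : Decidable P) (Q? : ∀ x y → Dec (Q x y)) →
             (∀ x → # ys (Q? x) ≤ 1) → (∑ xs λ x → # ys λ y → P? x ×-dec Q? x y) ≤ # xs P?
#-restrict xs ys P? Q? h = ∑-mono xs λ x → begin
  # ys (λ y → P? x ×-dec Q? x y)  ≡⟨ ∑-cong ys (λ y → ⟦⟧-× (P? x) (Q? x y)) ⟩
  ∑ ys (λ y → ⟦ P? x ⟧ * ⟦ Q? x y ⟧)  ≡⟨ ∑-*ˡ ys ⟦ P? x ⟧ _ ⟩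
  ⟦ P? x ⟧ * # ys (Q? x)  ≤⟨ *-monoʳ-≤ ⟦ P? x ⟧ (h x) ⟩
  ⟦ P? x ⟧ * 1  ≡⟨ *-identityʳ _ ⟩
  ⟦ P? x ⟧  ∎
  where open ≤-Reasoning

∑-+₄ : ∀ {A : Set} (xs : List A) (f g h k : A → ℕ) →
       ∑ xs (λ x → f x + (g x + (h x + k x))) ≡ ∑ xs f + (∑ xs g + (∑ xs h + ∑ xs k))
∑-+₄ xs f g h k = trans (∑-+ xs f _) (cong (∑ xs f +_) (trans (∑-+ xs g _) (cong (∑ xs g +_) (∑-+ xs h k))))

∑³ : ∀ {A : Set} → List A → (A → A → A → ℕ) → ℕ
∑³ xs f = ∑ xs λ x → ∑ xs λ y → ∑ xs λ z → f x y z

∑³-+₄ : ∀ {A : Set} (xs : List A) (f g h k : A → A → A → ℕ) →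
        ∑³ xs (λ x y z → f x y z + (g x y z + (h x y z + k x y z))) ≡ ∑³ xs f + (∑³ xs g + (∑³ xs h + ∑³ xs k))
∑³-+₄ xs f g h k = trans
  (∑-cong xs λ x → trans (∑-cong xs λ y → ∑-+₄ xs (f x y) (g x y) (h x y) (k x y))
                         (∑-+₄ xs _ _ _ _))
  (∑-+₄ xs _ _ _ _)

∑³-rotate : ∀ {A : Set} (xs : List A) (f : A → A → A → ℕ) → ∑³ xs (λ x y z → f y z x) ≡ ∑³ xs f
∑³-rotate xs f = trans (∑-swap xs xs _) (∑-cong xs λ y → ∑-swap xs xs _)

∑³-swap₂ : ∀ {A : Set} (xs : List A) (f : A → A → A → ℕ) → ∑³ xs (λ x y z → f x z y) ≡ ∑³ xs f
∑³-swap₂ xs f = ∑-cong xs λ x → ∑-swap xs xs _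

∑³-mono : ∀ {A : Set} (xs : List A) {f g : A → A → A → ℕ} → (∀ x y z → f x y z ≤ g x y z) → ∑³ xs f ≤ ∑³ xs g
∑³-mono xs h = ∑-mono xs λ x → ∑-mono xs λ y → ∑-mono xs λ z → h x y z

∑³-+ : ∀ {A : Set} (xs : List A) (f g : A → A → A → ℕ) → ∑³ xs (λ x y z → f x y z + g x y z) ≡ ∑³ xs f + ∑³ xs g
∑³-+ xs f g = trans (∑-cong xs λ x → trans (∑-cong xs λ y → ∑-+ xs (f x y) (g x y)) (∑-+ xs _ _)) (∑-+ xs _ _)

#-weighted : ∀ {A B : Set} {P : A → Set} {Q : A → B → Set} (xs : List A) (ys : List B) (P? : Decidable P) (Q? : ∀ x y → Dec (Q x y)) K →
             (∀ {x} → x ∈ xs → P x → # ys (Q? x) ≤ K) → (∑ xs λ x → # ys λ y → P? x ×-dec Q? x y) ≤ # xs P? * K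
#-weighted xs ys P? Q? K h = ≤-trans (∑-mono-∈ xs λ {x} x∈ → go x∈ (P? x)) (≤-reflexive (trans (∑-cong xs λ x → *-comm ⟦ P? x ⟧ K) (trans (∑-*ˡ xs K _) (*-comm K _))))
  where
  go : ∀ {x} → x ∈ xs → (d : Dec _) → (# ys λ y → d ×-dec Q? x y) ≤ ⟦ d ⟧ * K
  go {x} x∈ (yes p) = ≤-trans (≤-reflexive (∑-cong ys λ y → trans (⟦⟧-× (yes p) (Q? x y)) (+-identityʳ _))) (≤-trans (h x∈ p) (m≤m+n K 0))
  go x∈ (no _) = ≤-reflexive (∑-zero ys)

-- Bit length and the isoperimetric function

2*-suc : ∀ k → 2 ^ suc k ≡ 2 ^ k + 2 ^ k
2*-suc k = cong (2 ^ k +_) (+-identityʳ (2 ^ k))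

Σ< : ℕ → (ℕ → ℕ) → ℕ
Σ< zero    f = 0
Σ< (suc n) f = Σ< n f + f n

Σ<-mono : ∀ n {f g : ℕ → ℕ} → (∀ i → i < n → f i ≤ g i) → Σ< n f ≤ Σ< n g
Σ<-mono zero    h = z≤n
Σ<-mono (suc n) h = +-mono-≤ (Σ<-mono n λ i i<n → h i (m<n⇒m<1+n i<n)) (h n ≤-refl)

Σ<-const : ∀ n c → Σ< n (λ _ → c) ≡ n * c
Σ<-const zero    c = refl
Σ<-const (suc n) c = trans (cong (_+ c) (Σ<-const n c)) (+-comm (n * c) c)

Σ<-+ : ∀ n (f g : ℕ → ℕ) → Σ< n (λ i → f i + g i) ≡ Σ< n f + Σ< n g
Σ<-+ zero    f g = refl
Σ<-+ (suc n) f g rewrite Σ<-+ n f g = lemma (Σ< n f) (Σ< n g) (f n) (g n)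
  where
  lemma : ∀ a b c d → a + b + (c + d) ≡ a + c + (b + d)
  lemma = solve-∀

Σ<-append : ∀ a b (f : ℕ → ℕ) → Σ< (a + b) f ≡ Σ< a f + Σ< b (λ i → f (a + i))
Σ<-append a zero    f = trans (cong (λ t → Σ< t f) (+-identityʳ a)) (sym (+-identityʳ _))
Σ<-append a (suc b) f rewrite +-suc a b | Σ<-append a b f = +-assoc (Σ< a f) _ _

Σ<-monoˡ : ∀ {m n} (f : ℕ → ℕ) → m ≤ n → Σ< m f ≤ Σ< n f
Σ<-monoˡ {m} {n} f m≤n = begin
  Σ< m f  ≤⟨ m≤m+n _ _ ⟩
  Σ< m f + Σ< (n ∸ m) (λ i → f (m + i))  ≡⟨ Σ<-append m (n ∸ m) f ⟨
  Σ< (m + (n ∸ m)) f  ≡⟨ cong (λ t → Σ< t f) (m+[n∸m]≡n m≤n) ⟩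
  Σ< n f  ∎
  where open ≤-Reasoning

abstract
  -- Bit length: the least k with n < 2 ^ k.
  L : ℕ → ℕ
  L zero    = 0
  L (suc n) with suc n <? 2 ^ L n
  ... | yes _ = L n
  ... | no _  = suc (L n)

  n<2^L : ∀ n → n < 2 ^ L n
  n<2^L zero    = z<s
  n<2^L (suc n) with suc n <? 2 ^ L n
  ... | yes p = p
  ... | no _  = begin-strict
    suc n  ≤⟨ n<2^L n ⟩
    2 ^ L n  <⟨ m<m+n (2 ^ L n) (m^n>0 2 (L n)) ⟩
    2 ^ L n + 2 ^ L n   ≡⟨ 2*-suc (L n) ⟨
    2 ^ suc (L n)  ∎
    where open ≤-Reasoning

  L-least : ∀ n k → L n ≡ suc k → 2 ^ k ≤ n
  L-least (suc n) k eq with suc n <? 2 ^ L n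
  ... | yes _ = m≤n⇒m≤1+n (L-least n k eq)
  ... | no p  = subst (λ t → 2 ^ t ≤ suc n) (cong ℕ.pred eq) (≮⇒≥ p)

^2-cancel-< : ∀ {a b} → 2 ^ a < 2 ^ b → a < b
^2-cancel-< p = ≰⇒> λ b≤a → <⇒≱ p (^-monoʳ-≤ 2 b≤a)

L-≤ : ∀ {n k} → n < 2 ^ k → L n ≤ k
L-≤ {n} {k} p with L n in eq
... | zero  = z≤n
... | suc l = ^2-cancel-< (≤-<-trans (L-least n l eq) p)

L-> : ∀ {n k} → 2 ^ k ≤ n → k < L n
L-> {n} p = ^2-cancel-< (≤-<-trans p (n<2^L n))

L-mono : ∀ {m n} → m ≤ n → L m ≤ L n
L-mono {m} {n} m≤n = L-≤ (≤-<-trans m≤n (n<2^L n))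

-- The sum b + i exceeds 2i, so its binary expansion has at least one more digit.
L-double : ∀ {i b} → i < b → L i < L (b + i)
L-double {i} {b} i<b with L i in eq
... | zero  = L-> (≤-trans (≤-trans (s≤s z≤n) i<b) (m≤m+n b i))
... | suc k = L-> (begin
  2 ^ suc k  ≡⟨ 2*-suc k ⟩
  2 ^ k + 2 ^ k   ≤⟨ +-mono-≤ (≤-trans (L-least i k eq) (<⇒≤ i<b)) (L-least i k eq) ⟩
  b + i  ∎)
  where open ≤-Reasoning

-- An upper estimate for the number of edges induced by n vertices of a cube, whose exact maximum is
-- the sum of the binary digit sums of all i < n. Bit lengths instead of digit sums lose a constant
-- factor and make merging a termwise comparison.
Iso : ℕ → ℕ
Iso n = Σ< n L

-- The terms of the shorter sum are moved on top of the longer one: index i becomes b + i and gains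
-- a bit.
Iso-step : ∀ a b → a ≤ b → Iso a + Iso b + a ≤ Iso (a + b)
Iso-step a b a≤b = begin
  Iso a + Iso b + a  ≡⟨ lemma (Iso a) (Iso b) a ⟩
  Iso b + (Iso a + a * 1)  ≡⟨ cong (λ t → Iso b + (Iso a + t)) (Σ<-const a 1) ⟨
  Iso b + (Iso a + Σ< a (λ _ → 1))  ≡⟨ cong (Iso b +_) (Σ<-+ a L (λ _ → 1)) ⟨
  Iso b + Σ< a (λ i → L i + 1)  ≤⟨ +-monoʳ-≤ (Iso b) (Σ<-mono a λ i i<a →
                                             ≤-trans (≤-reflexive (+-comm (L i) 1)) (L-double (<-≤-trans i<a a≤b))) ⟩
  Iso b + Σ< a (λ i → L (b + i))  ≡⟨ Σ<-append b a L ⟨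
  Iso (b + a)  ≡⟨ cong Iso (+-comm b a) ⟩
  Iso (a + b)  ∎
  where
  open ≤-Reasoning
  lemma : ∀ x y z → x + y + z ≡ y + (x + z * 1)
  lemma = solve-∀

Iso-merge : ∀ a b c → c ≤ a → c ≤ b → Iso a + Iso b + c ≤ Iso (a + b)
Iso-merge a b c c≤a c≤b with ≤-total a b
... | inj₁ a≤b = ≤-trans (+-monoʳ-≤ (Iso a + Iso b) c≤a) (Iso-step a b a≤b)
... | inj₂ b≤a = begin
  Iso a + Iso b + c   ≡⟨ cong (_+ c) (+-comm (Iso a) (Iso b)) ⟩
  Iso b + Iso a + c   ≤⟨ +-monoʳ-≤ (Iso b + Iso a) c≤b ⟩
  Iso b + Iso a + b   ≤⟨ Iso-step b a b≤a ⟩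
  Iso (b + a)  ≡⟨ cong Iso (+-comm b a) ⟩
  Iso (a + b)  ∎
  where open ≤-Reasoning

Iso-≤ : ∀ n k → n ≤ 2 ^ k → Iso n ≤ n * k
Iso-≤ n k p = ≤-trans (Σ<-mono n λ i i<n → L-≤ (<-≤-trans i<n p)) (≤-reflexive (Σ<-const n k))

-- Integer approximation of √2

square-cancel-≤ : ∀ {a b} → a * a ≤ b * b → a ≤ b
square-cancel-≤ {a} {b} p = ≮⇒≥ λ b<a → <⇒≱ (*-mono-< b<a b<a) p

-- The crude e ≤ 2(k + 1) suffices, since 2(k + 2)² exceeds 2(k + 1)² by 4(k + 1) + 2.
δ-step-aux : ∀ k e → e * e ≤ 2 * (suc k * suc k) → suc e * suc e ≤ 2 * (suc (suc k) * suc (suc k))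
δ-step-aux k e p = begin
  suc e * suc e  ≡⟨ lemma₁ e ⟩
  e * e + (2 * e + 1)  ≤⟨ +-mono-≤ p (+-monoˡ-≤ 1 (*-monoʳ-≤ 2 e≤)) ⟩
  2 * (suc k * suc k) + (2 * (2 * suc k) + 1)  ≤⟨ m≤m+n _ 1 ⟩
  2 * (suc k * suc k) + (2 * (2 * suc k) + 1) + 1 ≡⟨ lemma₂ k ⟩
  2 * (suc (suc k) * suc (suc k))  ∎
  where
  open ≤-Reasoning
  lemma₁ : ∀ e → (1 + e) * (1 + e) ≡ e * e + (2 * e + 1)
  lemma₁ = solve-∀
  lemma₂ : ∀ k → 2 * ((1 + k) * (1 + k)) + (2 * (2 * (1 + k)) + 1) + 1 ≡ 2 * ((2 + k) * (2 + k))
  lemma₂ = solve-∀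
  lemma₃ : ∀ x → 2 * (x * x) + 2 * (x * x) ≡ (2 * x) * (2 * x)
  lemma₃ = solve-∀
  e≤ : e ≤ 2 * suc k
  e≤ = square-cancel-≤ (≤-trans p (≤-trans (m≤m+n _ (2 * (suc k * suc k))) (≤-reflexive (lemma₃ (suc k)))))

abstract
  -- k + δ k approximates √2 k from above, up to a bounded error.
  δ : ℕ → ℕ
  δ zero    = 0
  δ (suc k) with 2 * (suc k * suc k) ≤? (suc k + δ k) * (suc k + δ k)
  ... | yes _ = δ k
  ... | no _  = suc (δ k)

  δ-lower : ∀ k → 2 * (k * k) ≤ (k + δ k) * (k + δ k)
  δ-lower zero    = z≤n
  δ-lower (suc k) with 2 * (suc k * suc k) ≤? (suc k + δ k) * (suc k + δ k)
  ... | yes p = p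
  ... | no _  = begin
    2 * (suc k * suc k)  ≤⟨ m≤m+n _ (2 + 4 * δ k) ⟩
    2 * (suc k * suc k) + (2 + 4 * δ k)  ≡⟨ lemma₁ k (δ k) ⟩
    2 * (k * k) + (4 + 4 * (k + δ k))  ≤⟨ +-monoˡ-≤ _ (δ-lower k) ⟩
    (k + δ k) * (k + δ k) + (4 + 4 * (k + δ k))  ≡⟨ lemma₂ k (δ k) ⟩
    (suc k + suc (δ k)) * (suc k + suc (δ k))  ∎
    where
    open ≤-Reasoning
    lemma₁ : ∀ k d → 2 * ((1 + k) * (1 + k)) + (2 + 4 * d) ≡ 2 * (k * k) + (4 + 4 * (k + d))
    lemma₁ = solve-∀
    lemma₂ : ∀ k d → (k + d) * (k + d) + (4 + 4 * (k + d)) ≡ (1 + k + (1 + d)) * (1 + k + (1 + d))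
    lemma₂ = solve-∀

  δ-upper : ∀ k → (k + δ k) * (k + δ k) ≤ 2 * (suc k * suc k)
  δ-upper zero    = z≤n
  δ-upper (suc k) with 2 * (suc k * suc k) ≤? (suc k + δ k) * (suc k + δ k)
  ... | yes _ = δ-step-aux k (k + δ k) (δ-upper k)
  ... | no p  = subst (λ t → t * t ≤ 2 * (suc (suc k) * suc (suc k))) (cong suc (sym (+-suc k (δ k))))
                  (δ-step-aux k (suc (k + δ k)) (<⇒≤ (≰⇒> p)))

  δ-suc-≤ : ∀ k → δ (suc k) ≤ suc (δ k)
  δ-suc-≤ k with 2 * (suc k * suc k) ≤? (suc k + δ k) * (suc k + δ k)
  ... | yes _ = n≤1+n _
  ... | no _  = ≤-refl

  δ-suc-≥ : ∀ k → δ k ≤ δ (suc k)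
  δ-suc-≥ k with 2 * (suc k * suc k) ≤? (suc k + δ k) * (suc k + δ k)
  ... | yes _ = ≤-refl
  ... | no _  = n≤1+n _

δ-mono : ∀ {j k} → j ≤ k → δ j ≤ δ k
δ-mono {j} {zero}  z≤n = ≤-refl
δ-mono {j} {suc k} j≤ with m≤n⇒m<n∨m≡n j≤
... | inj₁ (s≤s p) = ≤-trans (δ-mono p) (δ-suc-≥ k)
... | inj₂ refl    = ≤-refl

-- A form of √2 - 1 ≥ 1/3: otherwise k + δ k < 4k/3, whereas (4/3)² < 2.
k≤3δ : ∀ k → k ≤ 3 * δ k
k≤3δ k = ≮⇒≥ λ 3δ<k → <⇒≱ (small 3δ<k) (*-monoʳ-≤ 9 (δ-lower k))
  where
  open ≤-Reasoning
  lemma₁ : ∀ k d → 9 * ((k + d) * (k + d)) ≡ (3 * k + 3 * d) * (3 * k + 3 * d)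
  lemma₁ = solve-∀
  lemma₂ : ∀ k → (3 * k + k) * (3 * k + k) ≡ 16 * (k * k)
  lemma₂ = solve-∀
  lemma₃ : ∀ k → 16 * (k * k) + 2 * (k * k) ≡ 9 * (2 * (k * k))
  lemma₃ = solve-∀
  small : 3 * δ k < k → 9 * ((k + δ k) * (k + δ k)) < 9 * (2 * (k * k))
  small p = begin-strict
    9 * ((k + δ k) * (k + δ k))  ≡⟨ lemma₁ k (δ k) ⟩
    (3 * k + 3 * δ k) * (3 * k + 3 * δ k)  ≤⟨ *-mono-≤ (+-monoʳ-≤ (3 * k) (<⇒≤ p)) (+-monoʳ-≤ (3 * k) (<⇒≤ p)) ⟩
    (3 * k + k) * (3 * k + k)  ≡⟨ lemma₂ k ⟩
    16 * (k * k)  <⟨ m<m+n _ (positive (≤-<-trans z≤n p)) ⟩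
    16 * (k * k) + 2 * (k * k)  ≡⟨ lemma₃ k ⟩
    9 * (2 * (k * k))  ∎
    where
    positive : ∀ {k} → 0 < k → 0 < 2 * (k * k)
    positive {suc k} _ = z<s

-- Makes the exponent k - δ k - 3 of the threshold a nonnegative. From k = 6 on, δ k ≥ k - 2
-- contradicts (k + δ k)² ≤ 2(k + 1)².
δ+3≤k : ∀ k → 6 ≤ k → δ k + 3 ≤ k
δ+3≤k k 6≤k = ≮⇒≥ λ k<δ+3 → <⇒≱ (big (+-cancelʳ-≤ 1 k (δ k + 2) (≤-trans (≤-reflexive (+-comm k 1)) (≤-trans k<δ+3 (≤-reflexive (sym (+-assoc (δ k) 2 1))))))) (δ-upper k)
  where
  open ≤-Reasoning
  big : k ≤ δ k + 2 → 2 * (suc k * suc k) < (k + δ k) * (k + δ k)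
  big p with m≤n⇒∃[o]m+o≡n 6≤k
  ... | o , refl = begin-strict
    2 * (suc (6 + o) * suc (6 + o))  <⟨ m<m+n _ {2 + 12 * o + 2 * (o * o)} z<s ⟩
    2 * (suc (6 + o) * suc (6 + o)) + (2 + 12 * o + 2 * (o * o)) ≡⟨ lemma o ⟩
    (6 + o + (4 + o)) * (6 + o + (4 + o))  ≤⟨ *-mono-≤ q q ⟩
    (6 + o + δ (6 + o)) * (6 + o + δ (6 + o))  ∎
    where
    lemma : ∀ o → 2 * ((7 + o) * (7 + o)) + (2 + 12 * o + 2 * (o * o)) ≡ (6 + o + (4 + o)) * (6 + o + (4 + o))
    lemma = solve-∀
    q : 6 + o + (4 + o) ≤ 6 + o + δ (6 + o)
    q = +-monoʳ-≤ (6 + o) (+-cancelʳ-≤ 2 _ _ (≤-trans (≤-reflexive (+-comm (4 + o) 2)) p))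

-- The exponent √2 enters here: (k − δ)² ≤ 2δ² is equivalent to 2k² ≤ (k + δ)².
δ-critical : ∀ k j → suc j + δ k ≡ k → j + δ j ≤ 2 * δ k
δ-critical k j eq = square-cancel-≤ (begin
  (j + δ j) * (j + δ j)  ≤⟨ δ-upper j ⟩
  2 * (suc j * suc j)  ≤⟨ *-monoʳ-≤ 2 key ⟩
  2 * (2 * (δ k * δ k))  ≡⟨ lemma₁ (δ k) ⟩
  2 * δ k * (2 * δ k)  ∎)
  where
  open ≤-Reasoning
  lemma₁ : ∀ d → 2 * (2 * (d * d)) ≡ 2 * d * (2 * d)
  lemma₁ = solve-∀
  lemma₂ : ∀ x d → 2 * ((x + d) * (x + d)) ≡ x * x + (x * x + 4 * x * d + 2 * (d * d))
  lemma₂ = solve-∀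
  lemma₃ : ∀ x d → (x + d + d) * (x + d + d) ≡ 2 * (d * d) + (x * x + 4 * x * d + 2 * (d * d))
  lemma₃ = solve-∀
  key : suc j * suc j ≤ 2 * (δ k * δ k)
  key = +-cancelʳ-≤ (suc j * suc j + 4 * suc j * δ k + 2 * (δ k * δ k)) _ _ (begin
    suc j * suc j + _  ≡⟨ lemma₂ (suc j) (δ k) ⟨
    2 * ((suc j + δ k) * (suc j + δ k))  ≡⟨ cong (λ t → 2 * (t * t)) eq ⟩
    2 * (k * k)  ≤⟨ δ-lower k ⟩
    (k + δ k) * (k + δ k)  ≡⟨ cong (λ t → (t + δ k) * (t + δ k)) eq ⟨
    (suc j + δ k + δ k) * (suc j + δ k + δ k) ≡⟨ lemma₃ (suc j) (δ k) ⟩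
    2 * (δ k * δ k) + _  ∎)

-- Edges of the cube

-- The edge-isoperimetric inequality of the cube, for families of rows with repetitions.
module Isoperimetry {A V : Set} (b b′ : A → V → Bool)
  {E : A → A → V → Set} (E? : ∀ x y p → Dec (E x y p))
  (differ : ∀ {x y p} → E x y p → b x p ≢ b′ y p)
  (functional : ∀ {x y y′ p} → E x y p → E x y′ p → y ≡ y′)
  (injective : ∀ {x x′ y p} → E x y p → E x′ y p → x ≡ x′)
  where

  edges# : List A → List A → List V → ℕ
  edges# X Y ps = ∑ X λ x → ∑ Y λ y → # ps (E? x y)

  module _ (p : V) (qs : List V) where
    one? : ∀ x → Dec (b x p ≡ true)
    one? x = b x p Bool.≟ true

    one′? : ∀ y → Dec (b′ y p ≡ true)
    one′? y = b′ y p Bool.≟ true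

    same : ∀ X Y → (∀ {x y} → x ∈ X → y ∈ Y → b x p ≡ b′ y p) → edges# X Y (p ∷ qs) ≤ edges# X Y qs
    same X Y h = ∑-mono-∈ X λ x∈ → ∑-mono-∈ Y λ y∈ →
      ≤-reflexive (cong (_+ # qs _) (⟦⟧-no (E? _ _ p) λ e → differ e (h x∈ y∈)))

    module _ (p∉ : All (p ≢_) qs) (X Y : List A) (uX : Unique X) (uY : Unique Y)
      (agree : ∀ {x y q r} → E x y q → r ∈ p ∷ qs → r ≢ q → b x r ≡ b′ y r)
      (h : ∀ {x y} → x ∈ X → y ∈ Y → b x p ≢ b′ y p) where

      -- The rows of an edge agree outside its direction, and X and Y disagree at p, so every edge
      -- has direction p. Its edges form a matching, which bounds their number by either side even
      -- if rows repeat.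
      single : edges# X Y (p ∷ qs) ≤ ∑ X λ x → # Y λ y → E? x y p
      single = ∑-mono-∈ X λ {x} x∈ → ∑-mono-∈ Y λ {y} y∈ → ≤-reflexive
        (trans (cong (⟦ E? x y p ⟧ +_) (#-zero (E? x y) qs λ q∈ e →
                  h x∈ y∈ (agree e (here refl) (All.lookup p∉ q∈))))
               (+-identityʳ _))

      crossˡ : edges# X Y (p ∷ qs) ≤ length X
      crossˡ = ≤-trans single (∑-≤-length X λ {x} _ → #-unique (λ y → E? x y p) uY functional)

      crossʳ : edges# X Y (p ∷ qs) ≤ length Y
      crossʳ = ≤-trans single (≤-trans (≤-reflexive (∑-swap X Y _))
        (∑-≤-length Y λ {y} _ → #-unique (λ x → E? x y p) uX injective))

  edges#-split : ∀ {P Q : A → Set} (P? : Decidable P) (Q? : Decidable Q) X Y ps → edges# X Y ps ≡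
    edges# (filter P? X) (filter Q? Y) ps + edges# (filter P? X) (filter (¬? ∘ Q?) Y) ps +
    (edges# (filter (¬? ∘ P?) X) (filter Q? Y) ps + edges# (filter (¬? ∘ P?) X) (filter (¬? ∘ Q?) Y) ps)
  edges#-split P? Q? X Y ps = trans (∑-filter-split P? X _)
    (cong₂ _+_ (half (filter P? X)) (half (filter (¬? ∘ P?) X)))
    where
    half : ∀ X → edges# X Y ps ≡ edges# X (filter Q? Y) ps + edges# X (filter (¬? ∘ Q?) Y) ps
    half X = trans (∑-cong X λ x → ∑-filter-split Q? Y _) (∑-+ X _ _)

  -- Induction on the columns. When the rows are split by their entry at p, edges of the other
  -- directions stay within a half, and those of direction p are matchings between the halves.
  bound : ∀ ps → Unique ps → (∀ {x y q r} → E x y q → r ∈ ps → r ≢ q → b x r ≡ b′ y r) →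
          ∀ X Y → Unique X → Unique Y → edges# X Y ps ≤ Iso (length X + length Y)
  bound []       _        agree X Y uX uY = ≤-trans (≤-reflexive
    (trans (∑-cong X λ _ → ∑-zero Y) (∑-zero X))) z≤n
  bound (p ∷ qs) (p∉ ∷ u) agree X Y uX uY = begin
    edges# X Y (p ∷ qs)
      ≡⟨ edges#-split P? Q? X Y (p ∷ qs) ⟩
    e X₁ Y₁ + e X₁ Y₀ + (e X₀ Y₁ + e X₀ Y₀)
      ≡⟨ lemma₁ (e X₁ Y₁) (e X₁ Y₀) (e X₀ Y₁) (e X₀ Y₀) ⟩
    e X₁ Y₁ + e X₀ Y₀ + (e X₁ Y₀ + e X₀ Y₁)
      ≤⟨ +-monoˡ-≤ _ (+-mono-≤ (≤-trans (same p qs X₁ Y₁ λ x∈ y∈ → trans (in₁ x∈) (sym (in₁′ y∈))) (rec X₁ Y₁ uX₁ uY₁))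
                               (≤-trans (same p qs X₀ Y₀ λ x∈ y∈ → trans (in₀ x∈) (sym (in₀′ y∈))) (rec X₀ Y₀ uX₀ uY₀))) ⟩
    Iso n₁ + Iso n₀ + (e X₁ Y₀ + e X₀ Y₁)
      -- Of the two crossing parts, one is charged to rows of X and the other to rows of Y, so that
      -- both charges fall into the same half.
      ≤⟨ Iso-merge n₁ n₀ _
           (+-mono-≤ (crossˡ p qs p∉ X₁ Y₀ uX₁ uY₀ agree apart₁) (crossʳ p qs p∉ X₀ Y₁ uX₀ uY₁ agree apart₀))
           (≤-trans (+-mono-≤ (crossʳ p qs p∉ X₁ Y₀ uX₁ uY₀ agree apart₁) (crossˡ p qs p∉ X₀ Y₁ uX₀ uY₁ agree apart₀))
                    (≤-reflexive (+-comm (length Y₀) (length X₀)))) ⟩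
    Iso (n₁ + n₀)
      ≡⟨ cong Iso (lemma₁ (length X₁) (length Y₁) (length X₀) (length Y₀)) ⟩
    Iso (length X₁ + length Y₀ + (length Y₁ + length X₀))
      ≡⟨ cong Iso (lemma₂ (length X₁) (length Y₀) (length Y₁) (length X₀)) ⟩
    Iso (length X₁ + length X₀ + (length Y₁ + length Y₀))
      ≡⟨ cong Iso (cong₂ _+_ (length-filter-split P? X) (length-filter-split Q? Y)) ⟨
    Iso (length X + length Y) ∎
    where
    open ≤-Reasoning
    P? = one? p qs
    Q? = one′? p qs
    X₁ = filter P? X
    X₀ = filter (¬? ∘ P?) X
    Y₁ = filter Q? Y
    Y₀ = filter (¬? ∘ Q?) Y
    e : List A → List A → ℕ
    e X Y = edges# X Y (p ∷ qs)
    n₁ = length X₁ + length Y₁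
    n₀ = length X₀ + length Y₀
    uX₁ = unique-filter P? uX
    uX₀ = unique-filter (¬? ∘ P?) uX
    uY₁ = unique-filter Q? uY
    uY₀ = unique-filter (¬? ∘ Q?) uY
    rec = bound qs u (λ e r∈ → agree e (there r∈))
    in₁ : ∀ {x} → x ∈ X₁ → b x p ≡ true
    in₁ = filter-P P? X
    in₁′ : ∀ {y} → y ∈ Y₁ → b′ y p ≡ true
    in₁′ = filter-P Q? Y
    in₀ : ∀ {x} → x ∈ X₀ → b x p ≡ false
    in₀ x∈ = Bool.¬-not (filter-P (¬? ∘ P?) X x∈)
    in₀′ : ∀ {y} → y ∈ Y₀ → b′ y p ≡ false
    in₀′ y∈ = Bool.¬-not (filter-P (¬? ∘ Q?) Y y∈)
    apart₁ : ∀ {x y} → x ∈ X₁ → y ∈ Y₀ → b x p ≢ b′ y p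
    apart₁ x∈ y∈ eq = filter-P (¬? ∘ Q?) Y y∈ (trans (sym eq) (in₁ x∈))
    apart₀ : ∀ {x y} → x ∈ X₀ → y ∈ Y₁ → b x p ≢ b′ y p
    apart₀ x∈ y∈ eq = filter-P (¬? ∘ P?) X x∈ (trans eq (in₁′ y∈))
    lemma₁ : ∀ a b c d → a + b + (c + d) ≡ a + d + (b + c)
    lemma₁ = solve-∀
    lemma₂ : ∀ a b c d → a + b + (c + d) ≡ a + d + (c + b)
    lemma₂ = solve-∀

-- Three colours and rainbow triples

third? : Dec (∀ (i j a b : Fin 3) → i ≢ j → a ≢ i → a ≢ j → b ≢ i → b ≢ j → a ≡ b)
third? = all? λ i → all? λ j → all? λ a → all? λ b →
  ¬? (i ≟ j) →-dec ¬? (a ≟ i) →-dec ¬? (a ≟ j) →-dec ¬? (b ≟ i) →-dec ¬? (b ≟ j) →-dec a ≟ b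

third : ∀ (i j a b : Fin 3) → i ≢ j → a ≢ i → a ≢ j → b ≢ i → b ≢ j → a ≡ b
third = from-yes third?

-- Abstract, so that sums over the three colours are not unfolded.
abstract
  palette : List (Fin 3)
  palette = allFin 3

  ∈palette : ∀ i → i ∈ palette
  ∈palette = ∈-allFin

  length-palette : length palette ≡ 3
  length-palette = refl

  ∑-palette : ∀ f → ∑ palette f ≡ f 0F + (f 1F + f 2F)
  ∑-palette f = cong (λ t → f 0F + (f 1F + t)) (+-identityʳ _)

  palette-once : ∀ c → # palette (λ i → c ≟ i) ≡ 1
  palette-once 0F = refl
  palette-once 1F = refl
  palette-once 2F = refl

Mode : Set
Mode = Fin 3 × Bool × Bool

abstract
  modes : List Mode
  modes = cartesianProduct (allFin 3) (cartesianProduct (true ∷ false ∷ []) (true ∷ false ∷ []))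

  length-modes : length modes ≡ 12
  length-modes = refl

  ∈modes : ∀ m → m ∈ modes
  ∈modes (i , ε , ε′) = ∈-cartesianProduct⁺ (∈-allFin i) (∈-cartesianProduct⁺ (∈bools ε) (∈bools ε′))
    where
    ∈bools : ∀ b → b ∈ true ∷ false ∷ []
    ∈bools true  = here refl
    ∈bools false = there (here refl)

RainbowTriple : ∀ {n : ℕ} → (Fin n → Fin n → Fin 3) → Fin n → Fin n → Fin n → Set
RainbowTriple col x y z = col x y ≢ col y z × col y z ≢ col x z × col x y ≢ col x z

module Graph {n : ℕ} (col : Fin n → Fin n → Fin 3) (col-sym : ∀ x y → col x y ≡ col y x) where

  V = Fin n

  R : V → V → V → Set
  R = RainbowTriple col

  R? : ∀ x y z → Dec (R x y z)
  R? x y z = ¬? (col x y ≟ col y z) ×-dec ¬? (col y z ≟ col x z) ×-dec ¬? (col x y ≟ col x z)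

  R-swap₁ : ∀ {x y z} → R x y z → R y x z
  R-swap₁ {x} {y} {z} (p , q , r) rewrite col-sym x y = r , ≢-sym q , p

  R-swap₂ : ∀ {x y z} → R x y z → R x z y
  R-swap₂ {x} {y} {z} (p , q , r) rewrite col-sym y z = ≢-sym q , ≢-sym p , ≢-sym r

  R-rotate : ∀ {x y z} → R x y z → R y z x
  R-rotate r = R-swap₂ (R-swap₁ r)

  -- Each rainbow triangle is counted six times, once for every order of its vertices.
  T3 : List V → ℕ
  T3 S = ∑ S λ x → ∑ S λ y → # S (R? x y)

  colours : ∀ {x y z a b c} → col x y ≡ a → col y z ≡ b → col x z ≡ c →
            a ≢ b → b ≢ c → a ≢ c → R x y z
  colours refl refl refl p q r = p , q , r

  dichotomy : ∀ q p r → col q p ≢ col q r → ¬ R q p r → col p r ≡ col q p ⊎ col p r ≡ col q r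
  dichotomy q p r d ¬R with col p r ≟ col q p | col p r ≟ col q r
  ... | yes e | _     = inj₁ e
  ... | no _  | yes e = inj₂ e
  ... | no e  | no f  = ⊥-elim (¬R (≢-sym e , f , d))

  T3-filter : ∀ {P : V → Set} (P? : Decidable P) S →
              T3 (filter P? S) ≡ ∑³ S λ x y z → ⟦ P? x ×-dec P? y ×-dec P? z ×-dec R? x y z ⟧
  T3-filter P? S = begin-equality
    T3 (filter P? S)
      ≡⟨ ∑-filter P? S _ ⟩
    (∑ S λ x → ⟦ P? x ⟧ * (∑ (filter P? S) λ y → # (filter P? S) (R? x y)))
      ≡⟨ ∑-cong S (λ x → trans (cong (⟦ P? x ⟧ *_) (∑-filter P? S _))
           (sym (∑-*ˡ S ⟦ P? x ⟧ (λ y → ⟦ P? y ⟧ * # (filter P? S) (R? x y))))) ⟩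
    (∑ S λ x → ∑ S λ y → ⟦ P? x ⟧ * (⟦ P? y ⟧ * # (filter P? S) (R? x y)))
      ≡⟨ ∑-cong S (λ x → ∑-cong S λ y → begin-equality
           ⟦ P? x ⟧ * (⟦ P? y ⟧ * # (filter P? S) (R? x y))
             ≡⟨ cong (λ t → ⟦ P? x ⟧ * (⟦ P? y ⟧ * t)) (∑-filter P? S _) ⟩
           ⟦ P? x ⟧ * (⟦ P? y ⟧ * (∑ S λ z → ⟦ P? z ⟧ * ⟦ R? x y z ⟧))
             ≡⟨ cong (⟦ P? x ⟧ *_) (sym (∑-*ˡ S ⟦ P? y ⟧ (λ z → ⟦ P? z ⟧ * ⟦ R? x y z ⟧))) ⟩
           ⟦ P? x ⟧ * (∑ S λ z → ⟦ P? y ⟧ * (⟦ P? z ⟧ * ⟦ R? x y z ⟧))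
             ≡⟨ sym (∑-*ˡ S ⟦ P? x ⟧ (λ z → ⟦ P? y ⟧ * (⟦ P? z ⟧ * ⟦ R? x y z ⟧))) ⟩
           (∑ S λ z → ⟦ P? x ⟧ * (⟦ P? y ⟧ * (⟦ P? z ⟧ * ⟦ R? x y z ⟧)))
             ≡⟨ ∑-cong S (λ z → sym (trans (⟦⟧-× (P? x) _) (cong (⟦ P? x ⟧ *_)
                  (trans (⟦⟧-× (P? y) _) (cong (⟦ P? y ⟧ *_) (⟦⟧-× (P? z) (R? x y z))))))) ⟩
           (# S λ z → P? x ×-dec P? y ×-dec P? z ×-dec R? x y z) ∎) ⟩
    (∑³ S λ x y z → ⟦ P? x ×-dec P? y ×-dec P? z ×-dec R? x y z ⟧) ∎
    where open ≤-Reasoning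

  module _ (codegree : ∀ {x y z z′} → R x y z → R x y z′ → z ≡ z′) where

    #R≤1 : ∀ {S} → Unique S → ∀ x y → # S (R? x y) ≤ 1
    #R≤1 u x y = #-unique (R? x y) u codegree

    T3≤s² : ∀ {S} → Unique S → T3 S ≤ length S * length S
    T3≤s² {S} u = ∑-≤-const S λ {x} _ → ∑-≤-length S λ {y} _ → #R≤1 u x y

-- Cutting at a vertex

module CutAt {n : ℕ} (col : Fin n → Fin n → Fin 3) (col-sym : ∀ x y → col x y ≡ col y x)
  (codegree : ∀ {x y z z′} → RainbowTriple col x y z → RainbowTriple col x y z′ → z ≡ z′)
  (v : Fin n) (S : List (Fin n)) (u : Unique S)
  where

  open Graph col col-sym

  s = length S

  class : V → Fin 3
  class = col v

  -- The classes of x and y may coincide. A triangle whose three classes are not all equal has a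
  -- vertex p that is separated from the other two in this way.
  Sp : V → V → V → Set
  Sp p x y = R p x y × class p ≢ class x × class p ≢ class y

  Sp? : ∀ p x y → Dec (Sp p x y)
  Sp? p x y = R? p x y ×-dec ¬? (class p ≟ class x) ×-dec ¬? (class p ≟ class y)

  Off : V → V → V → Set
  Off p x y = Sp p x y × p ≢ v × x ≢ v × y ≢ v

  Off? : ∀ p x y → Dec (Off p x y)
  Off? p x y = Sp? p x y ×-dec ¬? (p ≟ v) ×-dec ¬? (x ≟ v) ×-dec ¬? (y ≟ v)

  module _ {p x y} (off : Off p x y) where
    private
      r = proj₁ (proj₁ off)
      p≁x = proj₁ (proj₂ (proj₁ off))
      p≁y = proj₂ (proj₂ (proj₁ off))

    -- The edge already has y as its third rainbow vertex, and y is not v. With the next two lemmas,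
    -- the dichotomy at v becomes available for every edge of the triangle between different
    -- classes.
    off-px : ¬ R v p x
    off-px r′ = proj₂ (proj₂ (proj₂ off)) (codegree r (R-rotate r′))

    off-py : ¬ R v p y
    off-py r′ = proj₁ (proj₂ (proj₂ off)) (codegree (R-swap₂ r) (R-rotate r′))

    off-xy : ¬ R v x y
    off-xy r′ = proj₁ (proj₂ off) (codegree (R-rotate r) (R-rotate r′))

    -- The dichotomy leaves two colours for each of px and py. If they were `class x` and `class y`,
    -- these would coincide or, by the dichotomy for xy, one of them would recur on xy. So exactly
    -- one of px and py has the colour of vp, and p is a column in which the rows of x and y differ.
    orient : (col p x ≡ class p × col p y ≡ class y) ⊎ (col p x ≡ class x × col p y ≡ class p)
    orient with dichotomy v p x p≁x off-px | dichotomy v p y p≁y off-py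
    ... | inj₁ e | inj₁ f = ⊥-elim (proj₂ (proj₂ r) (trans e (sym f)))
    ... | inj₁ e | inj₂ f = inj₁ (e , f)
    ... | inj₂ e | inj₁ f = inj₂ (e , f)
    ... | inj₂ e | inj₂ f with class x ≟ class y
    ...   | yes g = ⊥-elim (proj₂ (proj₂ r) (trans e (trans g (sym f))))
    ...   | no g with dichotomy v x y g off-xy
    ...     | inj₁ h = ⊥-elim (proj₁ r (trans e (sym h)))
    ...     | inj₂ h = ⊥-elim (proj₁ (proj₂ r) (trans h (sym f)))

  bit : Fin 3 → V → V → Bool
  bit i x q = does (col q x ≟ i)

  -- The edges opposite v in a rainbow triangle ("exceptional" edges) escape the dichotomy;
  -- each row x has at most one such column, and ε prescribes the value put there.
  row : Fin 3 → Bool → V → V → Bool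
  row i ε x q = does (class q ≟ i) ∧ (bit i x q ∨ (ε ∧ does (R? v q x)))

  row-out : ∀ {i q} ε x → class q ≢ i → row i ε x q ≡ false
  row-out {i} {q} ε x ne rewrite dec-false (class q ≟ i) ne = refl

  row-in : ∀ {i q x} ε → class q ≡ i → ¬ R v q x → row i ε x q ≡ bit i x q
  row-in {i} {q} {x} ε e ¬r rewrite dec-true (class q ≟ i) e | dec-false (R? v q x) ¬r | Bool.∧-zeroʳ ε = Bool.∨-identityʳ _

  row-exc : ∀ {i q x} ε → class q ≡ i → R v q x → row i ε x q ≡ ε
  row-exc {i} {q} {x} ε e r rewrite dec-true (class q ≟ i) e | dec-true (R? v q x) r
    | dec-false (col q x ≟ i) (λ c → proj₁ r (trans e (sym c))) = Bool.∧-identityʳ ε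

  -- An edge of the cube in direction p: by `E-differ` the rows of x and y also differ at p.
  E : Mode → V → V → V → Set
  E (i , ε , ε′) x y p = Off p x y × class p ≡ i × All (λ q → q ≢ p → row i ε x q ≡ row i ε′ y q) S

  E? : ∀ m x y p → Dec (E m x y p)
  E? (i , ε , ε′) x y p = Off? p x y ×-dec class p ≟ i ×-dec
    All.all? (λ q → ¬? (q ≟ p) →-dec (row i ε x q Bool.≟ row i ε′ y q)) S

  E-differ : ∀ {i ε ε′ x y p} → E (i , ε , ε′) x y p → row i ε x p ≢ row i ε′ y p
  E-differ {i} {ε} {ε′} {x} {y} {p} (off , e , _) eq with orient off
    | trans (sym (row-in ε e (off-px off))) (trans eq (row-in ε′ e (off-py off)))
  ... | inj₁ (f , g) | eq′ rewrite dec-true (col p x ≟ i) (trans f e)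
                           | dec-false (col p y ≟ i) (λ h → proj₂ (proj₂ (proj₁ off)) (trans e (trans (sym h) g))) = case eq′ of λ ()
  ... | inj₂ (f , g) | eq′ rewrite dec-true (col p y ≟ i) (trans g e)
                           | dec-false (col p x ≟ i) (λ h → proj₁ (proj₂ (proj₁ off)) (trans e (trans (sym h) f))) = case eq′ of λ ()

  clean# : ∀ m → (∑ S λ x → ∑ S λ y → # S (E? m x y)) ≤ Iso (s + s)
  clean# m@(i , ε , ε′) = Iso.bound S u (λ (_ , _ , a) r∈ → All.lookup a r∈) S S u u
    where
    module Iso = Isoperimetry (row i ε) (row i ε′) (E? m) (E-differ {i} {ε} {ε′})
      (λ ((sp , _) , _) ((sp′ , _) , _) → codegree (proj₁ sp) (proj₁ sp′))
      (λ ((sp , _) , _) ((sp′ , _) , _) → codegree (R-swap₂ (proj₁ sp)) (R-swap₂ (proj₁ sp′)))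

  -- The obstruction that no choice of ε and ε′ removes: a second column in which the rows differ,
  -- exceptional for neither of them.
  Wit : V → V → V → V → Set
  Wit p x y q = class q ≡ class p × q ≢ p × ¬ R v q x × ¬ R v q y × bit (class p) x q ≢ bit (class p) y q

  Wit? : ∀ p x y q → Dec (Wit p x y q)
  Wit? p x y q = class q ≟ class p ×-dec ¬? (q ≟ p) ×-dec ¬? (R? v q x) ×-dec ¬? (R? v q y) ×-dec
                 ¬? (bit (class p) x q Bool.≟ bit (class p) y q)

  Dirty : V → V → V → Set
  Dirty p x y = Off p x y × Any.Any (Wit p x y) S

  Dirty? : ∀ p x y → Dec (Dirty p x y)
  Dirty? p x y = Off? p x y ×-dec Any.any? (Wit? p x y) S

  -- The exceptional column of each row is filled with the entry that the other row has there. The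
  -- two columns differ, because R v q x and R v q y force x = y; so the two choices do not
  -- interfere.
  clean : ∀ p x y → Off p x y → ¬ Any.Any (Wit p x y) S → ∃ λ m → E m x y p
  clean p x y off ¬w = (i , ε , ε′) , off , refl , All.tabulate agree
    where
    i = class p
    x≢y : x ≢ y
    x≢y refl = proj₂ (proj₂ (proj₁ (proj₁ off))) refl
    Flip : V → V → V → Set
    Flip x y q = class q ≡ i × R v q x × bit i y q ≡ true
    flip? : ∀ x y → Dec (Any.Any (Flip x y) S)
    flip? x y = Any.any? (λ q → class q ≟ i ×-dec R? v q x ×-dec bit i y q Bool.≟ true) S
    ε = does (flip? x y)
    ε′ = does (flip? y x)
    flip : ∀ {x y q} → q ∈ S → class q ≡ i → R v q x → does (flip? x y) ≡ bit i y q
    flip {x} {y} {q} q∈ e r with bit i y q in eq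
    ... | true  = dec-true (flip? x y) (lose q∈ (e , r , eq))
    ... | false = dec-false (flip? x y) λ a → let q′ , _ , _ , r′ , t = find a in
      case trans (sym t) (trans (cong (bit i y) (codegree (R-swap₂ r′) (R-swap₂ r))) eq) of λ ()
    agree : ∀ {q} → q ∈ S → q ≢ p → row i ε x q ≡ row i ε′ y q
    agree {q} q∈ q≢p = go (class q ≟ i) (R? v q x) (R? v q y) (bit i x q Bool.≟ bit i y q)
      where
      go : Dec (class q ≡ i) → Dec (R v q x) → Dec (R v q y) → Dec (bit i x q ≡ bit i y q) → row i ε x q ≡ row i ε′ y q
      go (no ne) _ _ _ = trans (row-out ε x ne) (sym (row-out ε′ y ne))
      go (yes e) (yes r) (yes r′) _ = ⊥-elim (x≢y (codegree r r′))
      go (yes e) (yes r) (no ¬r)  _ = trans (row-exc ε e r) (trans (flip q∈ e r) (sym (row-in ε′ e ¬r)))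
      go (yes e) (no ¬r) (yes r)  _ = trans (row-in ε e ¬r) (trans (sym (flip q∈ e r)) (sym (row-exc ε′ e r)))
      go (yes e) (no ¬r) (no ¬r′) (yes b) = trans (row-in ε e ¬r) (trans b (sym (row-in ε′ e ¬r′)))
      go (yes e) (no ¬r) (no ¬r′) (no b) = ⊥-elim (¬w (lose q∈ (e , q≢p , ¬r , ¬r′ , b)))

  -- A directed cycle p, x, y through three classes: each edge has the class of its tail as colour.
  α : V → V → V → Set
  α p x y = Off p x y × class x ≢ class y × col p x ≡ class p × col p y ≡ class y × col x y ≡ class x

  α? : ∀ p x y → Dec (α p x y)
  α? p x y = Off? p x y ×-dec ¬? (class x ≟ class y) ×-dec col p x ≟ class p ×-dec
             col p y ≟ class y ×-dec col x y ≟ class x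

  -- Reading colours as tails again, q stands in for p with both of its edges reversed.
  W : V → V → V → V → Set
  W p x y q = class q ≡ class p × q ≢ p × col q x ≡ class x × col q y ≡ class p

  W? : ∀ p x y q → Dec (W p x y q)
  W? p x y q = class q ≟ class p ×-dec ¬? (q ≟ p) ×-dec col q x ≟ class x ×-dec col q y ≟ class p

  Bad : V → V → V → Set
  Bad p x y = α p x y × Any.Any (W p x y) S

  bad? : ∀ p x y → Dec (Bad p x y)
  bad? p x y = α? p x y ×-dec Any.any? (W? p x y) S

  off-swap : ∀ {p x y} → Off p x y → Off p y x
  off-swap ((r , a , b) , c , d , e) = (R-swap₂ r , b , a) , c , e , d

  bits-differ : ∀ {p x y q} → bit (class p) x q ≢ bit (class p) y q →
                (col q x ≡ class p × col q y ≢ class p) ⊎ (col q x ≢ class p × col q y ≡ class p)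
  bits-differ {p} {x} {y} {q} b with col q x ≟ class p | col q y ≟ class p
  ... | yes e | yes f = ⊥-elim (b refl)
  ... | yes e | no f  = inj₁ (e , f)
  ... | no e  | yes f = inj₂ (e , f)
  ... | no e  | no f  = ⊥-elim (b refl)

  -- A witness q cannot form a rainbow triangle with xy, whose third vertex is p. Together with the
  -- dichotomies at v this leaves a single pattern: the cycle p, x, y and the reversed q.
  oriented-dirty : ∀ {p x y} → Off p x y → col p x ≡ class p → col p y ≡ class y →
                   Any.Any (Wit p x y) S → Bad p x y
  oriented-dirty {p} {x} {y} off@((r , p≁x , p≁y) , _) e f any with find any
  ... | q , q∈ , (g , q≢p , ¬qx , ¬qy , b) = (off , x≁y , e , f , xy≡x) , lose q∈ (g , q≢p , qx=x , qy=p)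
    where
    q≁x : class q ≢ class x
    q≁x h = p≁x (trans (sym g) h)
    q≁y : class q ≢ class y
    q≁y h = p≁y (trans (sym g) h)
    xy≢p : col x y ≢ class p
    xy≢p h = proj₁ r (trans e (sym h))
    xy≢y : col x y ≢ class y
    xy≢y h = proj₁ (proj₂ r) (trans h (sym f))
    clash : ∀ {a b} → col q x ≡ a → col q y ≡ b → a ≢ col x y → b ≢ col x y → a ≢ b → ⊥
    clash qx qy a≢ b≢ a≢b = q≢p (codegree (R-rotate (colours qx refl qy a≢ (≢-sym b≢) a≢b)) (R-rotate r))
    x≁y : class x ≢ class y
    x≁y h with bits-differ {p} {x} {y} {q} b | dichotomy v q x q≁x ¬qx | dichotomy v q y q≁y ¬qy
    ... | inj₁ (qx , ¬qy′) | _ | inj₁ k = ¬qy′ (trans k g)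
    ... | inj₁ (qx , ¬qy′) | _ | inj₂ k = clash qx k (≢-sym xy≢p) (≢-sym xy≢y) p≁y
    ... | inj₂ (¬qx′ , qy) | inj₁ k | _ = ¬qx′ (trans k g)
    ... | inj₂ (¬qx′ , qy) | inj₂ k | _ = clash (trans k h) qy (≢-sym xy≢y) (≢-sym xy≢p) (≢-sym p≁y)
    xy≡x : col x y ≡ class x
    xy≡x with dichotomy v x y x≁y (off-xy off)
    ... | inj₁ k = k
    ... | inj₂ k = ⊥-elim (xy≢y k)
    facts : col q x ≡ class x × col q y ≡ class p
    facts with bits-differ {p} {x} {y} {q} b | dichotomy v q x q≁x ¬qx | dichotomy v q y q≁y ¬qy
    ... | inj₁ (qx , ¬qy′) | _ | inj₁ k = ⊥-elim (¬qy′ (trans k g))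
    ... | inj₁ (qx , ¬qy′) | _ | inj₂ k = ⊥-elim (clash qx k (≢-sym xy≢p) (≢-sym xy≢y) p≁y)
    ... | inj₂ (¬qx′ , qy) | inj₁ k | _ = ⊥-elim (¬qx′ (trans k g))
    ... | inj₂ (¬qx′ , qy) | inj₂ k | _ = k , qy
    qx=x = proj₁ facts
    qy=p = proj₂ facts

  wit-swap : ∀ {p x y q} → Wit p x y q → Wit p y x q
  wit-swap (a , b , c , d , e) = a , b , d , c , ≢-sym e

  dirty-cases : ∀ {p x y} → Dirty p x y → Bad p x y ⊎ Bad p y x
  dirty-cases (off , any) with orient off
  ... | inj₁ (e , f) = inj₁ (oriented-dirty off e f any)
  ... | inj₂ (e , f) = inj₂ (oriented-dirty (off-swap off) f e (Any.map wit-swap any))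

  module Crowd {p x₀ y₀ q : V} (α₀ : α p x₀ y₀) (w : W p x₀ y₀ q) where

    Gx Gy : V → Set
    Gx x = x ≡ x₀ ⊎ R v y₀ x ⊎ R v q x ⊎ R q y₀ x
    Gy y = R v x₀ y ⊎ R v q y ⊎ R q x₀ y

    Gx? : ∀ x → Dec (Gx x)
    Gx? x = x ≟ x₀ ⊎-dec R? v y₀ x ⊎-dec R? v q x ⊎-dec R? q y₀ x

    Gy? : ∀ y → Dec (Gy y)
    Gy? y = R? v x₀ y ⊎-dec R? v q y ⊎-dec R? q x₀ y

    #Gx : # S Gx? ≤ 4
    #Gx = ≤-trans (#-cover Gx? (_≟ x₀) (λ x → R? v y₀ x ⊎-dec R? v q x ⊎-dec R? q y₀ x) S (λ _ → id))
      (+-mono-≤ (#-unique (_≟ x₀) u λ { refl refl → refl })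
      (≤-trans (#-cover _ (R? v y₀) (λ x → R? v q x ⊎-dec R? q y₀ x) S (λ _ → id))
      (+-mono-≤ (#R≤1 codegree u v y₀)
      (≤-trans (#-cover _ (R? v q) (R? q y₀) S (λ _ → id))
      (+-mono-≤ (#R≤1 codegree u v q) (#R≤1 codegree u q y₀))))))

    #Gy : # S Gy? ≤ 3
    #Gy = ≤-trans (#-cover Gy? (R? v x₀) (λ x → R? v q x ⊎-dec R? q x₀ x) S (λ _ → id))
      (+-mono-≤ (#R≤1 codegree u v x₀)
      (≤-trans (#-cover _ (R? v q) (R? q x₀) S (λ _ → id))
      (+-mono-≤ (#R≤1 codegree u v q) (#R≤1 codegree u q x₀))))

    -- Outside the exceptional vertices, x₀y must have colour `class y`, or p x₀ y would be a second
    -- rainbow triangle on py; likewise xy₀ has colour `class y₀`. Whatever the colours of qx and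
    -- qy, one of q x₀ y, q y₀ x and q x y is then rainbow, and the last would be a second one on
    -- xy.
    classify : ∀ {x y} → α p x y → class x ≡ class x₀ → Gx x ⊎ Gy y
    classify {x} {y} (((r , p≁x , p≁y) , _) , x≁y , px , py , xy) x~x₀ with x ≟ x₀
    ... | yes e = inj₁ (inj₁ e)
    ... | no x≢x₀ with R? v x₀ y | R? v y₀ x | R? v q x | R? v q y
    ...   | yes r′ | _ | _ | _ = inj₂ (inj₁ r′)
    ...   | no _ | yes r′ | _ | _ = inj₁ (inj₂ (inj₁ r′))
    ...   | no _ | no _ | yes r′ | _ = inj₁ (inj₂ (inj₂ (inj₁ r′)))
    ...   | no _ | no _ | no _ | yes r′ = inj₂ (inj₂ (inj₁ r′))
    ...   | no ¬x₀y | no ¬y₀x | no ¬qx | no ¬qy = final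
      where
      r₀ = proj₁ (proj₁ (proj₁ α₀))
      p≁x₀ = proj₁ (proj₂ (proj₁ (proj₁ α₀)))
      p≁y₀ = proj₂ (proj₂ (proj₁ (proj₁ α₀)))
      x₀≁y₀ = proj₁ (proj₂ α₀)
      px₀ = proj₁ (proj₂ (proj₂ α₀))
      py₀ = proj₁ (proj₂ (proj₂ (proj₂ α₀)))
      x₀y₀ = proj₂ (proj₂ (proj₂ (proj₂ α₀)))
      q~p = proj₁ w
      q≢p = proj₁ (proj₂ w)
      qx₀ = proj₁ (proj₂ (proj₂ w))
      qy₀ = proj₂ (proj₂ (proj₂ w))
      x₀≁y : class x₀ ≢ class y
      x₀≁y e = x≁y (trans x~x₀ e)
      x≁y₀ : class x ≢ class y₀
      x≁y₀ e = x₀≁y₀ (trans (sym x~x₀) e)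
      x₀y : col x₀ y ≡ class y
      x₀y with dichotomy v x₀ y x₀≁y ¬x₀y
      ... | inj₂ e = e
      ... | inj₁ e = ⊥-elim (x≢x₀ (codegree (R-swap₂ r) (R-swap₂ (colours px₀ e py p≁x₀ x₀≁y p≁y))))
      xy₀ : col x y₀ ≡ class y₀
      xy₀ with dichotomy v x y₀ x≁y₀ (¬y₀x ∘ R-swap₂)
      ... | inj₂ e = e
      ... | inj₁ e = ⊥-elim (x≢x₀ (codegree (R-swap₂ (colours px e py₀ p≁x x≁y₀ p≁y₀)) (R-swap₂ r₀)))
      final : Gx x ⊎ Gy y
      final with dichotomy v q y (λ e → p≁y (trans (sym q~p) e)) ¬qy | dichotomy v q x (λ e → p≁x (trans (sym q~p) e)) ¬qx
      ... | inj₁ qy | _ = inj₂ (inj₂ (inj₂ (colours qx₀ x₀y (trans qy q~p) x₀≁y (≢-sym p≁y) (≢-sym p≁x₀))))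
      ... | inj₂ qy | inj₂ qx = inj₁ (inj₂ (inj₂ (inj₂ (colours qy₀ (trans (col-sym y₀ x) xy₀) qx p≁y₀ (≢-sym x≁y₀) p≁x))))
      ... | inj₂ qy | inj₁ qx = ⊥-elim (q≢p (codegree (R-rotate (colours (trans qx q~p) xy qy p≁x x≁y p≁y)) (R-rotate r)))

    -- Given p, each of x and y determines the other, so the 4 + 3 exceptional vertices account for
    -- at most 7 pairs.
    crowd : (∑ S λ x → # S λ y → α? p x y ×-dec class x ≟ class x₀) ≤ 7
    crowd = begin
      (∑ S λ x → # S λ y → α? p x y ×-dec class x ≟ class x₀)
        ≤⟨ ∑-mono S (λ x → #-cover _ (λ y → Gx? x ×-dec R? p x y) (λ y → Gy? y ×-dec R? p x y) S
             λ _ (a , e) → [ (λ g → inj₁ (g , proj₁ (proj₁ (proj₁ a)))) , (λ g → inj₂ (g , proj₁ (proj₁ (proj₁ a)))) ]′ (classify a e)) ⟩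
      (∑ S λ x → (# S λ y → Gx? x ×-dec R? p x y) + (# S λ y → Gy? y ×-dec R? p x y))
        ≡⟨ ∑-+ S _ _ ⟩
      (∑ S λ x → # S λ y → Gx? x ×-dec R? p x y) + (∑ S λ x → # S λ y → Gy? y ×-dec R? p x y)
        ≡⟨ cong ((∑ S λ x → # S λ y → Gx? x ×-dec R? p x y) +_) (∑-swap S S _) ⟩
      (∑ S λ x → # S λ y → Gx? x ×-dec R? p x y) + (∑ S λ y → # S λ x → Gy? y ×-dec R? p x y)
        ≤⟨ +-mono-≤ (#-restrict S S Gx? (R? p) (λ x → #R≤1 codegree u p x))
                    (#-restrict S S Gy? (λ y x → R? p x y) (λ y → #-unique (λ x → R? p x y) u λ a b → codegree (R-swap₂ a) (R-swap₂ b))) ⟩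
      # S Gx? + # S Gy?
        ≤⟨ +-mono-≤ #Gx #Gy ⟩
      7 ∎
      where
      open ≤-Reasoning

  -- If there is any bad triple of this class, it serves as the reference triple of `Crowd`.
  bad-class# : ∀ p j → (∑ S λ x → # S λ y → bad? p x y ×-dec class x ≟ j) ≤ 7
  bad-class# p j with (∑ S λ x → # S λ y → bad? p x y ×-dec class x ≟ j) ≤? 0
  ... | yes z = ≤-trans z z≤n
  ... | no nz with ∑-positive S _ (≰⇒> nz)
  ...   | x₀ , _ , pos with ∑-positive S _ pos
  ...     | y₀ , _ , pos′ with ⟦⟧-pos (bad? p x₀ y₀ ×-dec class x₀ ≟ j) pos′
  ...       | (a₀ , any) , refl with find any
  ...         | q , _ , w = ≤-trans
    (∑-mono S λ x → ∑-mono S λ y → ⟦⟧-mono (bad? p x y ×-dec class x ≟ _) (α? p x y ×-dec class x ≟ _)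
      λ ((a , _) , e) → a , e)
    (Crowd.crowd a₀ w)

  bad# : ∀ p → (∑ S λ x → # S (bad? p x)) ≤ 21
  bad# p = begin
    (∑ S λ x → # S (bad? p x))
      ≤⟨ ∑-mono S (λ x → ∑-mono S λ y → by-class x y (bad? p x y)) ⟩
    (∑ S λ x → ∑ S λ y → # palette λ j → bad? p x y ×-dec class x ≟ j)
      ≡⟨ ∑-cong S (λ x → ∑-swap S palette _) ⟩
    (∑ S λ x → ∑ palette λ j → # S λ y → bad? p x y ×-dec class x ≟ j)
      ≡⟨ ∑-swap S palette _ ⟩
    (∑ palette λ j → ∑ S λ x → # S λ y → bad? p x y ×-dec class x ≟ j)
      ≤⟨ ∑-≤-const palette (λ {j} _ → bad-class# p j) ⟩
    length palette * 7
      ≡⟨ cong (_* 7) length-palette ⟩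
    21 ∎
    where
    open ≤-Reasoning
    by-class : ∀ x y (d : Dec (Bad p x y)) → ⟦ d ⟧ ≤ # palette λ j → d ×-dec class x ≟ j
    by-class x y (no _)  = z≤n
    by-class x y (yes a) = #-one (λ j → yes a ×-dec class x ≟ j) (∈palette (class x)) (a , refl)

  dirty# : ∀ p → (∑ S λ x → # S (Dirty? p x)) ≤ 42
  dirty# p = begin
    (∑ S λ x → # S (Dirty? p x))
      ≤⟨ ∑-mono S (λ x → #-cover _ (bad? p x) (λ y → bad? p y x) S λ _ → dirty-cases) ⟩
    (∑ S λ x → # S (bad? p x) + # S (λ y → bad? p y x))
      ≡⟨ ∑-+ S _ _ ⟩
    (∑ S λ x → # S (bad? p x)) + (∑ S λ x → # S λ y → bad? p y x)
      ≡⟨ cong ((∑ S λ x → # S (bad? p x)) +_) (∑-swap S S _) ⟩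
    (∑ S λ x → # S (bad? p x)) + (∑ S λ y → # S (bad? p y))
      ≤⟨ +-mono-≤ (bad# p) (bad# p) ⟩
    42 ∎
    where open ≤-Reasoning

  on-v# : ∀ {P : V → V → Set} (P? : ∀ x y → Dec (P x y)) → (∀ x → # S (P? x) ≤ 1) →
          (∑ S λ x → # S λ y → x ≟ v ×-dec P? x y) ≤ 1
  on-v# P? h = ≤-trans (#-restrict S S (_≟ v) P? h) (#-unique (_≟ v) u λ { refl refl → refl })

  #R≤1′ : ∀ p y → # S (λ x → R? p x y) ≤ 1
  #R≤1′ p y = #-unique (λ x → R? p x y) u λ a b → codegree (R-swap₂ a) (R-swap₂ b)

  -- Here 42 = 2 · 3 · 7, for two orientations and three classes of x, and 12 is the number of
  -- modes.
  off# : (∑ S λ p → ∑ S λ x → # S (Off? p x)) ≤ 42 * s + 12 * Iso (s + s)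
  off# = begin
    (∑ S λ p → ∑ S λ x → # S (Off? p x))
      ≤⟨ ∑-mono S (λ p → ∑-mono S λ x → ∑-mono S λ y → cover p x y) ⟩
    (∑ S λ p → ∑ S λ x → ∑ S λ y → ⟦ Dirty? p x y ⟧ + # modes (λ m → E? m x y p))
      ≡⟨ ∑-cong S (λ p → trans (∑-cong S λ x → ∑-+ S _ _) (∑-+ S _ _)) ⟩
    (∑ S λ p → (∑ S λ x → # S (Dirty? p x)) + (∑ S λ x → ∑ S λ y → # modes λ m → E? m x y p))
      ≡⟨ ∑-+ S _ _ ⟩
    (∑ S λ p → ∑ S λ x → # S (Dirty? p x)) + (∑ S λ p → ∑ S λ x → ∑ S λ y → # modes λ m → E? m x y p)
      ≤⟨ +-mono-≤ (≤-trans (∑-≤-const S λ {p} _ → dirty# p) (≤-reflexive (*-comm s 42)))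
                  (≤-trans (≤-reflexive reorder) (≤-trans (∑-≤-const modes λ {m} _ → clean# m) (≤-reflexive (cong (_* Iso (s + s)) length-modes)))) ⟩
    42 * s + 12 * Iso (s + s) ∎
    where
    open ≤-Reasoning
    cover : ∀ p x y → ⟦ Off? p x y ⟧ ≤ ⟦ Dirty? p x y ⟧ + # modes (λ m → E? m x y p)
    cover p x y = ⟦⟧-≤ (Off? p x y) λ off → go off (Any.any? (Wit? p x y) S)
      where
      go : Off p x y → Dec (Any.Any (Wit p x y) S) → 1 ≤ ⟦ Dirty? p x y ⟧ + # modes (λ m → E? m x y p)
      go off (yes w) = ≤-trans (1≤⟦⟧ (Dirty? p x y) (off , w)) (m≤m+n _ _)
      go off (no ¬w) = let m , e = clean p x y off ¬w in
        ≤-trans (#-one (λ m → E? m x y p) (∈modes m) e) (m≤n+m _ _)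
    reorder : (∑ S λ p → ∑ S λ x → ∑ S λ y → # modes λ m → E? m x y p) ≡
              (∑ modes λ m → ∑ S λ x → ∑ S λ y → # S (E? m x y))
    reorder = begin-equality
      (∑ S λ p → ∑ S λ x → ∑ S λ y → # modes λ m → E? m x y p)
        ≡⟨ ∑-swap S S _ ⟩
      (∑ S λ x → ∑ S λ p → ∑ S λ y → # modes λ m → E? m x y p)
        ≡⟨ ∑-cong S (λ x → ∑-swap S S _) ⟩
      (∑ S λ x → ∑ S λ y → ∑ S λ p → # modes λ m → E? m x y p)
        ≡⟨ ∑-cong S (λ x → trans (∑-cong S λ y → ∑-swap S modes _) (∑-swap S modes _)) ⟩
      (∑ S λ x → ∑ modes λ m → ∑ S λ y → # S (E? m x y))
        ≡⟨ ∑-swap S modes _ ⟩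
      (∑ modes λ m → ∑ S λ x → ∑ S λ y → # S (E? m x y)) ∎

  -- The additional 3s are the triples with v in one of the three positions: one further entry
  -- determines the rest.
  split# : (∑ S λ p → ∑ S λ x → # S (Sp? p x)) ≤ 45 * s + 12 * Iso (s + s)
  split# = begin
    (∑ S λ p → ∑ S λ x → # S (Sp? p x))
      ≤⟨ ∑-mono S (λ p → ∑-mono S λ x → #-cover _ (atP? p x) (λ y → rest₁? p x y) S λ _ → cases₁) ⟩
    (∑ S λ p → ∑ S λ x → # S (atP? p x) + # S (rest₁? p x))
      ≤⟨ ∑-mono S (λ p → ∑-mono S λ x → +-monoʳ-≤ (# S (atP? p x)) (≤-trans
           (#-cover _ (atX? p x) (rest₂? p x) S (λ _ → id))
           (+-monoʳ-≤ (# S (atX? p x)) (#-cover _ (atY? p x) (Off? p x) S (λ _ → id))))) ⟩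
    (∑ S λ p → ∑ S λ x → # S (atP? p x) + (# S (atX? p x) + (# S (atY? p x) + # S (Off? p x))))
      ≡⟨ ∑-cong S (λ p → ∑-+₄ S (λ x → # S (atP? p x)) (λ x → # S (atX? p x)) (λ x → # S (atY? p x)) (λ x → # S (Off? p x))) ⟩
    (∑ S λ p → (∑ S λ x → # S (atP? p x)) + ((∑ S λ x → # S (atX? p x)) +
               ((∑ S λ x → # S (atY? p x)) + (∑ S λ x → # S (Off? p x)))))
      ≡⟨ ∑-+₄ S (λ p → ∑ S λ x → # S (atP? p x)) (λ p → ∑ S λ x → # S (atX? p x))
                (λ p → ∑ S λ x → # S (atY? p x)) (λ p → ∑ S λ x → # S (Off? p x)) ⟩
    (∑ S λ p → ∑ S λ x → # S (atP? p x)) + ((∑ S λ p → ∑ S λ x → # S (atX? p x)) +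
               ((∑ S λ p → ∑ S λ x → # S (atY? p x)) + (∑ S λ p → ∑ S λ x → # S (Off? p x))))
      ≤⟨ +-mono-≤ P-bound (+-mono-≤ X-bound (+-mono-≤ Y-bound off#)) ⟩
    s + (s + (s + (42 * s + 12 * Iso (s + s))))
      ≡⟨ lemma s (Iso (s + s)) ⟩
    45 * s + 12 * Iso (s + s) ∎
    where
    open ≤-Reasoning
    lemma : ∀ s t → s + (s + (s + (42 * s + 12 * t))) ≡ 45 * s + 12 * t
    lemma = solve-∀
    atP? : ∀ p x y → Dec (p ≡ v × R p x y)
    atP? p x y = p ≟ v ×-dec R? p x y
    atX? : ∀ p x y → Dec (x ≡ v × R p x y)
    atX? p x y = x ≟ v ×-dec R? p x y
    atY? : ∀ p x y → Dec (y ≡ v × R p x y)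
    atY? p x y = y ≟ v ×-dec R? p x y
    rest₂? : ∀ p x y → Dec ((y ≡ v × R p x y) ⊎ Off p x y)
    rest₂? p x y = atY? p x y ⊎-dec Off? p x y
    rest₁? : ∀ p x y → Dec ((x ≡ v × R p x y) ⊎ (y ≡ v × R p x y) ⊎ Off p x y)
    rest₁? p x y = atX? p x y ⊎-dec rest₂? p x y
    cases₁ : ∀ {p x y} → Sp p x y → (p ≡ v × R p x y) ⊎ (x ≡ v × R p x y) ⊎ (y ≡ v × R p x y) ⊎ Off p x y
    cases₁ {p} {x} {y} sp@(r , _) with p ≟ v | x ≟ v | y ≟ v
    ... | yes e | _     | _     = inj₁ (e , r)
    ... | no _  | yes e | _     = inj₂ (inj₁ (e , r))
    ... | no _  | no _  | yes e = inj₂ (inj₂ (inj₁ (e , r)))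
    ... | no a  | no b  | no c  = inj₂ (inj₂ (inj₂ (sp , a , b , c)))
    P-bound : (∑ S λ p → ∑ S λ x → # S (atP? p x)) ≤ s
    P-bound = ≤-trans (≤-reflexive (∑-swap S S _))
      (∑-≤-length S λ {x} _ → on-v# (λ p y → R? p x y) (λ p → #R≤1 codegree u p x))
    X-bound : (∑ S λ p → ∑ S λ x → # S (atX? p x)) ≤ s
    X-bound = ∑-≤-length S λ {p} _ → on-v# (R? p) (#R≤1 codegree u p)
    Y-bound : (∑ S λ p → ∑ S λ x → # S (atY? p x)) ≤ s
    Y-bound = ∑-≤-length S λ {p} _ → ≤-trans (≤-reflexive (∑-swap S S _)) (on-v# (λ y x → R? p x y) (#R≤1′ p))

  classOf : Fin 3 → List V
  classOf i = filter (λ x → class x ≟ i) S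

  Mono : Fin 3 → V → V → V → Set
  Mono i x y z = class x ≡ i × class y ≡ i × class z ≡ i × R x y z

  mono? : ∀ i x y z → Dec (Mono i x y z)
  mono? i x y z = class x ≟ i ×-dec class y ≟ i ×-dec class z ≟ i ×-dec R? x y z

  mono# : ∀ i → (∑ S λ x → ∑ S λ y → # S (mono? i x y)) ≡ T3 (classOf i)
  mono# i = sym (T3-filter (λ x → class x ≟ i) S)

  -- The factor 3 stands for the position of the vertex that is separated from the other two.
  cut : T3 S ≤ (∑ palette λ i → T3 (classOf i)) + 3 * (45 * s + 12 * Iso (s + s))
  cut = begin
    T3 S
      ≤⟨ ∑-mono S (λ x → ∑-mono S λ y → ∑-mono S λ z → cover x y z) ⟩
    (∑ S λ x → ∑ S λ y → ∑ S λ z → # palette (λ i → mono? i x y z) + (⟦ Sp? x y z ⟧ + (⟦ Sp? y z x ⟧ + ⟦ Sp? z x y ⟧)))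
      ≡⟨ ∑³-+₄ S (λ x y z → # palette (λ i → mono? i x y z)) (λ x y z → ⟦ Sp? x y z ⟧) (λ x y z → ⟦ Sp? y z x ⟧) (λ x y z → ⟦ Sp? z x y ⟧) ⟩
    (∑ S λ x → ∑ S λ y → ∑ S λ z → # palette (λ i → mono? i x y z)) +
      (sp + ((∑ S λ x → ∑ S λ y → # S λ z → Sp? y z x) + (∑ S λ x → ∑ S λ y → # S λ z → Sp? z x y)))
      ≡⟨ cong₂ _+_ monos (cong (sp +_) (cong₂ _+_ (∑³-rotate S λ x y z → ⟦ Sp? x y z ⟧)
           (sym (∑³-rotate S λ x y z → ⟦ Sp? z x y ⟧)))) ⟩
    (∑ palette λ i → T3 (classOf i)) + (sp + (sp + sp))
      ≤⟨ +-monoʳ-≤ (∑ palette λ i → T3 (classOf i)) (+-mono-≤ split# (+-mono-≤ split# (≤-trans split# (m≤m+n _ 0)))) ⟩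
    (∑ palette λ i → T3 (classOf i)) + 3 * (45 * s + 12 * Iso (s + s)) ∎
    where
    open ≤-Reasoning
    sp = ∑ S λ x → ∑ S λ y → # S (Sp? x y)
    cover : ∀ x y z → ⟦ R? x y z ⟧ ≤ # palette (λ i → mono? i x y z) + (⟦ Sp? x y z ⟧ + (⟦ Sp? y z x ⟧ + ⟦ Sp? z x y ⟧))
    cover x y z = ⟦⟧-≤ (R? x y z) λ r → go r (class x ≟ class y) (class y ≟ class z) (class x ≟ class z)
      where
      m = # palette (λ i → mono? i x y z)
      go : R x y z → Dec (class x ≡ class y) → Dec (class y ≡ class z) → Dec (class x ≡ class z) →
           1 ≤ m + (⟦ Sp? x y z ⟧ + (⟦ Sp? y z x ⟧ + ⟦ Sp? z x y ⟧))
      go r (yes e) (yes f) _ = ≤-trans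
        (#-one (λ i → mono? i x y z) (∈palette (class x)) (refl , sym e , sym (trans e f) , r)) (m≤m+n m _)
      go r (no e) _ (no g) = ≤-trans (≤-trans (1≤⟦⟧ (Sp? x y z) (r , e , g)) (m≤m+n _ _)) (m≤n+m _ m)
      go r (no e) (no f) (yes g) = ≤-trans (≤-trans (≤-trans
        (1≤⟦⟧ (Sp? y z x) (R-rotate r , f , ≢-sym e)) (m≤m+n _ _)) (m≤n+m _ ⟦ Sp? x y z ⟧)) (m≤n+m _ m)
      go r (yes e) (no f) (no g) = ≤-trans (≤-trans (≤-trans
        (1≤⟦⟧ (Sp? z x y) (R-rotate (R-rotate r) , ≢-sym g , ≢-sym f)) (m≤n+m _ ⟦ Sp? y z x ⟧)) (m≤n+m _ ⟦ Sp? x y z ⟧)) (m≤n+m _ m)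
      go r (yes e) (no f) (yes g) = ⊥-elim (f (trans (sym e) g))
      go r (no e) (yes f) (yes g) = ⊥-elim (e (trans g (sym f)))
    monos : (∑ S λ x → ∑ S λ y → ∑ S λ z → # palette λ i → mono? i x y z) ≡ (∑ palette λ i → T3 (classOf i))
    monos = begin-equality
      (∑ S λ x → ∑ S λ y → ∑ S λ z → # palette λ i → mono? i x y z)
        ≡⟨ ∑-cong S (λ x → trans (∑-cong S λ y → ∑-swap S palette _) (∑-swap S palette _)) ⟩
      (∑ S λ x → ∑ palette λ i → ∑ S λ y → # S (mono? i x y))
        ≡⟨ ∑-swap S palette _ ⟩
      (∑ palette λ i → ∑ S λ x → ∑ S λ y → # S (mono? i x y))
        ≡⟨ ∑-cong palette mono# ⟩
      (∑ palette λ i → T3 (classOf i)) ∎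

-- The sparse case

module SparseBound {n : ℕ} (col : Fin n → Fin n → Fin 3) (col-sym : ∀ x y → col x y ≡ col y x)
  (codegree : ∀ {x y z z′} → RainbowTriple col x y z → RainbowTriple col x y z′ → z ≡ z′)
  (i j k : Fin 3) (i≢j : i ≢ j) (i≢k : i ≢ k) (j≢k : j ≢ k)
  (X : List (Fin n)) (unique : Unique X)
  (D Φ B : ℕ) (Φ<B² : Φ < suc B * suc (3 * B))
  (sparse : ∀ {u} → u ∈ X → # X (λ x → ¬? (col u x ≟ i)) ≤ D)
  (small : ∀ {P : Fin n → Set} (P? : Decidable P) → length (filter P? X) ≤ D + D →
    Graph.T3 col col-sym (filter P? X) ≤ Φ)
  where

  open Graph col col-sym

  d = 3 * B + 3

  -- The triangle is seen from the vertex opposite its edge of the majority colour i.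
  Λ : V → V → V → Set
  Λ y u w = col y u ≡ j × col y w ≡ k × col u w ≡ i

  Λ? : ∀ y u w → Dec (Λ y u w)
  Λ? y u w = col y u ≟ j ×-dec col y w ≟ k ×-dec col u w ≟ i

  Λ⇒R : ∀ {y u w} → Λ y u w → R y u w
  Λ⇒R (a , b , c) = colours a c b (≢-sym i≢j) i≢k j≢k

  #R : ∀ x y → # X (R? x y) ≤ 1
  #R x y = #-unique (R? x y) unique codegree

  #R′ : ∀ x z → # X (λ y → R? x y z) ≤ 1
  #R′ x z = #-unique (λ y → R? x y z) unique λ a b → codegree (R-swap₂ a) (R-swap₂ b)

  apex : V → ℕ
  apex y = ∑ X λ u → # X (Λ? y u)

  G : V → Set
  G y = d ≤ apex y

  G? : ∀ y → Dec (G y)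
  G? y = d ≤? apex y

  StarSet : V → V → V → Set
  StarSet u w y = G y × col u y ≡ j × col w y ≡ k

  star? : ∀ u w y → Dec (StarSet u w y)
  star? u w y = G? y ×-dec col u y ≟ j ×-dec col w y ≟ k

  -- The neighbours of y in the colours j and k all lie in the neighbourhoods of u and w, a set
  -- too small to contain many rainbow triangles.
  module Star {u w : V} (u∈ : u ∈ X) (w∈ : w ∈ X) where

    Near : V → Set
    Near x = col u x ≢ i ⊎ col w x ≢ i

    near? : ∀ x → Dec (Near x)
    near? x = ¬? (col u x ≟ i) ⊎-dec ¬? (col w x ≟ i)

    N = filter near? X

    length-N : length N ≤ D + D
    length-N = ≤-trans (≤-reflexive (length-# near? X))
      (≤-trans (#-cover near? (λ x → ¬? (col u x ≟ i)) (λ x → ¬? (col w x ≟ i)) X (λ _ → id))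
               (+-mono-≤ (sparse u∈) (sparse w∈)))

    inner : V → ℕ
    inner y = ∑ N λ p → # N (R? y p)

    -- For a triangle y p q, the dichotomy at y gives uq and wp the colours j or k. The 2 allows for
    -- the q with y u q rainbow and the p with y w p rainbow, each in at most one triangle at y.
    apex≤ : ∀ {y} → StarSet u w y → apex y ≤ inner y + 2
    apex≤ {y} (_ , uy , wy) = begin
      apex y
        ≤⟨ ∑-mono X (λ p → ∑-mono X λ q → ≤-trans
             (⟦⟧-cover (Λ? y p q) (exc₁? p q ⊎-dec exc₂? p q) (near? p ×-dec near? q ×-dec R? y p q) classify)
             (+-monoˡ-≤ _ (⟦⟧-cover (exc₁? p q ⊎-dec exc₂? p q) (exc₁? p q) (exc₂? p q) id))) ⟩
      (∑ X λ p → ∑ X λ q → ⟦ exc₁? p q ⟧ + ⟦ exc₂? p q ⟧ + ⟦ near? p ×-dec near? q ×-dec R? y p q ⟧)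
        ≡⟨ ∑-cong X (λ p → trans (∑-+ X _ _) (cong (_+ (# X λ q → near? p ×-dec near? q ×-dec R? y p q)) (∑-+ X _ _))) ⟩
      (∑ X λ p → # X (exc₁? p) + # X (exc₂? p) + # X (λ q → near? p ×-dec near? q ×-dec R? y p q))
        ≡⟨ trans (∑-+ X _ _) (cong (_+ (∑ X λ p → # X λ q → near? p ×-dec near? q ×-dec R? y p q)) (∑-+ X _ _)) ⟩
      (∑ X λ p → # X (exc₁? p)) + (∑ X λ p → # X (exc₂? p)) + (∑ X λ p → # X λ q → near? p ×-dec near? q ×-dec R? y p q)
        ≤⟨ +-mono-≤ (+-mono-≤
             (≤-trans (≤-reflexive (∑-swap X X _)) (≤-trans (#-restrict X X (R? y u) (λ q p → R? y p q) (#R′ y)) (#R y u)))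
             (≤-trans (#-restrict X X (R? y w) (R? y) (#R y)) (#R y w)))
             (≤-reflexive inside) ⟩
      2 + inner y
        ≡⟨ +-comm 2 (inner y) ⟩
      inner y + 2 ∎
      where
      open ≤-Reasoning
      exc₁? : ∀ p q → Dec (R y u q × R y p q)
      exc₁? p q = R? y u q ×-dec R? y p q
      exc₂? : ∀ p q → Dec (R y w p × R y p q)
      exc₂? p q = R? y w p ×-dec R? y p q
      yu = trans (col-sym y u) uy
      yw = trans (col-sym y w) wy
      classify : ∀ {p q} → Λ y p q → ((R y u q × R y p q) ⊎ (R y w p × R y p q)) ⊎ (Near p × Near q × R y p q)
      classify {p} {q} l@(yp , yq , pq) with R? y u q | R? y w p
      ... | yes r | _     = inj₁ (inj₁ (r , Λ⇒R l))
      ... | no _  | yes r = inj₁ (inj₂ (r , Λ⇒R l))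
      ... | no r  | no r′ = inj₂ (inj₂ wp , inj₁ uq , Λ⇒R l)
        where
        uq : col u q ≢ i
        uq e with dichotomy y u q (λ f → j≢k (trans (sym yu) (trans f yq))) r
        ... | inj₁ f = i≢j (trans (sym e) (trans f yu))
        ... | inj₂ f = i≢k (trans (sym e) (trans f yq))
        wp : col w p ≢ i
        wp e with dichotomy y w p (λ f → j≢k (trans (sym yp) (trans (sym f) yw))) r′
        ... | inj₁ f = i≢k (trans (sym e) (trans f yw))
        ... | inj₂ f = i≢j (trans (sym e) (trans f yp))
      inside : (∑ X λ p → # X λ q → near? p ×-dec near? q ×-dec R? y p q) ≡ inner y
      inside = sym (begin-equality
        inner y
          ≡⟨ ∑-filter near? X _ ⟩
        (∑ X λ p → ⟦ near? p ⟧ * # N (R? y p))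
          ≡⟨ ∑-cong X (λ p → trans (cong (⟦ near? p ⟧ *_) (∑-filter near? X _))
               (sym (∑-*ˡ X ⟦ near? p ⟧ (λ q → ⟦ near? q ⟧ * ⟦ R? y p q ⟧)))) ⟩
        (∑ X λ p → ∑ X λ q → ⟦ near? p ⟧ * (⟦ near? q ⟧ * ⟦ R? y p q ⟧))
          ≡⟨ ∑-cong X (λ p → ∑-cong X λ q → sym (trans (⟦⟧-× (near? p) _) (cong (⟦ near? p ⟧ *_) (⟦⟧-× (near? q) (R? y p q))))) ⟩
        (∑ X λ p → # X λ q → near? p ×-dec near? q ×-dec R? y p q) ∎)

    -- The set N contains the star itself, so B + 1 members would contribute 3B + 1 triples each to
    -- T3 N, more than Φ.
    star-bound : # X (star? u w) ≤ B
    star-bound = ≮⇒≥ λ B< → <⇒≱ Φ<B² (begin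
      suc B * suc (3 * B)  ≤⟨ *-monoˡ-≤ (suc (3 * B)) B< ⟩
      # X (star? u w) * suc (3 * B)  ≡⟨ *-comm (# X (star? u w)) _ ⟩
      suc (3 * B) * # X (star? u w)  ≡⟨ ∑-*ˡ X (suc (3 * B)) _ ⟨
      (∑ X λ y → suc (3 * B) * ⟦ star? u w y ⟧)  ≤⟨ ∑-mono X (λ y → weigh y (star? u w y)) ⟩
      (∑ X λ y → ⟦ near? y ⟧ * inner y)  ≡⟨ ∑-filter near? X inner ⟨
      T3 N  ≤⟨ small near? length-N ⟩
      Φ  ∎)
      where
      open ≤-Reasoning
      weigh : ∀ y (p : Dec (StarSet u w y)) → suc (3 * B) * ⟦ p ⟧ ≤ ⟦ near? y ⟧ * inner y
      weigh y (no _)  = ≤-trans (≤-reflexive (*-zeroʳ (3 * B))) z≤n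
      weigh y (yes p) = begin
        suc (3 * B) * 1  ≡⟨ *-identityʳ _ ⟩
        suc (3 * B)  ≤⟨ +-cancelʳ-≤ 2 _ _ (≤-trans (≤-reflexive (lemma (3 * B))) (≤-trans (proj₁ p) (apex≤ p))) ⟩
        inner y  ≡⟨ +-identityʳ _ ⟨
        1 * inner y  ≡⟨ cong (_* inner y) (⟦⟧-yes (near? y) (inj₁ λ e → i≢j (trans (sym e) (proj₁ (proj₂ p))))) ⟨
        ⟦ near? y ⟧ * inner y  ∎
        where
        lemma : ∀ b → suc b + 2 ≡ b + 3
        lemma = solve-∀

  open Star using (star-bound)

  -- A j/k-coloured complete bipartite graph between Y and Z gives a large star on one side.
  module Pairs {u w h : V} (u∈ : u ∈ X) (w∈ : w ∈ X)
    {P Q : V → Set} (P? : Decidable P) (Q? : Decidable Q)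
    (P⇒ : ∀ {y} → P y → G y × col u y ≡ j × col h y ≡ j)
    (Q⇒ : ∀ {z} → Q z → G z × col w z ≡ k × col h z ≡ k)
    where

    -- By the dichotomy at h, yz has colour j or k unless h y z is rainbow. Colour j puts z into the
    -- star of y and w, colour k puts y into the star of u and z, and a star has at most B members.
    pairs : # X P? * # X Q? ≤ # X P? * suc B + # X Q? * B
    pairs = begin
      # X P? * # X Q?
        ≡⟨ trans (*-comm (# X P?) _) (sym (∑-*ˡ X (# X Q?) _)) ⟩
      (∑ X λ y → # X Q? * ⟦ P? y ⟧)
        ≡⟨ ∑-cong X (λ y → trans (*-comm (# X Q?) ⟦ P? y ⟧) (trans (sym (∑-*ˡ X ⟦ P? y ⟧ _)) (∑-cong X λ z → sym (⟦⟧-× (P? y) (Q? z))))) ⟩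
      (∑ X λ y → # X λ z → P? y ×-dec Q? z)
        ≤⟨ ∑-mono X (λ y → ∑-mono X λ z → ≤-trans
             (⟦⟧-cover (P? y ×-dec Q? z) (P? y ×-dec R? h y z) (a? y z ⊎-dec b? y z) classify)
             (+-monoʳ-≤ ⟦ P? y ×-dec R? h y z ⟧ (⟦⟧-cover (a? y z ⊎-dec b? y z) (a? y z) (b? y z) id))) ⟩
      (∑ X λ y → ∑ X λ z → ⟦ P? y ×-dec R? h y z ⟧ + (⟦ a? y z ⟧ + ⟦ b? y z ⟧))
        ≡⟨ ∑-cong X (λ y → trans (∑-+ X _ _) (cong ((# X λ z → P? y ×-dec R? h y z) +_) (∑-+ X _ _))) ⟩
      (∑ X λ y → (# X λ z → P? y ×-dec R? h y z) + (# X (a? y) + # X (b? y)))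
        ≡⟨ trans (∑-+ X _ _) (cong ((∑ X λ y → # X λ z → P? y ×-dec R? h y z) +_) (∑-+ X _ _)) ⟩
      (∑ X λ y → # X λ z → P? y ×-dec R? h y z) + ((∑ X λ y → # X (a? y)) + (∑ X λ y → # X (b? y)))
        ≤⟨ +-mono-≤ (#-restrict X X P? (λ y z → R? h y z) (#R h))
           (+-mono-≤ (#-weighted X X P? (λ y → star? y w) B λ y∈ _ → star-bound y∈ w∈)
                     (≤-trans (≤-reflexive (∑-swap X X _)) (#-weighted X X Q? (λ z → star? u z) B λ z∈ _ → star-bound u∈ z∈))) ⟩
      # X P? + (# X P? * B + # X Q? * B)
        ≡⟨ lemma (# X P?) (# X Q?) B ⟩
      # X P? * suc B + # X Q? * B ∎
      where
      open ≤-Reasoning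
      lemma : ∀ p q b → p + (p * b + q * b) ≡ p * (1 + b) + q * b
      lemma = solve-∀
      a? : ∀ y z → Dec (P y × StarSet y w z)
      a? y z = P? y ×-dec star? y w z
      b? : ∀ y z → Dec (Q z × StarSet u z y)
      b? y z = Q? z ×-dec star? u z y
      classify : ∀ {y z} → P y × Q z → (P y × R h y z) ⊎ ((P y × StarSet y w z) ⊎ (Q z × StarSet u z y))
      classify {y} {z} (p , q) with R? h y z
      ... | yes r = inj₁ (p , r)
      ... | no r with P⇒ p | Q⇒ q
      ...   | gy , uy , hy | gz , wz , hz with dichotomy h y z (λ e → j≢k (trans (sym hy) (trans e hz))) r
      ...     | inj₁ e = inj₂ (inj₁ (p , gz , trans e hy , wz))
      ...     | inj₂ e = inj₂ (inj₂ (q , gy , uy , trans (col-sym z y) (trans e hz)))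

    too-many : 2 * B + 2 ≤ # X P? → 2 * B + 2 ≤ # X Q? → ⊥
    too-many p≥ q≥ = <⇒≱ (lem (# X P?) (# X Q?) p≥ q≥) (*-monoʳ-≤ 2 pairs)
      where
      lem : ∀ p q → 2 * B + 2 ≤ p → 2 * B + 2 ≤ q → 2 * (p * suc B + q * B) < 2 * (p * q)
      lem p q p≥ q≥ = begin-strict
        2 * (p * suc B + q * B)  <⟨ m<m+n _ {2 * q} (≤-trans (≤-trans (s≤s z≤n) (≤-trans (m≤n+m 2 (2 * B)) q≥)) (m≤m+n q (q + 0))) ⟩
        2 * (p * suc B + q * B) + 2 * q  ≡⟨ lemma p q B ⟩
        p * (2 * B + 2) + q * (2 * B + 2)  ≤⟨ +-mono-≤ (*-monoʳ-≤ p q≥) (*-monoʳ-≤ q p≥) ⟩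
        p * q + q * p  ≡⟨ lemma′ p q ⟩
        2 * (p * q)  ∎
        where
        open ≤-Reasoning
        lemma : ∀ p q b → 2 * (p * (1 + b) + q * b) + 2 * q ≡ p * (2 * b + 2) + q * (2 * b + 2)
        lemma = solve-∀
        lemma′ : ∀ p q → p * q + q * p ≡ 2 * (p * q)
        lemma′ = solve-∀

  GΛ? : ∀ y u w → Dec (G y × Λ y u w)
  GΛ? y u w = G? y ×-dec Λ? y u w

  degU degW : V → ℕ
  degU u = ∑ X λ y → # X λ w → GΛ? y u w
  degW w = ∑ X λ y → # X λ u → GΛ? y u w

  U W : V → Set
  U u = d ≤ degU u
  W w = d ≤ degW w

  U? : ∀ u → Dec (U u)
  U? u = d ≤? degU u

  W? : ∀ w → Dec (W w)
  W? w = d ≤? degW w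

  Y? : ∀ u y → Dec (G y × col u y ≡ j)
  Y? u y = G? y ×-dec col u y ≟ j

  Z? : ∀ w z → Dec (G z × col w z ≡ k)
  Z? w z = G? z ×-dec col w z ≟ k

  degU≤ : ∀ u → degU u ≤ # X (Y? u)
  degU≤ u = ≤-trans (∑-mono X λ y → #-mono _ (λ w → Y? u y ×-dec R? y u w) X
      λ _ (g , l) → (g , trans (col-sym u y) (proj₁ l)) , Λ⇒R l)
    (#-restrict X X (Y? u) (λ y w → R? y u w) λ y → #R y u)

  degW≤ : ∀ w → degW w ≤ # X (Z? w)
  degW≤ w = ≤-trans (∑-mono X λ y → #-mono _ (λ u → Z? w y ×-dec R? y u w) X
      λ _ (g , l) → (g , trans (col-sym w y) (proj₁ (proj₂ l))) , Λ⇒R l)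
    (#-restrict X X (Z? w) (λ y u → R? y u w) λ y → #R′ y w)

  2B+2≤d : 2 * B + 2 ≤ d
  2B+2≤d = +-mono-≤ (*-monoˡ-≤ B {2} {3} (s≤s (s≤s z≤n))) (s≤s (s≤s z≤n))

  leftover : ∀ {c} → d ≤ B + (c + 1) → 2 * B + 2 ≤ c
  leftover {c} p = +-cancelʳ-≤ (B + 1) _ _ (≤-trans (≤-reflexive (lemma B)) (≤-trans p (≤-reflexive (lemma′ B c))))
    where
    lemma : ∀ b → 2 * b + 2 + (b + 1) ≡ 3 * b + 3
    lemma = solve-∀
    lemma′ : ∀ b c → b + (c + 1) ≡ c + (b + 1)
    lemma′ = solve-∀

  -- Let uw have colour j. By the dichotomy at w, a rich k-neighbour z of w is a k-neighbour of u
  -- too, apart from one exception and the at most B vertices z with uz of colour j, which form a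
  -- star. So u can act as h in `Pairs`; for colour k, w does.
  no-link : ∀ {u w} → u ∈ X → w ∈ X → U u → W w → ¬ (col u w ≡ j ⊎ col u w ≡ k)
  no-link {u} {w} u∈ w∈ uu ww (inj₁ uw) = Pairs.too-many {h = u} u∈ w∈ (Y? u) Q?
    (λ (g , e) → g , e , e) id (≤-trans 2B+2≤d (≤-trans uu (degU≤ u)))
    (leftover (≤-trans ww (≤-trans (degW≤ w) (≤-trans
      (#-cover (Z? w) (star? u w) (λ z → Q? z ⊎-dec R? w u z) X λ {z} _ → split z)
      (+-mono-≤ (star-bound u∈ w∈) (≤-trans (#-cover _ Q? (R? w u) X λ _ → id) (+-monoʳ-≤ (# X Q?) (#R w u))))))))
    where
    Q? : ∀ z → Dec (G z × col w z ≡ k × col u z ≡ k)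
    Q? z = G? z ×-dec col w z ≟ k ×-dec col u z ≟ k
    wu = trans (col-sym w u) uw
    split : ∀ z → G z × col w z ≡ k → StarSet u w z ⊎ ((G z × col w z ≡ k × col u z ≡ k) ⊎ R w u z)
    split z (g , wz) with R? w u z
    ... | yes r = inj₂ (inj₂ r)
    ... | no r with dichotomy w u z (λ e → j≢k (trans (sym wu) (trans e wz))) r
    ...   | inj₁ e = inj₁ (g , trans e wu , wz)
    ...   | inj₂ e = inj₂ (inj₁ (g , wz , trans e wz))
  no-link {u} {w} u∈ w∈ uu ww (inj₂ uw) = Pairs.too-many {h = w} u∈ w∈ P? (Z? w)
    id (λ (g , e) → g , e , e)
    (leftover (≤-trans uu (≤-trans (degU≤ u) (≤-trans
      (#-cover (Y? u) (star? u w) (λ z → P? z ⊎-dec R? u w z) X λ {z} _ → split z)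
      (+-mono-≤ (star-bound u∈ w∈) (≤-trans (#-cover _ P? (R? u w) X λ _ → id) (+-monoʳ-≤ (# X P?) (#R u w))))))))
    (≤-trans 2B+2≤d (≤-trans ww (degW≤ w)))
    where
    P? : ∀ y → Dec (G y × col u y ≡ j × col w y ≡ j)
    P? y = G? y ×-dec col u y ≟ j ×-dec col w y ≟ j
    split : ∀ y → G y × col u y ≡ j → StarSet u w y ⊎ ((G y × col u y ≡ j × col w y ≡ j) ⊎ R u w y)
    split y (g , uy) with R? u w y
    ... | yes r = inj₂ (inj₂ r)
    ... | no r with dichotomy u w y (λ e → j≢k (trans (sym uy) (trans (sym e) uw))) r
    ...   | inj₁ e = inj₁ (g , uy , trans e uw)
    ...   | inj₂ e = inj₂ (inj₁ (g , uy , trans e uy))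

  Full : V → V → V → Set
  Full y u w = U u × W w × Λ y u w

  full? : ∀ y u w → Dec (Full y u w)
  full? y u w = U? u ×-dec W? w ×-dec Λ? y u w

  -- If u and u′ differ, the dichotomy at y joins u and w′ in colour j or k, against `no-link`.
  full-unique : ∀ {y u w u′ w′} → u ∈ X → w′ ∈ X → Full y u w → Full y u′ w′ → u ≡ u′
  full-unique {y} {u} {w} {u′} {w′} u∈ w′∈ (uu , _ , l) (_ , ww , l′) with u ≟ u′
  ... | yes e  = e
  ... | no u≢u′ = ⊥-elim (no-link u∈ w′∈ uu ww link)
    where
    ¬r : ¬ R y u w′
    ¬r r = u≢u′ (codegree (R-swap₂ r) (R-swap₂ (Λ⇒R l′)))
    link : col u w′ ≡ j ⊎ col u w′ ≡ k
    link with dichotomy y u w′ (λ e → j≢k (trans (sym (proj₁ l)) (trans e (proj₁ (proj₂ l′))))) ¬r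
    ... | inj₁ e = inj₁ (trans e (proj₁ l))
    ... | inj₂ e = inj₂ (trans e (proj₁ (proj₂ l′)))

  full# : ∀ y → (∑ X λ u → # X (full? y u)) ≤ 1
  full# y with (∑ X λ u → # X (full? y u)) ≤? 0
  ... | yes z = ≤-trans z z≤n
  ... | no nz with ∑-positive X _ (≰⇒> nz)
  ...   | u₀ , _ , pos with ∑-positive X _ pos
  ...     | w₀ , w₀∈ , pos′ = ≤-trans
    (∑-mono-∈ X λ {u} u∈ → #-mono (full? y u) (λ w → u ≟ u₀ ×-dec R? y u w) X
      λ _ f → full-unique u∈ w₀∈ f (⟦⟧-pos (full? y u₀ w₀) pos′) , Λ⇒R (proj₂ (proj₂ f)))
    (≤-trans (#-restrict X X (_≟ u₀) (R? y) (#R y)) (#-unique (_≟ u₀) unique λ { refl refl → refl }))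

  Λ# : ℕ
  Λ# = ∑³ X λ y u w → ⟦ Λ? y u w ⟧

  low# : ∀ {P : V → V → V → Set} (P? : ∀ x y z → Dec (P x y z)) →
         (∑³ X λ x y z → ⟦ ¬? (d ≤? (∑ X λ y → # X (P? x y))) ×-dec P? x y z ⟧) ≤ length X * d
  low# P? = ∑-≤-const X λ {x} _ → go x (d ≤? (∑ X λ y → # X (P? x y)))
    where
    go : ∀ x (p : Dec (d ≤ (∑ X λ y → # X (P? x y)))) → (∑ X λ y → # X λ z → ¬? p ×-dec P? x y z) ≤ d
    go x (yes _) = ≤-trans (≤-reflexive (trans (∑-cong X λ _ → ∑-zero X) (∑-zero X))) z≤n
    go x (no p)  = ≤-trans (∑-mono X λ y → #-mono _ (P? x y) X λ _ → proj₂) (<⇒≤ (≰⇒> p))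

  Λ#-bound : Λ# ≤ length X * (9 * B + 10)
  Λ#-bound = begin
    Λ#
      -- A triangle with a vertex of too low degree is charged to this vertex, at most d times in
      -- each of the three roles. The others are full, at most one for each y. Altogether 3d + 1 =
      -- 9B + 10.
      ≤⟨ ∑³-mono X cover ⟩
    (∑³ X λ y u w → ⟦ g? y u w ⟧ + (⟦ u? u y w ⟧ + (⟦ w? w y u ⟧ + ⟦ full? y u w ⟧)))
      ≡⟨ ∑³-+₄ X (λ y u w → ⟦ g? y u w ⟧) (λ y u w → ⟦ u? u y w ⟧) (λ y u w → ⟦ w? w y u ⟧) (λ y u w → ⟦ full? y u w ⟧) ⟩
    (∑³ X λ y u w → ⟦ g? y u w ⟧) + ((∑³ X λ y u w → ⟦ u? u y w ⟧) + ((∑³ X λ y u w → ⟦ w? w y u ⟧) + (∑³ X λ y u w → ⟦ full? y u w ⟧)))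
      ≤⟨ +-mono-≤ (low# Λ?) (+-mono-≤
           (≤-trans (≤-reflexive (∑-swap X X _)) (low# (λ u y w → GΛ? y u w)))
           (+-mono-≤
             (≤-trans (≤-reflexive (sym (∑³-rotate X λ y u w → ⟦ w? w y u ⟧))) (low# (λ w y u → GΛ? y u w)))
             (∑-≤-const X λ {y} _ → full# y))) ⟩
    length X * d + (length X * d + (length X * d + length X * 1))
      ≡⟨ lemma (length X) B ⟩
    length X * (9 * B + 10) ∎
    where
    open ≤-Reasoning
    lemma : ∀ x b → x * (3 * b + 3) + (x * (3 * b + 3) + (x * (3 * b + 3) + x * 1)) ≡ x * (9 * b + 10)
    lemma = solve-∀
    g? : ∀ y u w → Dec (¬ G y × Λ y u w)
    g? y u w = ¬? (G? y) ×-dec Λ? y u w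
    u? : ∀ u y w → Dec (¬ U u × G y × Λ y u w)
    u? u y w = ¬? (U? u) ×-dec GΛ? y u w
    w? : ∀ w y u → Dec (¬ W w × G y × Λ y u w)
    w? w y u = ¬? (W? w) ×-dec GΛ? y u w
    cover : ∀ y u w → ⟦ Λ? y u w ⟧ ≤ ⟦ g? y u w ⟧ + (⟦ u? u y w ⟧ + (⟦ w? w y u ⟧ + ⟦ full? y u w ⟧))
    cover y u w = ⟦⟧-≤ (Λ? y u w) λ l → go l (G? y) (U? u) (W? w)
      where
      go : Λ y u w → Dec (G y) → Dec (U u) → Dec (W w) → 1 ≤ ⟦ g? y u w ⟧ + (⟦ u? u y w ⟧ + (⟦ w? w y u ⟧ + ⟦ full? y u w ⟧))
      go l (no g) _ _ = ≤-trans (1≤⟦⟧ (g? y u w) (g , l)) (m≤m+n _ _)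
      go l (yes g) (no p) _ = ≤-trans (≤-trans (1≤⟦⟧ (u? u y w) (p , g , l)) (m≤m+n _ _)) (m≤n+m _ ⟦ g? y u w ⟧)
      go l (yes g) (yes p) (no q) = ≤-trans (≤-trans (≤-trans (1≤⟦⟧ (w? w y u) (q , g , l)) (m≤m+n _ _))
        (m≤n+m _ ⟦ u? u y w ⟧)) (m≤n+m _ ⟦ g? y u w ⟧)
      go l (yes g) (yes p) (yes q) = ≤-trans (≤-trans (≤-trans (1≤⟦⟧ (full? y u w) (p , q , l)) (m≤n+m _ ⟦ w? w y u ⟧))
        (m≤n+m _ ⟦ u? u y w ⟧)) (m≤n+m _ ⟦ g? y u w ⟧)

  opposite-i : ∀ {x y z} → R x y z → col y z ≡ i → Λ x y z ⊎ Λ x z y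
  opposite-i {x} {y} {z} (p , q , r) yz with col x y ≟ j | col x z ≟ j
  ... | yes e | _     = inj₁ (e , third i j _ _ i≢j (λ f → q (trans yz (sym f))) (λ f → r (trans e (sym f))) (≢-sym i≢k) (≢-sym j≢k) , yz)
  ... | no _  | yes f = inj₂ (f , third i j _ _ i≢j (λ e → p (trans e (sym yz))) (λ e → r (trans e (sym f))) (≢-sym i≢k) (≢-sym j≢k) , trans (col-sym z y) yz)
  ... | no e  | no f  = ⊥-elim (r (third i j _ _ i≢j (λ g → p (trans g (sym yz))) e (λ g → q (trans yz (sym g))) f))

  -- All three colours occur in a rainbow triangle, so one edge has colour i: three positions for it
  -- and two orders of its ends give the 6.
  sparse-bound : T3 X ≤ 6 * (length X * (9 * B + 10))
  sparse-bound = begin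
    T3 X
      ≤⟨ ∑³-mono X (λ x y z → ⟦⟧-≤ (R? x y z) λ r → go r (col y z ≟ i) (col z x ≟ i) (col x y ≟ i)) ⟩
    (∑³ X λ x y z → M x y z + (M y z x + (M z x y + 0)))
      ≡⟨ ∑³-+₄ X M (λ x y z → M y z x) (λ x y z → M z x y) (λ _ _ _ → 0) ⟩
    ∑³ X M + (∑³ X (λ x y z → M y z x) + (∑³ X (λ x y z → M z x y) + ∑³ X (λ _ _ _ → 0)))
      ≡⟨ cong (∑³ X M +_) (cong₂ _+_ (∑³-rotate X M) (cong₂ _+_ (sym (∑³-rotate X λ x y z → M z x y))
           (trans (∑-cong X λ _ → trans (∑-cong X λ _ → ∑-zero X) (∑-zero X)) (∑-zero X)))) ⟩
    3 * ∑³ X M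
      ≡⟨ cong (3 *_) (trans (∑³-+ X _ _) (cong (Λ# +_) (∑³-swap₂ X λ y u w → ⟦ Λ? y u w ⟧))) ⟩
    3 * (Λ# + Λ#)
      ≡⟨ lemma Λ# ⟩
    6 * Λ#
      ≤⟨ *-monoʳ-≤ 6 Λ#-bound ⟩
    6 * (length X * (9 * B + 10)) ∎
    where
    open ≤-Reasoning
    lemma : ∀ l → 3 * (l + l) ≡ 6 * l
    lemma = solve-∀
    M : V → V → V → ℕ
    M x y z = ⟦ Λ? x y z ⟧ + ⟦ Λ? x z y ⟧
    pick : ∀ x y z → Λ x y z ⊎ Λ x z y → 1 ≤ M x y z
    pick x y z (inj₁ l) = ≤-trans (1≤⟦⟧ (Λ? x y z) l) (m≤m+n _ _)
    pick x y z (inj₂ l) = ≤-trans (1≤⟦⟧ (Λ? x z y) l) (m≤n+m _ ⟦ Λ? x y z ⟧)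
    go : ∀ {x y z} → R x y z → Dec (col y z ≡ i) → Dec (col z x ≡ i) → Dec (col x y ≡ i) → 1 ≤ M x y z + (M y z x + (M z x y + 0))
    go {x} {y} {z} r (yes e) _ _ = ≤-trans (pick x y z (opposite-i r e)) (m≤m+n _ _)
    go {x} {y} {z} r (no _) (yes e) _ = ≤-trans (≤-trans (pick y z x (opposite-i (R-rotate r) e)) (m≤m+n _ _)) (m≤n+m _ (M x y z))
    go {x} {y} {z} r (no _) (no _) (yes e) = ≤-trans (≤-trans (≤-trans (pick z x y (opposite-i (R-rotate (R-rotate r)) e)) (m≤m+n _ 0)) (m≤n+m _ (M y z x))) (m≤n+m _ (M x y z))
    go {x} {y} {z} (p , q , r) (no a) (no b) (no c) = ⊥-elim (b (trans (col-sym z x)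
      (third (col x y) (col y z) (col x z) i p (≢-sym r) (≢-sym q) (≢-sym c) (≢-sym a))))

-- The potential and the choice of parameters

δ-positive : ∀ k → 1 ≤ k → 1 ≤ δ k
δ-positive k 1≤k = positive (δ k) (k≤3δ k)
  where
  positive : ∀ d → k ≤ 3 * d → 1 ≤ d
  positive zero    k≤0 = ≤-trans 1≤k k≤0
  positive (suc _) _   = s≤s z≤n

L-half : ∀ k {n} → 2 ^ k ≤ 2 * n → k ≤ L n
L-half zero    _ = z≤n
L-half (suc k) p = L-> (*-cancelˡ-≤ 2 p)

module Weight (K : ℕ) where

  -- For k the bit length of s, 2^(δ k) is s^(√2 - 1) up to a constant factor, so `F s` has the
  -- order K s^√2 log s.
  M : ℕ → ℕ
  M k = K * (suc k * 2 ^ δ k)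

  m : ℕ → ℕ
  m i = M (L i)

  F : ℕ → ℕ
  F s = Σ< s m

  M-mono : ∀ {j k} → j ≤ k → M j ≤ M k
  M-mono j≤k = *-monoʳ-≤ K (*-mono-≤ (s≤s j≤k) (^-monoʳ-≤ 2 (δ-mono j≤k)))

  m-mono : ∀ {i j} → i ≤ j → m i ≤ m j
  m-mono i≤j = M-mono (L-mono i≤j)

  F-mono : ∀ {s t} → s ≤ t → F s ≤ F t
  F-mono = Σ<-monoˡ m

  F-≤ : ∀ {n k} → n ≤ 2 ^ k → F n ≤ n * M k
  F-≤ {n} {k} p = ≤-trans (Σ<-mono n λ i i<n → M-mono (L-≤ {i} {k} (<-≤-trans i<n p))) (≤-reflexive (Σ<-const n (M k)))

  F-≥ : ∀ n → n * K ≤ F n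
  F-≥ n = ≤-trans (≤-reflexive (sym (Σ<-const n K)))
    (Σ<-mono n λ i _ → m≤m*n K (suc (L i) * 2 ^ δ (L i)) {{m*n≢0 (suc (L i)) (2 ^ δ (L i)) {{_}} {{m^n≢0 2 (δ (L i))}}}})

  -- Index i of the sum for a moves to b + i. No term decreases, and each of the first c gains g.
  F-gap : ∀ a b c g → c ≤ a → (∀ i → i < c → m i + g ≤ m (b + i)) → F a + F b + c * g ≤ F (b + a)
  F-gap a b c g c≤a h = begin
    F a + F b + c * g
      ≡⟨ cong (λ t → F t + F b + c * g) (m+[n∸m]≡n c≤a) ⟨
    F (c + (a ∸ c)) + F b + c * g
      ≡⟨ cong₂ (λ t t′ → t + F b + t′) (Σ<-append c (a ∸ c) m) (sym (Σ<-const c g)) ⟩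
    Σ< c m + Σ< (a ∸ c) (λ i → m (c + i)) + F b + Σ< c (λ _ → g)
      ≡⟨ lemma (Σ< c m) _ (F b) _ ⟩
    F b + (Σ< c m + Σ< c (λ _ → g) + Σ< (a ∸ c) (λ i → m (c + i)))
      ≡⟨ cong (λ t → F b + (t + Σ< (a ∸ c) (λ i → m (c + i)))) (Σ<-+ c m (λ _ → g)) ⟨
    F b + (Σ< c (λ i → m i + g) + Σ< (a ∸ c) (λ i → m (c + i)))
      ≤⟨ +-monoʳ-≤ (F b) (+-mono-≤ (Σ<-mono c h) (Σ<-mono (a ∸ c) λ i _ → m-mono (m≤n+m (c + i) b))) ⟩
    F b + (Σ< c (λ i → m (b + i)) + Σ< (a ∸ c) (λ i → m (b + (c + i))))
      ≡⟨ cong (F b +_) (Σ<-append c (a ∸ c) (λ i → m (b + i))) ⟨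
    F b + Σ< (c + (a ∸ c)) (λ i → m (b + i))
      ≡⟨ cong (λ t → F b + Σ< t (λ i → m (b + i))) (m+[n∸m]≡n c≤a) ⟩
    F b + Σ< a (λ i → m (b + i))
      ≡⟨ Σ<-append b a m ⟨
    F (b + a) ∎
    where
    open ≤-Reasoning
    lemma : ∀ x y z w → x + y + z + w ≡ z + (x + w + y)
    lemma = solve-∀

  F-superadditive : ∀ a b → F a + F b ≤ F (a + b)
  F-superadditive a b = ≤-trans (m≤m+n _ _) (≤-trans (F-gap a b 0 0 z≤n λ _ ()) (≤-reflexive (cong F (+-comm b a))))

-- `K-cut` pays for a cut, and `K-large` for the sparse case with B proportional to β; `K-small`
-- keeps the induction hypothesis for 4a vertices below order B². The last two place K between a
-- linear and a quadratic function of β.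
record Constants (K β : ℕ) : Set where
  field
    K-cut   : 13392 ≤ K
    K-large : 432 * β + 1248 ≤ K
    K-small : K ≤ 3 * (β * β)

module Parameters (K β : ℕ) (constants : Constants K β)
  (s k′ e : ℕ) (L-eq : L s ≡ suc k′) (e-eq : e + (δ (suc k′) + 3) ≡ suc k′)
  where

  open Weight K
  open Constants constants

  k = suc k′
  D = 2 ^ δ k
  D′ = 2 ^ δ k′
  -- Of the three bits by which e falls short of k - δ k, two offset the factor 4 in `Φ` and the
  -- third the rounding error of δ in `δ-critical`.
  a = 2 ^ e
  B = β * (suc k * D)

  D≤2D′ : D ≤ 2 * D′
  D≤2D′ = ^-monoʳ-≤ 2 (δ-suc-≤ k′)

  2^k′≤s : 2 ^ k′ ≤ s
  2^k′≤s = L-least s k′ L-eq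

  s<2^k : s < 2 ^ k
  s<2^k = subst (λ t → s < 2 ^ t) L-eq (n<2^L s)

  8aD≡2^k : 8 * (a * D) ≡ 2 ^ k
  8aD≡2^k = begin-equality
    8 * (a * D)  ≡⟨ lemma a D ⟩
    a * (D * 8)  ≡⟨ cong (a *_) (^-distribˡ-+-* 2 (δ k) 3) ⟨
    a * 2 ^ (δ k + 3)  ≡⟨ ^-distribˡ-+-* 2 e (δ k + 3) ⟨
    2 ^ (e + (δ k + 3))   ≡⟨ cong (2 ^_) e-eq ⟩
    2 ^ k  ∎
    where
    open ≤-Reasoning
    lemma : ∀ a d → 8 * (a * d) ≡ a * (d * 8)
    lemma = solve-∀

  1≤δ : 1 ≤ δ k
  1≤δ = δ-positive k (s≤s z≤n)

  4a<s : 4 * a < s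
  4a<s = ≤-trans (<-≤-trans (*-cancelˡ-< 2 (4 * a) (2 ^ k′) (begin-strict
    2 * (4 * a)  ≡⟨ lemma a ⟩
    8 * (a * 1)  <⟨ *-monoʳ-< 8 (*-monoʳ-< a {{m^n≢0 2 e}} (^-monoʳ-< 2 (s≤s (s≤s z≤n)) 1≤δ)) ⟩
    8 * (a * D)  ≡⟨ 8aD≡2^k ⟩
    2 ^ k  ∎)) ≤-refl) 2^k′≤s
    where
    open ≤-Reasoning
    lemma : ∀ a → 2 * (4 * a) ≡ 8 * (a * 1)
    lemma = solve-∀

  Φ = F (4 * a)

  -- With 4a = 2^j, Φ is at most K(j + 1) 2^(j + δ j), and `δ-critical` bounds this power by D².
  -- Weakening j + 1 to (k + 1)² matches the two logarithmic factors of B · 3B.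
  Φ<B² : Φ < suc B * suc (3 * B)
  Φ<B² = begin-strict
    F (4 * a)
      ≡⟨ cong F 4a≡ ⟩
    F (2 ^ j)
      ≤⟨ F-≤ {2 ^ j} {j} ≤-refl ⟩
    2 ^ j * (K * (suc j * 2 ^ δ j))
      ≡⟨ lemma₁ (2 ^ j) K (suc j) (2 ^ δ j) ⟩
    K * (suc j * (2 ^ j * 2 ^ δ j))
      ≡⟨ cong (λ t → K * (suc j * t)) (^-distribˡ-+-* 2 j (δ j)) ⟨
    K * (suc j * 2 ^ (j + δ j))
      ≤⟨ *-mono-≤ K-small (*-mono-≤ (≤-trans (s≤s j≤k) (m≤m*n (suc k) (suc k))) (^-monoʳ-≤ 2 (δ-critical k j j-eq))) ⟩
    3 * (β * β) * (suc k * suc k * 2 ^ (2 * δ k))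
      ≡⟨ cong (λ t → 3 * (β * β) * (suc k * suc k * t)) (trans (cong (2 ^_) (cong (δ k +_) (+-identityʳ (δ k)))) (^-distribˡ-+-* 2 (δ k) (δ k))) ⟩
    3 * (β * β) * (suc k * suc k * (D * D))
      ≡⟨ lemma₂ β (suc k) D ⟩
    B * (3 * B)
      <⟨ *-mono-< (n<1+n B) (n<1+n (3 * B)) ⟩
    suc B * suc (3 * B) ∎
    where
    open ≤-Reasoning
    j = e + 2
    4a≡ : 4 * a ≡ 2 ^ j
    4a≡ = trans (*-comm 4 a) (sym (^-distribˡ-+-* 2 e 2))
    j-eq : suc j + δ k ≡ k
    j-eq = trans (lemma e (δ k)) e-eq
      where
      lemma : ∀ e d → 1 + (e + 2) + d ≡ e + (d + 3)
      lemma = solve-∀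
    j≤k : j ≤ k
    j≤k = ≤-trans (n≤1+n j) (≤-trans (m≤m+n (suc j) (δ k)) (≤-reflexive j-eq))
    lemma₁ : ∀ x K y z → x * (K * (y * z)) ≡ K * (y * (x * z))
    lemma₁ = solve-∀
    lemma₂ : ∀ b k d → 3 * (b * b) * (k * k * (d * d)) ≡ b * (k * d) * (3 * (b * (k * d)))
    lemma₂ = solve-∀

  -- At least half of the indices below s have bit length k - 1 or more. The 8 collects this half, k
  -- + 1 ≤ 2k and D ≤ 2D′.
  F-lower : s * (K * (suc k * D)) ≤ 8 * F s
  F-lower = begin
    s * (K * (suc k * D))
      ≤⟨ *-mono-≤ s≤ (*-monoʳ-≤ K (*-mono-≤ sk≤ D≤2D′)) ⟩
    2 * (s ∸ h) * (K * (2 * k * (2 * D′)))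
      ≡⟨ lemma (s ∸ h) K k D′ ⟩
    8 * ((s ∸ h) * M k′)
      ≤⟨ *-monoʳ-≤ 8 (begin
           (s ∸ h) * M k′  ≡⟨ Σ<-const (s ∸ h) (M k′) ⟨
           Σ< (s ∸ h) (λ _ → M k′)  ≤⟨ Σ<-mono (s ∸ h) (λ i _ → M-mono (half i)) ⟩
           Σ< (s ∸ h) (λ i → m (h + i))  ≤⟨ m≤n+m _ (Σ< h m) ⟩
           Σ< h m + Σ< (s ∸ h) (λ i → m (h + i)) ≡⟨ Σ<-append h (s ∸ h) m ⟨
           F (h + (s ∸ h))  ≡⟨ cong F (m+[n∸m]≡n h≤s) ⟩
           F s  ∎) ⟩
    8 * F s ∎
    where
    open ≤-Reasoning
    h = 2 ^ (k′ ∸ 1)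
    2h : k′ ≢ 0 → 2 * h ≡ 2 ^ k′
    2h ne = cong (2 ^_) (m+[n∸m]≡n (n≢0⇒n>0 ne))
    k′≢0 : k′ ≢ 0
    k′≢0 refl = <⇒≱ (≤-<-trans (m≤n+m 3 (e + δ 1)) (≤-<-trans (≤-reflexive (trans (+-assoc e (δ 1) 3) e-eq)) (s≤s (s≤s z≤n)))) (s≤s (s≤s z≤n))
    2h≤s : 2 * h ≤ s
    2h≤s = ≤-trans (≤-reflexive (2h k′≢0)) 2^k′≤s
    h≤s : h ≤ s
    h≤s = ≤-trans (m≤m+n h (h + 0)) 2h≤s
    half : ∀ i → k′ ≤ L (h + i)
    half i = subst (_≤ L (h + i)) (m+[n∸m]≡n (n≢0⇒n>0 k′≢0)) (L-> {k = k′ ∸ 1} (m≤m+n h i))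
    s≤ : s ≤ 2 * (s ∸ h)
    s≤ = +-cancelʳ-≤ (2 * h) s _ (≤-trans (+-monoʳ-≤ s 2h≤s) (≤-reflexive (sym (trans (sym (*-distribˡ-+ 2 (s ∸ h) h))
           (trans (cong (2 *_) (m∸n+n≡m h≤s)) (cong (s +_) (+-identityʳ s)))))))
    sk≤ : suc k ≤ 2 * k
    sk≤ = ≤-trans (≤-reflexive (+-comm 1 k)) (+-monoʳ-≤ k (≤-trans (s≤s z≤n) (m≤m+n k 0)))
    lemma : ∀ t K k d → 2 * t * (K * (2 * k * (2 * d))) ≡ 8 * (t * (K * (k * d)))
    lemma = solve-∀

  -- Pays for the triangles outside the main majority class. With γ = √2 - 1 the two sides have
  -- orders s^(2 - 2γ) and s^(1 + γ), so the reason is γ ≥ 1/3, in the form `k≤3δ`.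
  a²≤sD : a * a ≤ s * D
  a²≤sD = begin
    a * a  ≡⟨ ^-distribˡ-+-* 2 e e ⟨
    2 ^ (e + e)  ≤⟨ ^-monoʳ-≤ 2 exponents ⟩
    2 ^ (k′ + δ k)  ≡⟨ ^-distribˡ-+-* 2 k′ (δ k) ⟩
    2 ^ k′ * D  ≤⟨ *-monoˡ-≤ D 2^k′≤s ⟩
    s * D  ∎
    where
    open ≤-Reasoning
    exponents : e + e ≤ k′ + δ k
    exponents = +-cancelʳ-≤ (2 * (δ k + 3)) _ _ (begin
      e + e + 2 * (δ k + 3)  ≡⟨ lemma₁ e (δ k) ⟩
      2 * (e + (δ k + 3))  ≡⟨ cong (2 *_) e-eq ⟩
      2 * k  ≤⟨ +-monoʳ-≤ k (≤-trans (≤-reflexive (+-identityʳ k)) (k≤3δ k)) ⟩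
      k + 3 * δ k  ≤⟨ m≤m+n _ 5 ⟩
      suc k′ + 3 * δ k + 5  ≡⟨ lemma₂ k′ (δ k) ⟩
      k′ + δ k + 2 * (δ k + 3)  ∎)
      where
      lemma₁ : ∀ e d → e + e + 2 * (d + 3) ≡ 2 * (e + (d + 3))
      lemma₁ = solve-∀
      lemma₂ : ∀ k d → 1 + k + 3 * d + 5 ≡ k + d + 2 * (d + 3)
      lemma₂ = solve-∀

  sparse-cost : ∀ {x} → x ≤ s → 96 * (a * a) + 6 * (x * (9 * B + 10)) ≤ F s
  sparse-cost {x} x≤s = *-cancelˡ-≤ 8 (begin
    8 * (96 * (a * a) + 6 * (x * (9 * B + 10)))
      ≤⟨ *-monoʳ-≤ 8 (+-mono-≤ (*-monoʳ-≤ 96 a²≤sD) (*-monoʳ-≤ 6 (*-monoˡ-≤ (9 * B + 10) x≤s))) ⟩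
    8 * (96 * (s * D) + 6 * (s * (9 * B + 10)))
      ≡⟨ lemma₁ s D B ⟩
    768 * (s * D) + 432 * (s * B) + 480 * s
      ≤⟨ +-mono-≤ (+-monoˡ-≤ (432 * (s * B)) (*-monoʳ-≤ 768 (*-monoʳ-≤ s (m≤m+n D (k * D)))))
                  (*-monoʳ-≤ 480 (m≤m*n s (suc k * D) {{m*n≢0 (suc k) D {{_}} {{m^n≢0 2 (δ k)}}}})) ⟩
    768 * (s * (suc k * D)) + 432 * (s * (β * (suc k * D))) + 480 * (s * (suc k * D))
      ≡⟨ lemma₂ s (suc k * D) β ⟩
    s * ((432 * β + 1248) * (suc k * D))
      ≤⟨ *-monoʳ-≤ s (*-monoˡ-≤ (suc k * D) K-large) ⟩
    s * (K * (suc k * D))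
      ≤⟨ F-lower ⟩
    8 * F s ∎)
    where
    open ≤-Reasoning
    lemma₁ : ∀ s d b → 8 * (96 * (s * d) + 6 * (s * (9 * b + 10))) ≡ 768 * (s * d) + 432 * (s * b) + 480 * s
    lemma₁ = solve-∀
    lemma₂ : ∀ s d b → 768 * (s * d) + 432 * (s * (b * d)) + 480 * (s * d) ≡ s * ((432 * b + 1248) * d)
    lemma₂ = solve-∀

  cost = 3 * (45 * s + 12 * Iso (s + s))
  gap = K * ((δ k + 2) * D′)

  -- The constant of `K-cut` is 13392 = 16 · 3 · (45 · 3 + 12 · 4 · 3): each inner 3 comes from k ≤
  -- 3δ k, the 4 from 2s(k + 1) ≤ 4ks, and 16 from 8aD = 2^k and D ≤ 2D′.
  cost≤ : cost ≤ a * gap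
  cost≤ = *-cancelˡ-≤ 16 (begin
    16 * cost
      ≤⟨ *-monoʳ-≤ 16 (*-monoʳ-≤ 3 (+-monoʳ-≤ (45 * s) (*-monoʳ-≤ 12 (Iso-≤ (s + s) (suc k) 2s≤)))) ⟩
    16 * (3 * (45 * s + 12 * ((s + s) * suc k)))
      ≤⟨ *-monoʳ-≤ 16 (*-monoʳ-≤ 3 (+-mono-≤ (*-monoʳ-≤ 45 (m≤m+n s (k′ * s))) (*-monoʳ-≤ 12 double))) ⟩
    16 * (3 * (45 * (k * s) + 12 * (4 * (k * s))))
      ≤⟨ *-monoʳ-≤ 16 (*-monoʳ-≤ 3 (+-mono-≤ (*-monoʳ-≤ 45 ks≤) (*-monoʳ-≤ 12 (*-monoʳ-≤ 4 ks≤)))) ⟩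
    16 * (3 * (45 * (3 * (δ k + 2) * 2 ^ k) + 12 * (4 * (3 * (δ k + 2) * 2 ^ k))))
      ≡⟨ lemma₂ (δ k + 2) (2 ^ k) ⟩
    13392 * ((δ k + 2) * 2 ^ k)
      ≤⟨ *-monoˡ-≤ _ K-cut ⟩
    K * ((δ k + 2) * 2 ^ k)
      ≡⟨ cong (λ t → K * ((δ k + 2) * t)) 8aD≡2^k ⟨
    K * ((δ k + 2) * (8 * (a * D)))
      ≤⟨ *-monoʳ-≤ K (*-monoʳ-≤ (δ k + 2) (*-monoʳ-≤ 8 (*-monoʳ-≤ a D≤2D′))) ⟩
    K * ((δ k + 2) * (8 * (a * (2 * D′))))
      ≡⟨ lemma₃ K (δ k + 2) a D′ ⟩
    16 * (a * gap) ∎)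
    where
    open ≤-Reasoning
    2s≤ : s + s ≤ 2 ^ suc k
    2s≤ = ≤-trans (+-mono-≤ (<⇒≤ s<2^k) (<⇒≤ s<2^k)) (≤-reflexive (sym (2*-suc k)))
    double : (s + s) * suc k ≤ 4 * (k * s)
    double = ≤-trans (*-monoʳ-≤ (s + s) {suc k} {2 * k} (≤-trans (≤-reflexive (+-comm 1 k)) (+-monoʳ-≤ k (m≤m+n 1 (k′ + 0)))))
      (≤-reflexive (lemma₁ s k))
      where
      lemma₁ : ∀ s k → (s + s) * (2 * k) ≡ 4 * (k * s)
      lemma₁ = solve-∀
    ks≤ : k * s ≤ 3 * (δ k + 2) * 2 ^ k
    ks≤ = *-mono-≤ (≤-trans (k≤3δ k) (*-monoʳ-≤ 3 (m≤m+n (δ k) 2))) (<⇒≤ s<2^k)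
    lemma₂ : ∀ d p → 16 * (3 * (45 * (3 * d * p) + 12 * (4 * (3 * d * p)))) ≡ 13392 * (d * p)
    lemma₂ = solve-∀
    lemma₃ : ∀ K d a p → K * (d * (8 * (a * (2 * p)))) ≡ 16 * (a * (K * (d * p)))
    lemma₃ = solve-∀

  -- The logarithmic factor provides the whole gap: e + 1 and δ k + 2 add up to k, while both powers
  -- of 2 are estimated by D′.
  M-gap : M e + gap ≤ M k′
  M-gap = begin
    K * (suc e * 2 ^ δ e) + gap
      ≤⟨ +-monoˡ-≤ gap (*-monoʳ-≤ K (*-monoʳ-≤ (suc e) (^-monoʳ-≤ 2 (δ-mono e≤k′)))) ⟩
    K * (suc e * D′) + K * ((δ k + 2) * D′)
      ≡⟨ lemma K e (δ k) D′ ⟩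
    K * ((e + (δ k + 3)) * D′)
      ≡⟨ cong (λ t → K * (t * D′)) e-eq ⟩
    K * (k * D′) ∎
    where
    open ≤-Reasoning
    lemma : ∀ K e d p → K * ((1 + e) * p) + K * ((d + 2) * p) ≡ K * ((e + (d + 3)) * p)
    lemma = solve-∀
    e≤k′ : e ≤ k′
    e≤k′ = ≤-pred (≤-trans (≤-trans (≤-reflexive (+-comm 1 e)) (+-monoʳ-≤ e (≤-trans (s≤s z≤n) (m≤n+m 3 (δ k))))) (≤-reflexive e-eq))

  -- The part x is moved on top of b = y + z. Since b ≥ s/2, every new index has bit length at least
  -- k - 1, whereas the first a old ones had at most e.
  cut-step : ∀ {x y z} → a ≤ x → x ≤ y → x + (y + z) ≡ s → F x + (F y + F z) + cost ≤ F s
  cut-step {x} {y} {z} a≤x x≤y eq = begin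
    F x + (F y + F z) + cost  ≤⟨ +-mono-≤ (+-monoʳ-≤ (F x) (F-superadditive y z)) cost≤ ⟩
    F x + F b + a * gap  ≤⟨ F-gap x b a gap a≤x step ⟩
    F (b + x)  ≡⟨ cong F (trans (+-comm b x) eq) ⟩
    F s  ∎
    where
    open ≤-Reasoning
    b = y + z
    s≤2b : s ≤ 2 * b
    s≤2b = ≤-trans (≤-reflexive (sym eq)) (+-mono-≤ (≤-trans x≤y (m≤m+n y z)) (m≤m+n b 0))
    large : ∀ i → k′ ≤ L (b + i)
    large i = L-half k′ (≤-trans 2^k′≤s (≤-trans s≤2b (*-monoʳ-≤ 2 (m≤m+n b i))))
    step : ∀ i → i < a → m i + gap ≤ m (b + i)
    step i i<a = ≤-trans (+-monoˡ-≤ gap (M-mono (L-≤ {i} {e} i<a))) (≤-trans M-gap (M-mono (large i)))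

  cut-step′ : ∀ {x y z} → a ≤ x → a ≤ y → x + (y + z) ≡ s → F x + (F y + F z) + cost ≤ F s
  cut-step′ {x} {y} {z} a≤x a≤y eq with ≤-total x y
  ... | inj₁ x≤y = cut-step a≤x x≤y eq
  ... | inj₂ y≤x = ≤-trans (≤-reflexive (cong (_+ cost) (lemma (F x) (F y) (F z)))) (cut-step a≤y y≤x (trans (lemma y x z) eq))
    where
    lemma : ∀ x y z → x + (y + z) ≡ y + (x + z)
    lemma = solve-∀

-- The recursion

#-filter-≤ : ∀ {A : Set} {P Q : A → Set} (P? : Decidable P) (Q? : Decidable Q) xs → # (filter P? xs) Q? ≤ # xs Q?
#-filter-≤ P? Q? xs = ≤-trans (m≤m+n _ _) (≤-reflexive (sym (∑-filter-split P? xs _)))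

module Recursion {n : ℕ} (col : Fin n → Fin n → Fin 3) (col-sym : ∀ x y → col x y ≡ col y x)
  (codegree : ∀ {x y z z′} → RainbowTriple col x y z → RainbowTriple col x y z′ → z ≡ z′)
  (K β : ℕ) (constants : Constants K β)
  where

  open Graph col col-sym
  open Weight K
  open Constants constants

  module Step (S : List V) (unique : Unique S)
    (k′ e : ℕ) (L-eq : L (length S) ≡ suc k′) (e-eq : e + (δ (suc k′) + 3) ≡ suc k′)
    (IH : ∀ S′ → Unique S′ → length S′ < length S → T3 S′ ≤ F (length S′))
    where

    open Parameters K β constants (length S) k′ e L-eq e-eq using (a; B; Φ; Φ<B²; 4a<s; sparse-cost; cost; cut-step′)

    s = length S

    N : V → Fin 3 → List V
    N v i = filter (λ x → col v x ≟ i) S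

    deg : V → Fin 3 → ℕ
    deg v i = length (N v i)

    deg-sum : ∀ v → deg v 0F + (deg v 1F + deg v 2F) ≡ s
    deg-sum v = begin-equality
      deg v 0F + (deg v 1F + deg v 2F)  ≡⟨ ∑-palette (deg v) ⟨
      ∑ palette (deg v)  ≡⟨ ∑-cong palette (λ i → length-# (λ x → col v x ≟ i) S) ⟩
      (∑ palette λ i → # S λ x → col v x ≟ i)  ≡⟨ ∑-swap palette S _ ⟩
      (∑ S λ x → # palette λ i → col v x ≟ i)  ≡⟨ ∑-cong S (λ x → palette-once (col v x)) ⟩
      (∑ S λ _ → 1)  ≡⟨ ∑-const S 1 ⟩
      s * 1  ≡⟨ *-identityʳ s ⟩
      s  ∎
      where open ≤-Reasoning

    1≤a : 1 ≤ a
    1≤a = m^n>0 2 e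

    Two : V → Set
    Two v = (a ≤ deg v 0F × a ≤ deg v 1F) ⊎ (a ≤ deg v 0F × a ≤ deg v 2F) ⊎
            (a ≤ deg v 1F × a ≤ deg v 2F)

    two? : ∀ v → Dec (Two v)
    two? v = (a ≤? deg v 0F ×-dec a ≤? deg v 1F) ⊎-dec (a ≤? deg v 0F ×-dec a ≤? deg v 2F) ⊎-dec
             (a ≤? deg v 1F ×-dec a ≤? deg v 2F)

    cut-case : ∀ v → Two v → T3 S ≤ F s
    cut-case v two = begin
      T3 S
        ≤⟨ CutAt.cut col col-sym codegree v S unique ⟩
      (∑ palette λ i → T3 (N v i)) + cost
        ≤⟨ +-monoˡ-≤ cost (∑-mono palette λ i → IH (N v i) (unique-filter _ unique) (proper i two)) ⟩
      (∑ palette λ i → F (deg v i)) + cost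
        ≡⟨ cong (_+ cost) (∑-palette (λ i → F (deg v i))) ⟩
      F x + (F y + F z) + cost
        ≤⟨ merge two ⟩
      F s ∎
      where
      open ≤-Reasoning
      x = deg v 0F
      y = deg v 1F
      z = deg v 2F
      below : ∀ {p q r} → 1 ≤ q → p + q + r ≡ s → p < s
      below {p} {q} {r} 1≤q eq = ≤-trans (≤-trans (≤-reflexive (+-comm 1 p)) (+-monoʳ-≤ p 1≤q)) (≤-trans (m≤m+n (p + q) r) (≤-reflexive eq))
      Σ₁ : x + (y + z) ≡ s
      Σ₁ = deg-sum v
      e₁ : ∀ x y z → x + (y + z) ≡ x + y + z
      e₁ = solve-∀
      e₂ : ∀ x y z → x + (y + z) ≡ x + z + y
      e₂ = solve-∀
      e₃ : ∀ x y z → x + (y + z) ≡ y + x + z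
      e₃ = solve-∀
      e₄ : ∀ x y z → x + (y + z) ≡ y + z + x
      e₄ = solve-∀
      e₅ : ∀ x y z → x + (y + z) ≡ z + x + y
      e₅ = solve-∀
      e₆ : ∀ x y z → x + (y + z) ≡ z + y + x
      e₆ = solve-∀
      via : ∀ {p} → x + (y + z) ≡ p → p ≡ s
      via eq = trans (sym eq) Σ₁
      proper : ∀ i → Two v → deg v i < s
      proper 0F (inj₁ (_ , q))        = below (≤-trans 1≤a q) (via (e₁ x y z))
      proper 0F (inj₂ (inj₁ (_ , q))) = below (≤-trans 1≤a q) (via (e₂ x y z))
      proper 0F (inj₂ (inj₂ (_ , q))) = below (≤-trans 1≤a q) (via (e₂ x y z))
      proper 1F (inj₁ (p , _))        = below (≤-trans 1≤a p) (via (e₃ x y z))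
      proper 1F (inj₂ (inj₁ (p , _))) = below (≤-trans 1≤a p) (via (e₃ x y z))
      proper 1F (inj₂ (inj₂ (_ , q))) = below (≤-trans 1≤a q) (via (e₄ x y z))
      proper 2F (inj₁ (p , _))        = below (≤-trans 1≤a p) (via (e₅ x y z))
      proper 2F (inj₂ (inj₁ (p , _))) = below (≤-trans 1≤a p) (via (e₅ x y z))
      proper 2F (inj₂ (inj₂ (p , _))) = below (≤-trans 1≤a p) (via (e₆ x y z))
      c₁ : ∀ x y z → x + (y + z) ≡ x + (z + y)
      c₁ = solve-∀
      c₂ : ∀ x y z → x + (y + z) ≡ y + (z + x)
      c₂ = solve-∀
      merge : Two v → F x + (F y + F z) + cost ≤ F s
      merge (inj₁ (p , q))        = cut-step′ p q Σ₁
      merge (inj₂ (inj₁ (p , q))) = ≤-trans (≤-reflexive (cong (_+ cost) (c₁ (F x) (F y) (F z)))) (cut-step′ p q (via (c₁ x y z)))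
      merge (inj₂ (inj₂ (p , q))) = ≤-trans (≤-reflexive (cong (_+ cost) (c₂ (F x) (F y) (F z)))) (cut-step′ p q (via (c₂ x y z)))

    module NoTwo (no-two : ∀ {v} → v ∈ S → ¬ Two v) where

      Maj : Fin 3 → V → Set
      Maj i v = a ≤ deg v i

      maj? : ∀ i v → Dec (Maj i v)
      maj? i v = a ≤? deg v i

      exclusive : ∀ {v} i j → i ≢ j → v ∈ S → Maj i v → deg v j < a
      exclusive i j i≢j v∈ p = ≰⇒> λ q → no-two v∈ (go i j i≢j p q)
        where
        go : ∀ {v} i j → i ≢ j → Maj i v → Maj j v → Two v
        go 0F 0F ne p q = ⊥-elim (ne refl)
        go 0F 1F ne p q = inj₁ (p , q)
        go 0F 2F ne p q = inj₂ (inj₁ (p , q))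
        go 1F 0F ne p q = inj₁ (q , p)
        go 1F 1F ne p q = ⊥-elim (ne refl)
        go 1F 2F ne p q = inj₂ (inj₂ (p , q))
        go 2F 0F ne p q = inj₂ (inj₁ (q , p))
        go 2F 1F ne p q = inj₂ (inj₂ (q , p))
        go 2F 2F ne p q = ⊥-elim (ne refl)

      majority : ∀ v → ∃ λ i → Maj i v
      majority v with maj? 0F v | maj? 1F v | maj? 2F v
      ... | yes p | _     | _     = 0F , p
      ... | no _  | yes p | _     = 1F , p
      ... | no _  | no _  | yes p = 2F , p
      ... | no p  | no q  | no r  = ⊥-elim (<⇒≱ 4a<s (begin
        s  ≡⟨ deg-sum v ⟨
        deg v 0F + (deg v 1F + deg v 2F)   ≤⟨ +-mono-≤ (<⇒≤ (≰⇒> p)) (+-mono-≤ (<⇒≤ (≰⇒> q)) (<⇒≤ (≰⇒> r))) ⟩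
        a + (a + a)  ≤⟨ +-monoʳ-≤ a (+-monoʳ-≤ a (m≤m+n a (a + 0))) ⟩
        4 * a  ∎))
        where open ≤-Reasoning

      among : ∀ (i j k : Fin 3) → i ≢ j → i ≢ k → j ≢ k → ∀ c → c ≢ i → c ≡ j ⊎ c ≡ k
      among i j k i≢j i≢k j≢k c c≢i with c ≟ j
      ... | yes e = inj₁ e
      ... | no e  = inj₂ (third i j c k i≢j c≢i e (≢-sym i≢k) (≢-sym j≢k))

      minority : ∀ i j k → i ≢ j → i ≢ k → j ≢ k → ∀ {v} → v ∈ S → Maj i v → # S (λ x → ¬? (col v x ≟ i)) ≤ 2 * a
      minority i j k i≢j i≢k j≢k {v} v∈ p = begin
        # S (λ x → ¬? (col v x ≟ i))
          ≤⟨ #-cover _ (λ x → col v x ≟ j) (λ x → col v x ≟ k) S (λ {x} _ → among i j k i≢j i≢k j≢k (col v x)) ⟩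
        # S (λ x → col v x ≟ j) + # S (λ x → col v x ≟ k)
          ≡⟨ cong₂ _+_ (length-# (λ x → col v x ≟ j) S) (length-# (λ x → col v x ≟ k) S) ⟨
        deg v j + deg v k
          ≤⟨ +-mono-≤ (<⇒≤ (exclusive i j i≢j v∈ p)) (≤-trans (<⇒≤ (exclusive i k i≢k v∈ p)) (m≤m+n a 0)) ⟩
        2 * a ∎
        where open ≤-Reasoning

      other : ∀ (i j : Fin 3) → i ≢ j → ∃ λ k → i ≢ k × j ≢ k
      other 0F 0F ne = ⊥-elim (ne refl)
      other 0F 1F ne = 2F , (λ ()) , (λ ())
      other 0F 2F ne = 1F , (λ ()) , (λ ())
      other 1F 0F ne = 2F , (λ ()) , (λ ())
      other 1F 1F ne = ⊥-elim (ne refl)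
      other 1F 2F ne = 0F , (λ ()) , (λ ())
      other 2F 0F ne = 1F , (λ ()) , (λ ())
      other 2F 1F ne = 0F , (λ ()) , (λ ())
      other 2F 2F ne = ⊥-elim (ne refl)

      Xs : Fin 3 → List V
      Xs i = filter (maj? i) S

      minority′ : ∀ i j → i ≢ j → ∀ {v} → v ∈ S → Maj i v → # S (λ x → ¬? (col v x ≟ i)) ≤ 2 * a
      minority′ i j i≢j = let k , i≢k , j≢k = other i j i≢j in minority i j k i≢j i≢k j≢k

      -- An edge between Xs i and Xs j has a minority colour at one of its ends.
      few : ∀ i j → i ≢ j → length (Xs j) ≤ length (Xs i) → length (Xs j) ≤ 4 * a
      few i j i≢j q≤p = ≮⇒≥ λ 4a<q → <⇒≱ (*-monoʳ-< p {{ℕ.>-nonZero (≤-trans (≤-trans (s≤s z≤n) 4a<q) q≤p)}} 4a<q) (begin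
        p * q
          ≡⟨ trans (∑-cong (Xs i) (λ x → trans (∑-const (Xs j) 1) (*-identityʳ q))) (∑-const (Xs i) q) ⟨
        (∑ (Xs i) λ x → ∑ (Xs j) λ y → 1)
          ≤⟨ ∑-mono (Xs i) (λ x → ∑-mono (Xs j) λ y → ⟦⟧-cover (yes tt) (x≁ x y) (y≁ x y) (λ _ → off x y)) ⟩
        (∑ (Xs i) λ x → ∑ (Xs j) λ y → ⟦ x≁ x y ⟧ + ⟦ y≁ x y ⟧)
          ≡⟨ trans (∑-cong (Xs i) λ x → ∑-+ (Xs j) _ _) (∑-+ (Xs i) _ _) ⟩
        (∑ (Xs i) λ x → # (Xs j) (x≁ x)) + (∑ (Xs i) λ x → # (Xs j) (y≁ x))
          ≡⟨ cong ((∑ (Xs i) λ x → # (Xs j) (x≁ x)) +_) (∑-swap (Xs i) (Xs j) _) ⟩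
        (∑ (Xs i) λ x → # (Xs j) (x≁ x)) + (∑ (Xs j) λ y → # (Xs i) λ x → y≁ x y)
          ≤⟨ +-mono-≤ (∑-≤-const (Xs i) λ {x} x∈ → ≤-trans (#-filter-≤ (maj? j) (x≁ x) S)
                         (minority′ i j i≢j (filter-⊆ (maj? i) S x∈) (filter-P (maj? i) S x∈)))
                      (∑-≤-const (Xs j) λ {y} y∈ → ≤-trans (#-filter-≤ (maj? i) (λ x → y≁ x y) S)
                         (minority′ j i (≢-sym i≢j) (filter-⊆ (maj? j) S y∈) (filter-P (maj? j) S y∈))) ⟩
        p * (2 * a) + q * (2 * a)
          ≤⟨ +-monoʳ-≤ (p * (2 * a)) (*-monoˡ-≤ (2 * a) q≤p) ⟩
        p * (2 * a) + p * (2 * a)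
          ≡⟨ lemma p a ⟩
        p * (4 * a) ∎)
        where
        open ≤-Reasoning
        p = length (Xs i)
        q = length (Xs j)
        x≁ : ∀ x y → Dec (col x y ≢ i)
        x≁ x y = ¬? (col x y ≟ i)
        y≁ : ∀ x y → Dec (col y x ≢ j)
        y≁ x y = ¬? (col y x ≟ j)
        off : ∀ x y → col x y ≢ i ⊎ col y x ≢ j
        off x y with col x y ≟ i
        ... | no e  = inj₁ e
        ... | yes e = inj₂ λ f → i≢j (trans (sym e) (trans (col-sym x y) f))
        lemma : ∀ p a → p * (2 * a) + p * (2 * a) ≡ p * (4 * a)
        lemma = solve-∀

      -- The two edges of a rainbow triangle at y differ in colour, so the first or the second has a
      -- minority colour; either case leaves 2a choices.
      triangles-at : ∀ {y} → y ∈ S → (∑ S λ x → # S (R? y x)) ≤ 4 * a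
      triangles-at {y} y∈ with majority y
      ... | l , p = begin
        (∑ S λ x → # S (R? y x))
          ≤⟨ ∑-mono S (λ x → #-cover _ (λ z → ¬? (col y x ≟ l) ×-dec R? y x z) (λ z → ¬? (col y z ≟ l) ×-dec R? y x z) S λ _ → split) ⟩
        (∑ S λ x → (# S λ z → ¬? (col y x ≟ l) ×-dec R? y x z) + (# S λ z → ¬? (col y z ≟ l) ×-dec R? y x z))
          ≡⟨ ∑-+ S _ _ ⟩
        (∑ S λ x → # S λ z → ¬? (col y x ≟ l) ×-dec R? y x z) + (∑ S λ x → # S λ z → ¬? (col y z ≟ l) ×-dec R? y x z)
          ≡⟨ cong ((∑ S λ x → # S λ z → ¬? (col y x ≟ l) ×-dec R? y x z) +_) (∑-swap S S _) ⟩
        (∑ S λ x → # S λ z → ¬? (col y x ≟ l) ×-dec R? y x z) + (∑ S λ z → # S λ x → ¬? (col y z ≟ l) ×-dec R? y x z)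
          ≤⟨ +-mono-≤ (#-restrict S S (λ x → ¬? (col y x ≟ l)) (R? y) (#R≤1 codegree unique y))
                      (#-restrict S S (λ z → ¬? (col y z ≟ l)) (λ z x → R? y x z)
                        λ z → #-unique (λ x → R? y x z) unique λ r r′ → codegree (R-swap₂ r) (R-swap₂ r′)) ⟩
        # S (λ x → ¬? (col y x ≟ l)) + # S (λ x → ¬? (col y x ≟ l))
          ≤⟨ +-mono-≤ (min l refl) (min l refl) ⟩
        2 * a + 2 * a
          ≡⟨ lemma a ⟩
        4 * a ∎
        where
        open ≤-Reasoning
        split : ∀ {x z} → R y x z → (col y x ≢ l × R y x z) ⊎ (col y z ≢ l × R y x z)
        split {x} {z} r with col y x ≟ l
        ... | no e  = inj₁ (e , r)
        ... | yes e = inj₂ ((λ f → proj₂ (proj₂ r) (trans e (sym f))) , r)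
        min : ∀ l′ → l ≡ l′ → # S (λ x → ¬? (col y x ≟ l′)) ≤ 2 * a
        min 0F refl = minority′ 0F 1F (λ ()) y∈ p
        min 1F refl = minority′ 1F 0F (λ ()) y∈ p
        min 2F refl = minority′ 2F 0F (λ ()) y∈ p
        lemma : ∀ a → 2 * a + 2 * a ≡ 4 * a
        lemma = solve-∀

      -- Outside X there are at most 4a vertices for each of the other two majority colours, and
      -- each begins at most 4a rainbow triples. The three positions give 3 · 8a · 4a = 96a².
      sparse-case : ∀ i j k → i ≢ j → i ≢ k → j ≢ k →
                    length (Xs j) ≤ length (Xs i) → length (Xs k) ≤ length (Xs i) → T3 S ≤ F s
      sparse-case i j k i≢j i≢k j≢k q≤p r≤p = begin
        T3 S
          ≤⟨ ∑³-mono S cover ⟩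
        (∑³ S λ x y z → ⟦ in? x y z ⟧ + (⟦ out? x y z ⟧ + (⟦ out? y z x ⟧ + ⟦ out? z x y ⟧)))
          ≡⟨ ∑³-+₄ S (λ x y z → ⟦ in? x y z ⟧) (λ x y z → ⟦ out? x y z ⟧) (λ x y z → ⟦ out? y z x ⟧) (λ x y z → ⟦ out? z x y ⟧) ⟩
        (∑³ S λ x y z → ⟦ in? x y z ⟧) + (O + ((∑³ S λ x y z → ⟦ out? y z x ⟧) + (∑³ S λ x y z → ⟦ out? z x y ⟧)))
          ≡⟨ cong₂ _+_ (sym (T3-filter (maj? i) S)) (cong (O +_) (cong₂ _+_ (∑³-rotate S (λ x y z → ⟦ out? x y z ⟧))
               (sym (∑³-rotate S (λ x y z → ⟦ out? z x y ⟧))))) ⟩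
        T3 X + (O + (O + O))
          ≤⟨ +-mono-≤ Sp.sparse-bound (+-mono-≤ O≤ (+-mono-≤ O≤ O≤)) ⟩
        6 * (length X * (9 * B + 10)) + (8 * a * (4 * a) + (8 * a * (4 * a) + 8 * a * (4 * a)))
          ≡⟨ lemma (6 * (length X * (9 * B + 10))) a ⟩
        96 * (a * a) + 6 * (length X * (9 * B + 10))
          ≤⟨ sparse-cost (≤-trans (m≤m+n (length X) _) (≤-reflexive (sym (length-filter-split (maj? i) S)))) ⟩
        F s ∎
        where
        open ≤-Reasoning
        lemma : ∀ t a → t + (8 * a * (4 * a) + (8 * a * (4 * a) + 8 * a * (4 * a))) ≡ 96 * (a * a) + t
        lemma = solve-∀
        X = Xs i
        in? : ∀ x y z → Dec (Maj i x × Maj i y × Maj i z × R x y z)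
        in? x y z = maj? i x ×-dec maj? i y ×-dec maj? i z ×-dec R? x y z
        out? : ∀ x y z → Dec (¬ Maj i x × R x y z)
        out? x y z = ¬? (maj? i x) ×-dec R? x y z
        O = ∑³ S λ x y z → ⟦ out? x y z ⟧
        cover : ∀ x y z → ⟦ R? x y z ⟧ ≤ ⟦ in? x y z ⟧ + (⟦ out? x y z ⟧ + (⟦ out? y z x ⟧ + ⟦ out? z x y ⟧))
        cover x y z = ⟦⟧-≤ (R? x y z) λ r → go r (maj? i x) (maj? i y) (maj? i z)
          where
          go : R x y z → Dec (Maj i x) → Dec (Maj i y) → Dec (Maj i z) →
               1 ≤ ⟦ in? x y z ⟧ + (⟦ out? x y z ⟧ + (⟦ out? y z x ⟧ + ⟦ out? z x y ⟧))
          go r (no p) _ _ = ≤-trans (≤-trans (1≤⟦⟧ (out? x y z) (p , r)) (m≤m+n _ _)) (m≤n+m _ ⟦ in? x y z ⟧)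
          go r (yes _) (no p) _ = ≤-trans (≤-trans (≤-trans (1≤⟦⟧ (out? y z x) (p , R-rotate r)) (m≤m+n _ _))
            (m≤n+m _ ⟦ out? x y z ⟧)) (m≤n+m _ ⟦ in? x y z ⟧)
          go r (yes _) (yes _) (no p) = ≤-trans (≤-trans (≤-trans (1≤⟦⟧ (out? z x y) (p , R-rotate (R-rotate r)))
            (m≤n+m _ ⟦ out? y z x ⟧)) (m≤n+m _ ⟦ out? x y z ⟧)) (m≤n+m _ ⟦ in? x y z ⟧)
          go r (yes p) (yes q) (yes t) = ≤-trans (1≤⟦⟧ (in? x y z) (p , q , t , r)) (m≤m+n _ _)
        outside : # S (λ x → ¬? (maj? i x)) ≤ 8 * a
        outside = begin
          # S (λ x → ¬? (maj? i x))
            ≤⟨ #-cover _ (maj? j) (maj? k) S (λ {x} _ → another x) ⟩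
          # S (maj? j) + # S (maj? k)
            ≡⟨ cong₂ _+_ (length-# (maj? j) S) (length-# (maj? k) S) ⟨
          length (Xs j) + length (Xs k)
            ≤⟨ +-mono-≤ (few i j i≢j q≤p) (few i k i≢k r≤p) ⟩
          4 * a + 4 * a
            ≡⟨ lemma′ a ⟩
          8 * a ∎
          where
          lemma′ : ∀ a → 4 * a + 4 * a ≡ 8 * a
          lemma′ = solve-∀
          another : ∀ x → ¬ Maj i x → Maj j x ⊎ Maj k x
          another x ¬p with majority x
          ... | l , q with l ≟ i
          ...   | yes refl = ⊥-elim (¬p q)
          ...   | no l≢i with among i j k i≢j i≢k j≢k l l≢i
          ...     | inj₁ refl = inj₁ q
          ...     | inj₂ refl = inj₂ q
        O≤ : O ≤ 8 * a * (4 * a)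
        O≤ = ≤-trans (∑-mono-∈ S λ {x} x∈ → at x∈ (maj? i x))
          (≤-trans (≤-reflexive (trans (∑-cong S λ x → *-comm ⟦ ¬? (maj? i x) ⟧ (4 * a)) (trans (∑-*ˡ S (4 * a) _) (*-comm (4 * a) _))))
            (*-monoˡ-≤ (4 * a) outside))
          where
          at : ∀ {x} → x ∈ S → (p : Dec (Maj i x)) → (∑ S λ y → # S λ z → ¬? p ×-dec R? x y z) ≤ ⟦ ¬? p ⟧ * (4 * a)
          at x∈ (yes _) = ≤-reflexive (trans (∑-cong S λ _ → ∑-zero S) (∑-zero S))
          at {x} x∈ (no p) = ≤-trans (∑-mono S λ y → #-mono _ (R? x y) S λ _ → proj₂) (≤-trans (triangles-at x∈) (m≤m+n (4 * a) 0))
        lemma″ : ∀ a → 2 * a + 2 * a ≡ 4 * a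
        lemma″ = solve-∀
        uX : Unique X
        uX = unique-filter (maj? i) unique
        sparse : ∀ {u} → u ∈ X → # X (λ x → ¬? (col u x ≟ i)) ≤ 2 * a
        sparse {u} u∈ = ≤-trans (#-filter-≤ (maj? i) (λ x → ¬? (col u x ≟ i)) S)
          (minority′ i j i≢j (filter-⊆ (maj? i) S u∈) (filter-P (maj? i) S u∈))
        small : ∀ {P : V → Set} (P? : Decidable P) → length (filter P? X) ≤ 2 * a + 2 * a → T3 (filter P? X) ≤ Φ
        small P? l = ≤-trans (IH (filter P? X) (unique-filter P? uX) (≤-<-trans l′ 4a<s)) (F-mono l′)
          where l′ = ≤-trans l (≤-reflexive (lemma″ a))
        module Sp = SparseBound col col-sym codegree i j k i≢j i≢k j≢k X uX (2 * a) Φ B Φ<B² sparse small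

      len : Fin 3 → ℕ
      len i = length (Xs i)

      conclude : T3 S ≤ F s
      conclude with ≤-total (len 0F) (len 1F) | ≤-total (len 1F) (len 2F) | ≤-total (len 0F) (len 2F)
      ... | inj₁ p | inj₁ q | _      = sparse-case 2F 0F 1F (λ ()) (λ ()) (λ ()) (≤-trans p q) q
      ... | inj₁ p | inj₂ q | _      = sparse-case 1F 0F 2F (λ ()) (λ ()) (λ ()) p q
      ... | inj₂ p | _      | inj₁ q = sparse-case 2F 0F 1F (λ ()) (λ ()) (λ ()) q (≤-trans p q)
      ... | inj₂ p | _      | inj₂ q = sparse-case 0F 1F 2F (λ ()) (λ ()) (λ ()) p q

    step : T3 S ≤ F s
    step with Any.any? two? S
    ... | yes any = let v , _ , two = find any in cut-case v two
    ... | no none = NoTwo.conclude λ v∈ two → none (lose v∈ two)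

  -- For s ≤ K the trivial bound s² is below Ks ≤ F s. Larger s has bit length at least 7, which
  -- makes the exponent e available.
  bound′ : ∀ S → Unique S → Acc _<_ (length S) → T3 S ≤ F (length S)
  bound′ S unique (acc rec) with length S ≤? K
  ... | yes s≤K = ≤-trans (T3≤s² codegree unique) (≤-trans (*-monoʳ-≤ (length S) s≤K) (F-≥ (length S)))
  ... | no s≰K = large (L (length S)) refl
    where
    64≤s : 2 ^ 6 ≤ length S
    64≤s = ≤-trans (≤-trans (≤ᵇ⇒≤ 64 13392 _) K-cut) (<⇒≤ (≰⇒> s≰K))
    large : ∀ l → L (length S) ≡ l → T3 S ≤ F (length S)
    large zero    eq = ⊥-elim (n≮0 (subst (6 <_) eq (L-> {length S} {6} 64≤s)))
    large (suc k′) eq = Step.step S unique k′ (suc k′ ∸ (δ (suc k′) + 3)) eq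
      (m∸n+n≡m (δ+3≤k (suc k′) (≤-trans (n≤1+n 6) (subst (6 <_) eq (L-> {length S} {6} 64≤s)))))
      (λ S′ u′ lt → bound′ S′ u′ (rec lt))

  bound : ∀ S → Unique S → T3 S ≤ F (length S)
  bound S unique = bound′ S unique (<-wellFounded (length S))

-- From triangles to ordered triples

weigh : {A : Set} → (A → ℕ) → Maybe A → ℕ
weigh f (just x) = f x
weigh f nothing  = 0

∑-mapMaybe : ∀ {A B : Set} (g : A → Maybe B) (f : B → ℕ) xs → ∑ (mapMaybe g xs) f ≡ ∑ xs (λ x → weigh f (g x))
∑-mapMaybe g f []       = refl
∑-mapMaybe g f (x ∷ xs) with g x
... | just y  = cong (f y +_) (∑-mapMaybe g f xs)
... | nothing = ∑-mapMaybe g f xs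

∑-++ : ∀ {A : Set} (xs ys : List A) (f : A → ℕ) → ∑ (xs ++ ys) f ≡ ∑ xs f + ∑ ys f
∑-++ []       ys f = refl
∑-++ (x ∷ xs) ys f = trans (cong (f x +_) (∑-++ xs ys f)) (sym (+-assoc (f x) _ _))

∑-map : ∀ {A B : Set} (g : A → B) xs (f : B → ℕ) → ∑ (map g xs) f ≡ ∑ xs (f ∘ g)
∑-map g []       f = refl
∑-map g (x ∷ xs) f = cong (f (g x) +_) (∑-map g xs f)

∑-cartesianProduct : ∀ {A B : Set} (xs : List A) (ys : List B) (f : A × B → ℕ) →
                     ∑ (cartesianProduct xs ys) f ≡ ∑ xs λ x → ∑ ys λ y → f (x , y)
∑-cartesianProduct []       ys f = refl
∑-cartesianProduct (x ∷ xs) ys f = trans (∑-++ (map (x ,_) ys) _ f)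
  (cong₂ _+_ (∑-map (x ,_) ys f) (∑-cartesianProduct xs ys f))

∑-triangles : ∀ n (f : Triangle n → ℕ) →
              ∑ (triangles n) f ≡ ∑³ (allFin n) λ x y z → weigh f (increasing (x , y , z))
∑-triangles n f = trans (∑-mapMaybe increasing f (cartesianProduct (allFin n) (cartesianProduct (allFin n) (allFin n))))
  (trans (∑-cartesianProduct (allFin n) _ _) (∑-cong (allFin n) λ x → ∑-cartesianProduct (allFin n) (allFin n) _))

module FromEdges {n : ℕ} (c : Edge n → Fin 3) where

  abstract
    col : Fin n → Fin n → Fin 3
    col x y with Fin.<-cmp x y
    ... | tri< p _ _ = c (edge p)
    -- A default value: by `R-distinct` the entries of a rainbow triple are different.
    ... | tri≈ _ _ _ = zero
    ... | tri> _ _ p = c (edge p)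

    col-< : ∀ {x y} (p : x Fin.< y) → col x y ≡ c (edge p)
    col-< {x} {y} p with Fin.<-cmp x y
    ... | tri< _ _ _  = refl
    ... | tri≈ ¬p _ _ = ⊥-elim (¬p p)
    ... | tri> ¬p _ _ = ⊥-elim (¬p p)

    col-> : ∀ {x y} (p : y Fin.< x) → col x y ≡ c (edge p)
    col-> {x} {y} p with Fin.<-cmp x y
    ... | tri< _ _ ¬p = ⊥-elim (¬p p)
    ... | tri≈ _ _ ¬p = ⊥-elim (¬p p)
    ... | tri> _ _ _  = refl

    col-sym : ∀ x y → col x y ≡ col y x
    col-sym x y with Fin.<-cmp x y
    ... | tri< p _ _    = sym (col-> p)
    ... | tri> _ _ p    = sym (col-< p)
    ... | tri≈ _ refl _ with Fin.<-cmp x x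
    ...   | tri< _ ¬e _ = ⊥-elim (¬e refl)
    ...   | tri≈ _ _ _  = refl
    ...   | tri> _ ¬e _ = ⊥-elim (¬e refl)

  open Graph col col-sym public

  Rb : Triangle n → Set
  Rb T = c (xy T) ≢ c (yz T) × c (yz T) ≢ c (xz T) × c (xy T) ≢ c (xz T)

  Rb? : ∀ T → Dec (Rb T)
  Rb? T = ¬? (c (xy T) ≟ c (yz T)) ×-dec ¬? (c (yz T) ≟ c (xz T)) ×-dec ¬? (c (xy T) ≟ c (xz T))

  Rb⇒R : ∀ {x y z} (p : x Fin.< y) (q : y Fin.< z) → Rb (triangle p q) → R x y z
  Rb⇒R {x} {y} {z} p q r rewrite col-< p | col-< q | col-< (Fin.<-trans {i = x} {j = y} {k = z} p q) = r

  R⇒Rb : ∀ {x y z} (p : x Fin.< y) (q : y Fin.< z) → R x y z → Rb (triangle p q)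
  R⇒Rb {x} {y} {z} p q r rewrite col-< p | col-< q | col-< (Fin.<-trans {i = x} {j = y} {k = z} p q) = r

  #Rb≤T3 : # (triangles n) Rb? ≤ T3 (allFin n)
  #Rb≤T3 = ≤-trans (≤-reflexive (∑-triangles n _)) (∑³-mono (allFin n) go)
    where
    go : ∀ x y z → weigh (λ T → ⟦ Rb? T ⟧) (increasing (x , y , z)) ≤ ⟦ R? x y z ⟧
    go x y z with x Fin.<? y | y Fin.<? z
    ... | yes p | yes q = ⟦⟧-mono (Rb? (triangle p q)) (R? x y z) (Rb⇒R p q)
    ... | yes _ | no _  = z≤n
    ... | no _  | _     = z≤n

  Vertex : Fin n → Triangle n → Set
  Vertex w T = w ≡ Triangle.x T ⊎ w ≡ Triangle.y T ⊎ w ≡ Triangle.z T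

  R-distinct : ∀ {x y z} → R x y z → z ≢ x × z ≢ y × x ≢ y
  R-distinct {x} {y} {z} (p , q , r) = (λ { refl → p (col-sym x y) }) , (λ { refl → r refl }) , λ { refl → q refl }

  -- The description of the vertices allows z to be recovered, so different z yield different
  -- triangles sharing the edge.
  realise : ∀ {x y z} (p : x Fin.< y) → R x y z → ∃ λ T → Rb T × edge p ∈ edges T × Vertex z T ×
            (∀ w → Vertex w T → w ≡ x ⊎ w ≡ y ⊎ w ≡ z)
  realise {x} {y} {z} p r with Fin.<-cmp z x | Fin.<-cmp z y
  ... | tri≈ _ e _ | _ = ⊥-elim (proj₁ (R-distinct r) e)
  ... | tri> _ _ _ | tri≈ _ e _ = ⊥-elim (proj₁ (proj₂ (R-distinct r)) e)
  ... | tri< q _ _ | _ = triangle q p , R⇒Rb q p (R-rotate (R-rotate r)) , there (here refl) , inj₁ refl ,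
    λ { w (inj₁ e) → inj₂ (inj₂ e) ; w (inj₂ (inj₁ e)) → inj₁ e ; w (inj₂ (inj₂ e)) → inj₂ (inj₁ e) }
  ... | tri> _ _ q | tri< q′ _ _ = triangle q q′ , R⇒Rb q q′ (R-swap₂ r) , there (there (here refl)) , inj₂ (inj₁ refl) ,
    λ { w (inj₁ e) → inj₁ e ; w (inj₂ (inj₁ e)) → inj₂ (inj₂ e) ; w (inj₂ (inj₂ e)) → inj₂ (inj₁ e) }
  ... | tri> _ _ q | tri> _ _ q′ = triangle p q′ , R⇒Rb p q′ r , here refl , inj₂ (inj₂ refl) , λ _ → id

  module _ (disjoint : ∀ S T → Rb S → Rb T → S ≢ T → ¬ ShareEdge S T) where

    codegree-< : ∀ {x y z z′} → x Fin.< y → R x y z → R x y z′ → z ≡ z′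
    codegree-< {x} {y} {z} {z′} p r r′ with z ≟ z′
    ... | yes e = e
    ... | no z≢z′ with realise p r | realise p r′
    ...   | S , rS , e∈S , _ , only | T , rT , e∈T , z′∈T , _ = ⊥-elim (disjoint S T rS rT S≢T (edge p , e∈S , e∈T))
      where
      S≢T : S ≢ T
      S≢T refl with only z′ z′∈T
      ... | inj₁ e        = proj₁ (R-distinct r′) e
      ... | inj₂ (inj₁ e) = proj₁ (proj₂ (R-distinct r′)) e
      ... | inj₂ (inj₂ e) = z≢z′ (sym e)

    codegree : ∀ {x y z z′} → R x y z → R x y z′ → z ≡ z′
    codegree {x} {y} {z} {z′} r r′ = go (Fin.<-cmp x y)
      where
      go : Tri (x Fin.< y) (x ≡ y) (y Fin.< x) → z ≡ z′
      go (tri< p _ _) = codegree-< p r r′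
      go (tri≈ _ e _) = ⊥-elim (proj₂ (proj₂ (R-distinct r)) e)
      go (tri> _ _ p) = codegree-< p (R-swap₁ r) (R-swap₁ r′)

    #Rb≤F : ∀ K β (constants : Constants K β) → # (triangles n) Rb? ≤ Weight.F K n
    #Rb≤F K β constants = ≤-trans #Rb≤T3 (≤-trans
      (Recursion.bound col col-sym codegree K β constants (allFin n) (Unique.allFin⁺ n))
      (≤-reflexive (cong (Weight.F K) (length-tabulate {n = n} id))))

-- Reduction to three colours

-- Colours are merged into three by conditional expectations; zero means "not yet decided".  A triple of
-- distinct colours stays distinct with probability 2/9, 1/3 or 0 given one, two distinct, two equal values.
expected : Fin 4 → Fin 4 → Fin 4 → ℕ
expected zero zero _ = 2
expected zero _ zero = 2
expected _ zero zero = 2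
expected zero b c with b ≟ c
... | yes _ = 0
... | no _  = 3
expected a zero c with a ≟ c
... | yes _ = 0
... | no _  = 3
expected a b zero with a ≟ b
... | yes _ = 0
... | no _  = 3
expected a b c = 9 * ⟦ ¬? (a ≟ b) ×-dec ¬? (b ≟ c) ×-dec ¬? (a ≟ c) ⟧

over : (Fin 4 → ℕ) → ℕ
over f = f 1F + f 2F + f 3F

average₁? : Dec (∀ b c → over (λ a → expected a b c) ≡ 3 * expected zero b c)
average₁? = all? λ b → all? λ c → _ ℕ.≟ _

average₂? : Dec (∀ a c → over (λ b → expected a b c) ≡ 3 * expected a zero c)
average₂? = all? λ b → all? λ c → _ ℕ.≟ _

average₃? : Dec (∀ a b → over (λ c → expected a b c) ≡ 3 * expected a b zero)
average₃? = all? λ b → all? λ c → _ ℕ.≟ _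

module Merge {T : Set} (α β γ : T → ℕ) (ts : List T)
  (distinct : ∀ {t} → t ∈ ts → α t ≢ β t × β t ≢ γ t × α t ≢ γ t)
  (bound : ℕ) (below : ∀ {t} → t ∈ ts → α t < bound × β t < bound × γ t < bound)
  where

  set : (ℕ → Fin 4) → ℕ → Fin 4 → ℕ → Fin 4
  set ψ m c x with x ℕ.≟ m
  ... | yes _ = c
  ... | no _  = ψ x

  set-≡ : ∀ ψ m c → set ψ m c m ≡ c
  set-≡ ψ m c with m ℕ.≟ m
  ... | yes _ = refl
  ... | no e  = ⊥-elim (e refl)

  set-≢ : ∀ ψ {m} c {x} → x ≢ m → set ψ m c x ≡ ψ x
  set-≢ ψ {m} c {x} ne with x ℕ.≟ m
  ... | yes e = ⊥-elim (ne e)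
  ... | no _  = refl

  value : (ℕ → Fin 4) → T → ℕ
  value ψ t = expected (ψ (α t)) (ψ (β t)) (ψ (γ t))

  over-cong : ∀ {f g} → (∀ a → f a ≡ g a) → over f ≡ over g
  over-cong h = cong₂ _+_ (cong₂ _+_ (h _) (h _)) (h _)

  over-const : ∀ v → over (λ _ → v) ≡ 3 * v
  over-const = lemma
    where
    lemma : ∀ v → v + v + v ≡ 3 * v
    lemma = solve-∀

  -- The three colours of t are different, so a decision on m affects at most one argument of
  -- `expected`.
  average : ∀ ψ m {t} → ψ m ≡ zero → t ∈ ts → over (λ c → value (set ψ m c) t) ≡ 3 * value ψ t
  average ψ m {t} free t∈ = go (distinct t∈) (α t ℕ.≟ m) (β t ℕ.≟ m) (γ t ℕ.≟ m)
    where
    hit : ∀ c {x} → x ≡ m → set ψ m c x ≡ c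
    hit c e = trans (cong (set ψ m c) e) (set-≡ ψ m c)
    cong₃ : ∀ {a a′ b b′ c c′} → a ≡ a′ → b ≡ b′ → c ≡ c′ → expected a b c ≡ expected a′ b′ c′
    cong₃ refl refl refl = refl
    go : α t ≢ β t × β t ≢ γ t × α t ≢ γ t → Dec (α t ≡ m) → Dec (β t ≡ m) → Dec (γ t ≡ m) →
         over (λ c → value (set ψ m c) t) ≡ 3 * value ψ t
    go (a≢b , _ , a≢c) (yes e) _ _ = trans
      (over-cong λ c → cong₃ (hit c e) (set-≢ ψ c λ f → a≢b (trans e (sym f))) (set-≢ ψ c λ f → a≢c (trans e (sym f))))
      (trans (from-yes average₁? (ψ (β t)) (ψ (γ t))) (cong (λ a → 3 * expected a (ψ (β t)) (ψ (γ t))) (sym (trans (cong ψ e) free))))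
    go (_ , b≢c , _) (no ne) (yes e) _ = trans
      (over-cong λ c → cong₃ (set-≢ ψ c ne) (hit c e) (set-≢ ψ c λ f → b≢c (trans e (sym f))))
      (trans (from-yes average₂? (ψ (α t)) (ψ (γ t))) (cong (λ b → 3 * expected (ψ (α t)) b (ψ (γ t))) (sym (trans (cong ψ e) free))))
    go _ (no ne) (no ne′) (yes e) = trans
      (over-cong λ c → cong₃ (set-≢ ψ c ne) (set-≢ ψ c ne′) (hit c e))
      (trans (from-yes average₃? (ψ (α t)) (ψ (β t))) (cong (λ c → 3 * expected (ψ (α t)) (ψ (β t)) c) (sym (trans (cong ψ e) free))))
    go _ (no ne) (no ne′) (no ne″) = trans
      (over-cong λ c → cong₃ (set-≢ ψ c ne) (set-≢ ψ c ne′) (set-≢ ψ c ne″))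
      (over-const (value ψ t))

  best : ∀ (f : Fin 4 → ℕ) {v} → over f ≡ 3 * v → ∃ λ c → c ≢ zero × v ≤ f c
  best f {v} eq with v ≤? f 1F | v ≤? f 2F | v ≤? f 3F
  ... | yes p | _     | _     = _ , (λ ()) , p
  ... | no _  | yes p | _     = _ , (λ ()) , p
  ... | no _  | no _  | yes p = _ , (λ ()) , p
  ... | no p  | no q  | no r  = ⊥-elim (<⇒≢ (≤-trans (+-mono-<-≤ (+-mono-<-≤ (≰⇒> p) (<⇒≤ (≰⇒> q))) (<⇒≤ (≰⇒> r))) (≤-reflexive (over-const v))) eq)

  -- The colours are decided one at a time, always so that the total conditional expectation does
  -- not drop.
  assign : ∀ m → ∃ λ ψ → (∀ x → m ≤ x → ψ x ≡ zero) × (∀ x → x < m → ψ x ≢ zero) × length ts * 2 ≤ ∑ ts (value ψ)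
  assign zero = (λ _ → zero) , (λ _ _ → refl) , (λ _ ()) , ≤-reflexive (sym (∑-const ts 2))
  assign (suc m) with assign m
  ... | ψ , free , fixed , large with best (λ c → ∑ ts (value (set ψ m c))) total
    where
    total : over (λ c → ∑ ts (value (set ψ m c))) ≡ 3 * ∑ ts (value ψ)
    total = begin-equality
      over (λ c → ∑ ts (value (set ψ m c)))
        ≡⟨ trans (∑-+ ts _ _) (cong (_+ ∑ ts (value (set ψ m 3F))) (∑-+ ts _ _)) ⟨
      ∑ ts (λ t → over (λ c → value (set ψ m c) t))
        ≡⟨ ∑-cong-∈ ts (average ψ m (free m ≤-refl)) ⟩
      ∑ ts (λ t → 3 * value ψ t)
        ≡⟨ ∑-*ˡ ts 3 (value ψ) ⟩
      3 * ∑ ts (value ψ) ∎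
      where open ≤-Reasoning
  ... | c , c≢0 , v≤ = set ψ m c , free′ , fixed′ , ≤-trans large v≤
    where
    free′ : ∀ x → suc m ≤ x → set ψ m c x ≡ zero
    free′ x m<x = trans (set-≢ ψ c (≢-sym (<⇒≢ m<x))) (free x (<⇒≤ m<x))
    fixed′ : ∀ x → x < suc m → set ψ m c x ≢ zero
    fixed′ x (s≤s x≤m) with m≤n⇒m<n∨m≡n x≤m
    ... | inj₁ x<m  = λ e → fixed x x<m (trans (sym (set-≢ ψ c (<⇒≢ x<m))) e)
    ... | inj₂ refl = λ e → c≢0 (trans (sym (set-≡ ψ m c)) e)

  pred₃ : Fin 4 → Fin 3
  pred₃ zero    = zero
  pred₃ (suc c) = c

  settled : ∀ a b c → a ≢ zero → b ≢ zero → c ≢ zero →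
            expected a b c ≤ 9 * ⟦ ¬? (pred₃ a ≟ pred₃ b) ×-dec ¬? (pred₃ b ≟ pred₃ c) ×-dec ¬? (pred₃ a ≟ pred₃ c) ⟧
  settled zero    _       _       p _ _ = ⊥-elim (p refl)
  settled (suc _) zero    _       _ p _ = ⊥-elim (p refl)
  settled (suc _) (suc _) zero    _ _ p = ⊥-elim (p refl)
  settled (suc a) (suc b) (suc c) _ _ _ = *-monoʳ-≤ 9 (⟦⟧-mono
    (¬? (suc a ≟ suc b) ×-dec ¬? (suc b ≟ suc c) ×-dec ¬? (suc a ≟ suc c))
    (¬? (a ≟ b) ×-dec ¬? (b ≟ c) ×-dec ¬? (a ≟ c))
    λ (p , q , r) → p ∘ cong suc , q ∘ cong suc , r ∘ cong suc)

  merge : ∃ λ (φ : ℕ → Fin 3) → length ts * 2 ≤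
          9 * # ts (λ t → ¬? (φ (α t) ≟ φ (β t)) ×-dec ¬? (φ (β t) ≟ φ (γ t)) ×-dec ¬? (φ (α t) ≟ φ (γ t)))
  merge = let ψ , _ , fixed , large = assign bound in
    pred₃ ∘ ψ , ≤-trans large (≤-trans
      (∑-mono-∈ ts λ {t} t∈ → let p , q , r = below t∈ in
        settled (ψ (α t)) (ψ (β t)) (ψ (γ t)) (fixed (α t) p) (fixed (β t) q) (fixed (γ t) r))
      (≤-reflexive (∑-*ˡ ts 9 _)))

∑-bound : ∀ {A : Set} (f : A → ℕ) (xs : List A) → ∃ λ b → ∀ {x} → x ∈ xs → f x < b
∑-bound f []       = 0 , λ ()
∑-bound f (x ∷ xs) = let b , h = ∑-bound f xs in suc (f x) + b ,
  λ { (here refl) → m≤m+n _ b ; (there x∈) → ≤-trans (h x∈) (m≤n+m b _) }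

-- Merging creates no rainbow triangle, so the merged colouring is again almost 3-Gallai. The loss
-- of 9/2 is rounded up to 9.
upper-bound : ∀ K β → Constants K β → ∀ {n} (c : Colouring n) → Almost3Gallai c → #rainbow c ≤ 9 * Weight.F K n
upper-bound K β constants {n} c gallai = begin
  #rainbow c
    ≤⟨ m≤m*n _ 2 ⟩
  length ts * 2
    ≤⟨ large ⟩
  9 * # ts Rb?
    ≤⟨ *-monoʳ-≤ 9 (#-filter-≤ (rainbow? c) Rb? (triangles n)) ⟩
  9 * # (triangles n) Rb?
    ≤⟨ *-monoʳ-≤ 9 (#Rb≤F disjoint K β constants) ⟩
  9 * Weight.F K n ∎
  where
  open ≤-Reasoning
  ts = filter (rainbow? c) (triangles n)
  b₁ = ∑-bound (c ∘ xy) ts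
  b₂ = ∑-bound (c ∘ yz) ts
  b₃ = ∑-bound (c ∘ xz) ts
  merged = Merge.merge (c ∘ xy) (c ∘ yz) (c ∘ xz) ts (λ {T} T∈ → filter-P (rainbow? c) (triangles n) T∈)
    (proj₁ b₁ + (proj₁ b₂ + proj₁ b₃))
    λ T∈ → ≤-trans (proj₂ b₁ T∈) (m≤m+n _ _) ,
           ≤-trans (proj₂ b₂ T∈) (≤-trans (m≤m+n _ _) (m≤n+m _ (proj₁ b₁))) ,
           ≤-trans (proj₂ b₃ T∈) (≤-trans (m≤n+m _ (proj₁ b₂)) (m≤n+m _ (proj₁ b₁)))
  φ = proj₁ merged
  large = proj₂ merged
  open FromEdges (φ ∘ c) using (Rb; Rb?; #Rb≤F)
  disjoint : ∀ S T → Rb S → Rb T → S ≢ T → ¬ ShareEdge S T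
  disjoint S T (p , q , r) (p′ , q′ , r′) = gallai S T
    (p ∘ cong φ , q ∘ cong φ , r ∘ cong φ) (p′ ∘ cong φ , q′ ∘ cong φ , r′ ∘ cong φ)

-- Binary digits

odd : ℕ → Bool
odd zero    = false
odd (suc n) = not (odd n)

bit : ℕ → ℕ → Bool
bit zero    n = odd n
bit (suc j) n = bit j ⌊ n /2⌋

half-+ : ∀ n x → ⌊ n + (x + x) /2⌋ ≡ ⌊ n /2⌋ + x
half-+ n zero    = trans (cong ⌊_/2⌋ (+-identityʳ n)) (sym (+-identityʳ _))
half-+ n (suc x) = trans (cong ⌊_/2⌋ (lemma n x)) (trans (cong suc (half-+ n x)) (sym (+-suc _ x)))
  where
  lemma : ∀ n x → n + (suc x + suc x) ≡ suc (suc (n + (x + x)))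
  lemma = solve-∀

odd-+ : ∀ n x → odd (n + (x + x)) ≡ odd n
odd-+ n zero    = cong odd (+-identityʳ n)
odd-+ n (suc x) = trans (cong odd (lemma n x)) (trans (Bool.not-involutive _) (odd-+ n x))
  where
  lemma : ∀ n x → n + (suc x + suc x) ≡ suc (suc (n + (x + x)))
  lemma = solve-∀

half-even : ∀ n → odd n ≡ false → ⌊ suc n /2⌋ ≡ ⌊ n /2⌋
half-even zero          _ = refl
half-even (suc (suc n)) e = cong suc (half-even n (trans (sym (Bool.not-involutive (odd n))) e))

half-half≤ : ∀ n → ⌊ n /2⌋ + ⌊ n /2⌋ ≤ n
half-half≤ zero          = z≤n
half-half≤ (suc zero)    = z≤n
half-half≤ (suc (suc n)) = s≤s (≤-trans (≤-reflexive (+-suc _ _)) (s≤s (half-half≤ n)))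

bit-flip : ∀ j n → bit j (n + 2 ^ j) ≡ not (bit j n)
bit-flip zero    n = cong odd (+-comm n 1)
bit-flip (suc j) n = trans (cong (bit j) (trans (cong (λ t → ⌊ n + t /2⌋) (2*-suc j)) (half-+ n (2 ^ j)))) (bit-flip j ⌊ n /2⌋)

-- Adding to a digit 0 causes no carry.
bit-other : ∀ l j n → bit j n ≡ false → l ≢ j → bit l (n + 2 ^ j) ≡ bit l n
bit-other zero    zero    n _ ne = ⊥-elim (ne refl)
bit-other (suc l) zero    n e ne = cong (bit l) (trans (cong ⌊_/2⌋ (+-comm n 1)) (half-even n e))
bit-other zero    (suc j) n e ne = trans (cong (λ t → odd (n + t)) (2*-suc j)) (odd-+ n (2 ^ j))
bit-other (suc l) (suc j) n e ne = trans (cong (bit l) (trans (cong (λ t → ⌊ n + t /2⌋) (2*-suc j)) (half-+ n (2 ^ j))))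
  (bit-other l j ⌊ n /2⌋ e (ne ∘ cong suc))

bit-≥ : ∀ j n → bit j n ≡ true → 2 ^ j ≤ n
bit-≥ zero    (suc n) _ = s≤s z≤n
bit-≥ (suc j) n       e = ≤-trans (≤-reflexive (2*-suc j))
  (≤-trans (+-mono-≤ (bit-≥ j _ e) (bit-≥ j _ e)) (half-half≤ n))

-- Exactly one of i and i + 2^j has digit 1 in position j, and the range shifted by 2^j contains at
-- most 2^j ones beyond m.
bit# : ∀ j m → m ≤ 2 * Σ< m (λ i → ⟦ bit j i Bool.≟ true ⟧) + 2 ^ j
bit# j m = begin
  m  ≡⟨ trans (Σ<-const m 1) (*-identityʳ m) ⟨
  Σ< m (λ _ → 1)  ≤⟨ Σ<-mono m (λ i _ → ≤-reflexive (sym (one i))) ⟩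
  Σ< m (λ i → b i + b (2 ^ j + i))  ≡⟨ Σ<-+ m b (λ i → b (2 ^ j + i)) ⟩
  Σ< m b + Σ< m (λ i → b (2 ^ j + i))  ≤⟨ +-monoʳ-≤ (Σ< m b) (begin
    Σ< m (λ i → b (2 ^ j + i))  ≤⟨ m≤n+m _ (Σ< (2 ^ j) b) ⟩
    Σ< (2 ^ j) b + Σ< m (λ i → b (2 ^ j + i))  ≡⟨ Σ<-append (2 ^ j) m b ⟨
    Σ< (2 ^ j + m) b  ≡⟨ cong (λ t → Σ< t b) (+-comm (2 ^ j) m) ⟩
    Σ< (m + 2 ^ j) b  ≡⟨ Σ<-append m (2 ^ j) b ⟩
    Σ< m b + Σ< (2 ^ j) (λ i → b (m + i))  ≤⟨ +-monoʳ-≤ (Σ< m b) (≤-trans (Σ<-mono (2 ^ j) λ i _ → ⟦⟧≤1 (bit j (m + i) Bool.≟ true))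
                                                          (≤-reflexive (trans (Σ<-const (2 ^ j) 1) (*-identityʳ _)))) ⟩
    Σ< m b + 2 ^ j  ∎) ⟩
  Σ< m b + (Σ< m b + 2 ^ j)  ≡⟨ lemma (Σ< m b) (2 ^ j) ⟩
  2 * Σ< m b + 2 ^ j  ∎
  where
  open ≤-Reasoning
  b : ℕ → ℕ
  b i = ⟦ bit j i Bool.≟ true ⟧
  lemma : ∀ x y → x + (x + y) ≡ 2 * x + y
  lemma = solve-∀
  exactly-one : ∀ x → ⟦ x Bool.≟ true ⟧ + ⟦ not x Bool.≟ true ⟧ ≡ 1
  exactly-one true  = refl
  exactly-one false = refl
  one : ∀ i → b i + b (2 ^ j + i) ≡ 1
  one i = trans (cong (λ t → b i + ⟦ t Bool.≟ true ⟧) (trans (cong (bit j) (+-comm (2 ^ j) i)) (bit-flip j i))) (exactly-one (bit j i))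

-- The cube colouring

Adjacent : ℕ → ℕ → ℕ → Set
Adjacent k y z = ∃ λ j → j < k × (z ≡ y + 2 ^ j × bit j y ≡ false)

adjacent? : ∀ k y z → Dec (Adjacent k y z)
adjacent? k y z = anyUpTo? (λ j → z ℕ.≟ y + 2 ^ j ×-dec bit j y Bool.≟ false) k

bitColour : Bool → ℕ
bitColour true  = 1
bitColour false = 0

adjacentColour : ∀ {P : Set} → Dec P → ℕ
adjacentColour (yes _) = 2
adjacentColour (no _)  = 0

abstract
  -- Vertices below k are the coordinates of a cube; a vertex v ≥ k carries the binary digits of v ∸ k.
  colour : ℕ → ℕ → ℕ → ℕ
  colour k u v with u <? k | v <? k
  ... | yes _ | yes _ = 0
  ... | yes _ | no _  = bitColour (bit u (v ∸ k))
  ... | no _  | _     = adjacentColour (adjacent? k (u ∸ k) (v ∸ k))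

  colour-low : ∀ {k u v} → u < k → v < k → colour k u v ≡ 0
  colour-low {k} {u} {v} p q with u <? k | v <? k
  ... | yes _ | yes _ = refl
  ... | yes _ | no ¬q = ⊥-elim (¬q q)
  ... | no ¬p | _     = ⊥-elim (¬p p)

  colour-cross : ∀ {k u v} → u < k → k ≤ v → colour k u v ≡ bitColour (bit u (v ∸ k))
  colour-cross {k} {u} {v} p q with u <? k | v <? k
  ... | yes _ | yes r = ⊥-elim (<⇒≱ r q)
  ... | yes _ | no _  = refl
  ... | no ¬p | _     = ⊥-elim (¬p p)

  colour-high : ∀ {k u v} → k ≤ u → colour k u v ≡ adjacentColour (adjacent? k (u ∸ k) (v ∸ k))
  colour-high {k} {u} {v} p with u <? k | v <? k
  ... | yes r | _ = ⊥-elim (<⇒≱ r p)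
  ... | no _  | _ = refl

  colour-three : ∀ k u v → colour k u v ≡ 0 ⊎ colour k u v ≡ 1 ⊎ colour k u v ≡ 2
  colour-three k u v with u <? k | v <? k
  ... | yes _ | yes _ = inj₁ refl
  ... | yes _ | no _ with bit u (v ∸ k)
  ...   | true  = inj₂ (inj₁ refl)
  ...   | false = inj₁ refl
  colour-three k u v | no _ | _ with adjacent? k (u ∸ k) (v ∸ k)
  ...   | yes _ = inj₂ (inj₂ refl)
  ...   | no _  = inj₁ refl

RainbowColours : ℕ → ℕ → ℕ → ℕ → Set
RainbowColours k x y z = colour k x y ≢ colour k y z × colour k y z ≢ colour k x z × colour k x y ≢ colour k x z

-- A coordinate x with an edge of the cube in direction x, lower end first.
Shape : ℕ → ℕ → ℕ → ℕ → Set
Shape k x y z = x < k × k ≤ y × z ≡ y + 2 ^ x × bit x (y ∸ k) ≡ false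

shape-top : ∀ {k x y z} → Shape k x y z → bit x (z ∸ k) ≡ true
shape-top {k} {x} {y} {z} (_ , k≤y , z≡ , b) = begin
  bit x (z ∸ k)  ≡⟨ cong (λ t → bit x (t ∸ k)) z≡ ⟩
  bit x (y + 2 ^ x ∸ k)  ≡⟨ cong (bit x) (+-∸-comm (2 ^ x) k≤y) ⟩
  bit x (y ∸ k + 2 ^ x)  ≡⟨ bit-flip x (y ∸ k) ⟩
  not (bit x (y ∸ k))  ≡⟨ cong not b ⟩
  true  ∎
  where open ≡-Reasoning

shape⇒rainbow : ∀ {k x y z} → Shape k x y z → RainbowColours k x y z
shape⇒rainbow {k} {x} {y} {z} shape@(x<k , k≤y , z≡ , b) =
  (λ e → case trans (sym xy≡0) (trans e yz≡2) of λ ()) ,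
  (λ e → case trans (sym yz≡2) (trans e xz≡1) of λ ()) ,
  (λ e → case trans (sym xy≡0) (trans e xz≡1) of λ ())
  where
  xy≡0 : colour k x y ≡ 0
  xy≡0 = trans (colour-cross x<k k≤y) (cong bitColour b)
  xz≡1 : colour k x z ≡ 1
  xz≡1 = trans (colour-cross x<k (≤-trans k≤y (≤-trans (m≤m+n y _) (≤-reflexive (sym z≡))))) (cong bitColour (shape-top shape))
  yes-colour : ∀ {P : Set} (d : Dec P) → P → adjacentColour d ≡ 2
  yes-colour (yes _) _ = refl
  yes-colour (no ¬p) p = ⊥-elim (¬p p)
  yz≡2 : colour k y z ≡ 2
  yz≡2 = trans (colour-high k≤y) (yes-colour (adjacent? k (y ∸ k) (z ∸ k))
    (x , x<k , trans (cong (_∸ k) z≡) (+-∸-comm (2 ^ x) k≤y) , b))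

-- Without coordinates among the vertices only the colours 0 and 2 occur, and with at least two of
-- them only 0 and 1. So x is the only coordinate, and yz must be an edge of the cube; its ends
-- differ in digit x, which is therefore its direction.
rainbow⇒shape : ∀ {k x y z} → x < y → y < z → RainbowColours k x y z → Shape k x y z
rainbow⇒shape {k} {x} {y} {z} x<y y<z (p , q , r) with x <? k
... | no x≮k = ⊥-elim (clash (adjacent? k _ _) (adjacent? k _ _) (adjacent? k _ _)
        (subst₂ _≢_ xy′ yz′ p) (subst₂ _≢_ yz′ xz′ q) (subst₂ _≢_ xy′ xz′ r))
  where
  k≤x = ≮⇒≥ x≮k
  xy′ = colour-high {k} {x} {y} k≤x
  yz′ = colour-high {k} {y} {z} (≤-trans k≤x (<⇒≤ x<y))
  xz′ = colour-high {k} {x} {z} k≤x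
  clash : ∀ {A B C : Set} (a : Dec A) (b : Dec B) (c : Dec C) → adjacentColour a ≢ adjacentColour b →
          adjacentColour b ≢ adjacentColour c → adjacentColour a ≢ adjacentColour c → ⊥
  clash (yes _) (yes _) _       p q r = p refl
  clash (yes _) (no _)  (yes _) p q r = r refl
  clash (yes _) (no _)  (no _)  p q r = q refl
  clash (no _)  (yes _) (yes _) p q r = q refl
  clash (no _)  (yes _) (no _)  p q r = r refl
  clash (no _)  (no _)  _       p q r = p refl
... | yes x<k with y <? k
...   | yes y<k = ⊥-elim low
  where
  xy′ = colour-low {k} x<k y<k
  clash : ∀ a b → 0 ≢ bitColour a → bitColour a ≢ bitColour b → 0 ≢ bitColour b → ⊥
  clash true  true  p q r = q refl
  clash true  false p q r = r refl
  clash false _     p q r = p refl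
  low : ⊥
  low with z <? k
  ... | yes z<k = p (trans xy′ (sym (colour-low y<k z<k)))
  ... | no z≮k  = clash (bit y (z ∸ k)) (bit x (z ∸ k)) (subst₂ _≢_ xy′ yz′ p) (subst₂ _≢_ yz′ xz′ q) (subst₂ _≢_ xy′ xz′ r)
    where
    yz′ = colour-cross {k} y<k (≮⇒≥ z≮k)
    xz′ = colour-cross {k} x<k (≮⇒≥ z≮k)
...   | no y≮k = conclude (adjacent? k (y ∸ k) (z ∸ k))
        (subst₂ _≢_ xy′ yz′ p) (subst₂ _≢_ yz′ xz′ q) (subst₂ _≢_ xy′ xz′ r)
  where
  k≤y = ≮⇒≥ y≮k
  k≤z = ≤-trans k≤y (<⇒≤ y<z)
  xy′ = colour-cross {k} x<k k≤y
  yz′ = colour-high {k} {y} {z} k≤y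
  xz′ = colour-cross {k} x<k k≤z
  clash : ∀ a b → bitColour a ≢ 0 → 0 ≢ bitColour b → bitColour a ≢ bitColour b → ⊥
  clash true  true  p q r = r refl
  clash true  false p q r = q refl
  clash false _     p q r = p refl
  conclude : (d : Dec (Adjacent k (y ∸ k) (z ∸ k))) → bitColour (bit x (y ∸ k)) ≢ adjacentColour d →
             adjacentColour d ≢ bitColour (bit x (z ∸ k)) → bitColour (bit x (y ∸ k)) ≢ bitColour (bit x (z ∸ k)) → Shape k x y z
  conclude (no _) p q r = ⊥-elim (clash (bit x (y ∸ k)) (bit x (z ∸ k)) p q r)
  conclude (yes (j , j<k , z≡ , b)) p q r with x ℕ.≟ j
  ... | no x≢j   = ⊥-elim (r (cong bitColour (sym (trans (cong (bit x) z≡) (bit-other x j (y ∸ k) b x≢j)))))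
  ... | yes refl = x<k , k≤y , (begin
    z  ≡⟨ m∸n+n≡m k≤z ⟨
    z ∸ k + k  ≡⟨ cong (_+ k) z≡ ⟩
    y ∸ k + 2 ^ x + k  ≡⟨ lemma (y ∸ k) (2 ^ x) k ⟩
    y ∸ k + k + 2 ^ x  ≡⟨ cong (_+ 2 ^ x) (m∸n+n≡m k≤y) ⟩
    y + 2 ^ x  ∎) , b
    where
    open ≡-Reasoning
    lemma : ∀ a b c → a + b + c ≡ a + c + b
    lemma = solve-∀

-- With `L n` coordinates every digit of a number below n is covered, at the expense of about log n
-- vertices.
cube : ∀ n → Colouring n
cube n e = colour (L n) (toℕ (Edge.u e)) (toℕ (Edge.v e))

cube-three : ∀ n → UsesOnlyThreeColours (cube n)
cube-three n = 0 , 1 , 2 , λ e → colour-three (L n) (toℕ (Edge.u e)) (toℕ (Edge.v e))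

2^-injective : ∀ {a b} → 2 ^ a ≡ 2 ^ b → a ≡ b
2^-injective e = ≤-antisym (cancel (≤-reflexive e)) (cancel (≤-reflexive (sym e)))
  where
  cancel : ∀ {a b} → 2 ^ a ≤ 2 ^ b → a ≤ b
  cancel {a} {b} p = ≮⇒≥ λ b<a → <⇒≱ (^-monoʳ-< 2 (s≤s (s≤s z≤n)) b<a) p

triangle-≡ : ∀ {n} (S T : Triangle n) → toℕ (Triangle.x S) ≡ toℕ (Triangle.x T) →
             toℕ (Triangle.y S) ≡ toℕ (Triangle.y T) → toℕ (Triangle.z S) ≡ toℕ (Triangle.z T) → S ≡ T
triangle-≡ (triangle _ _) (triangle _ _) p q r
  with refl ← Fin.toℕ-injective p | refl ← Fin.toℕ-injective q | refl ← Fin.toℕ-injective r = refl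

-- An edge determines its triangle. Coordinates lie below k, and digit x distinguishes the lower
-- from the upper end, so the position of the edge is known; two of x, y and z = y + 2^x then give
-- the third.
cube-gallai : ∀ n → Almost3Gallai (cube n)
cube-gallai n S T rS rT S≢T (e , e∈S , e∈T) = S≢T (go e∈S e∈T)
  where
  k = L n
  shape : ∀ T → Rainbow (cube n) T → Shape k (toℕ (Triangle.x T)) (toℕ (Triangle.y T)) (toℕ (Triangle.z T))
  shape (triangle {x} {y} {z} x<y y<z) r = rainbow⇒shape (recompute-< x<y) (recompute-< y<z) r
    where
    recompute-< : ∀ {a b : Fin n} → .(a Fin.< b) → a Fin.< b
    recompute-< {a} {b} p = recompute (a Fin.<? b) p
  sS = shape S rS
  sT = shape T rT
  x₁ = toℕ (Triangle.x S)
  y₁ = toℕ (Triangle.y S)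
  z₁ = toℕ (Triangle.z S)
  x₂ = toℕ (Triangle.x T)
  y₂ = toℕ (Triangle.y T)
  z₂ = toℕ (Triangle.z T)
  u v : Edge n → ℕ
  u e = toℕ (Edge.u e)
  v e = toℕ (Edge.v e)
  low-high : ∀ {x y} → x ≡ y → x < k → k ≤ y → ⊥
  low-high refl p q = <⇒≱ p q
  k≤z : ∀ {x y z} → Shape k x y z → k ≤ z
  k≤z (_ , k≤y , z≡ , _) = ≤-trans k≤y (≤-trans (m≤m+n _ _) (≤-reflexive (sym z≡)))
  bits : ∀ {x y x′ z′} → x ≡ x′ → y ≡ z′ → bit x (y ∸ k) ≡ false → bit x′ (z′ ∸ k) ≡ true → ⊥
  bits refl refl a b = case trans (sym a) b of λ ()
  same-xy : x₁ ≡ x₂ → y₁ ≡ y₂ → S ≡ T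
  same-xy p q = triangle-≡ S T p q (trans (proj₁ (proj₂ (proj₂ sS))) (trans (cong₂ (λ a b → a + 2 ^ b) q p) (sym (proj₁ (proj₂ (proj₂ sT))))))
  same-xz : x₁ ≡ x₂ → z₁ ≡ z₂ → S ≡ T
  same-xz p q = same-xy p (+-cancelʳ-≡ (2 ^ x₁) y₁ y₂ (trans (sym (proj₁ (proj₂ (proj₂ sS))))
    (trans q (trans (proj₁ (proj₂ (proj₂ sT))) (cong (λ t → y₂ + 2 ^ t) (sym p))))))
  same-yz : y₁ ≡ y₂ → z₁ ≡ z₂ → S ≡ T
  same-yz p q = same-xy (2^-injective (+-cancelˡ-≡ y₁ _ _ (trans (sym (proj₁ (proj₂ (proj₂ sS))))
    (trans q (trans (proj₁ (proj₂ (proj₂ sT))) (cong (_+ 2 ^ x₂) (sym p))))))) p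
  go : e ∈ edges S → e ∈ edges T → S ≡ T
  go (here refl) (here q) = same-xy (cong u q) (cong v q)
  go (here refl) (there (here q)) = ⊥-elim (low-high (cong u q) (proj₁ sS) (proj₁ (proj₂ sT)))
  go (here refl) (there (there (here q))) = ⊥-elim (bits (cong u q) (cong v q) (proj₂ (proj₂ (proj₂ sS))) (shape-top {z = z₂} sT))
  go (there (here refl)) (here q) = ⊥-elim (low-high (sym (cong u q)) (proj₁ sT) (proj₁ (proj₂ sS)))
  go (there (here refl)) (there (here q)) = same-yz (cong u q) (cong v q)
  go (there (here refl)) (there (there (here q))) = ⊥-elim (low-high (sym (cong u q)) (proj₁ sT) (proj₁ (proj₂ sS)))
  go (there (there (here refl))) (here q) = ⊥-elim (bits (sym (cong u q)) (sym (cong v q)) (proj₂ (proj₂ (proj₂ sT))) (shape-top {z = z₁} sS))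
  go (there (there (here refl))) (there (here q)) = ⊥-elim (low-high (cong u q) (proj₁ sS) (proj₁ (proj₂ sT)))
  go (there (there (here refl))) (there (there (here q))) = same-xz (cong u q) (cong v q)

∑-member : ∀ {A : Set} (f : A → ℕ) {xs x} → x ∈ xs → f x ≤ ∑ xs f
∑-member f (here refl) = m≤m+n _ _
∑-member f (there x∈)  = ≤-trans (∑-member f x∈) (m≤n+m _ _)

∑-tabulate : ∀ n {A : Set} (g : Fin n → A) (f : A → ℕ) (h : ℕ → ℕ) → (∀ i → f (g i) ≡ h (toℕ i)) → ∑ (tabulate g) f ≡ Σ< n h
∑-tabulate zero    g f h eq = refl
∑-tabulate (suc n) g f h eq = trans (cong₂ _+_ (eq zero) (∑-tabulate n (g ∘ suc) f (h ∘ suc) (eq ∘ suc)))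
  (sym (Σ<-append 1 n h))

∑-allFin : ∀ n (h : ℕ → ℕ) → ∑ (allFin n) (λ i → h (toℕ i)) ≡ Σ< n h
∑-allFin n h = ∑-tabulate n id (λ i → h (toℕ i)) h λ _ → refl

n<2^n : ∀ n → n < 2 ^ n
n<2^n zero    = z<s
n<2^n (suc n) = ≤-trans (+-mono-≤ (m^n>0 2 n) (n<2^n n)) (≤-reflexive (sym (2*-suc n)))

Top : ℕ → ℕ → ℕ → Set
Top k x z = x < k × k ≤ z × bit x (z ∸ k) ≡ true

top? : ∀ k x z → Dec (Top k x z)
top? k x z = x <? k ×-dec k ≤? z ×-dec bit x (z ∸ k) Bool.≟ true

-- Triangles are indexed by the upper end, since z ∸ 2^x is always a vertex, whereas y + 2^x may lie
-- beyond n.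
top⇒shape : ∀ {k x z} → Top k x z → Shape k x (z ∸ 2 ^ x) z × z ∸ 2 ^ x < z
top⇒shape {k} {x} {z} (x<k , k≤z , b) = (x<k , k≤y , z≡ , falsify) , ∸-monoʳ-< (m^n>0 2 x) 2^x≤z
  where
  p : 2 ^ x ≤ z ∸ k
  p = bit-≥ x (z ∸ k) b
  2^x≤z : 2 ^ x ≤ z
  2^x≤z = ≤-trans p (m∸n≤m z k)
  z≡ : z ≡ z ∸ 2 ^ x + 2 ^ x
  z≡ = sym (m∸n+n≡m 2^x≤z)
  k≤y : k ≤ z ∸ 2 ^ x
  k≤y = +-cancelʳ-≤ (2 ^ x) _ _ (≤-trans (+-monoʳ-≤ k p) (≤-reflexive (trans (m+[n∸m]≡n k≤z) z≡)))
  flipped : bit x (z ∸ k) ≡ not (bit x (z ∸ 2 ^ x ∸ k))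
  flipped = trans (cong (λ t → bit x (t ∸ k)) z≡) (trans (cong (bit x) (+-∸-comm (2 ^ x) k≤y)) (bit-flip x (z ∸ 2 ^ x ∸ k)))
  falsify : bit x (z ∸ 2 ^ x ∸ k) ≡ false
  falsify = trans (sym (Bool.not-involutive _)) (cong not (trans (sym flipped) b))

-- The errors 2^x of `bit#` add up to at most 2^(L n), which is O(n) and hence of lower order than n
-- log n.
cube-lower : ∀ n → L n * (n ∸ L n) ≤ 2 * #rainbow (cube n) + 2 ^ L n
cube-lower n = begin
  k * (n ∸ k)
    ≡⟨ Σ<-const k (n ∸ k) ⟨
  Σ< k (λ _ → n ∸ k)
    ≤⟨ Σ<-mono k (λ x _ → bit# x (n ∸ k)) ⟩
  Σ< k (λ x → 2 * N x + 2 ^ x)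
    ≡⟨ Σ<-+ k (λ x → 2 * N x) (2 ^_) ⟩
  Σ< k (λ x → 2 * N x) + Σ< k (2 ^_)
    ≤⟨ +-mono-≤ (≤-reflexive (double k N)) (geometric k) ⟩
  2 * Σ< k N + 2 ^ k
    ≤⟨ +-monoˡ-≤ (2 ^ k) (*-monoʳ-≤ 2 (begin
         Σ< k N
           ≤⟨ Σ<-mono k shift ⟩
         Σ< k (λ x → Σ< n (λ z → ⟦ top? k x z ⟧))
           ≤⟨ Σ<-monoˡ (λ x → Σ< n (λ z → ⟦ top? k x z ⟧)) k≤n ⟩
         Σ< n (λ x → Σ< n (λ z → ⟦ top? k x z ⟧))
           ≡⟨ ∑-allFin n (λ x → Σ< n (λ z → ⟦ top? k x z ⟧)) ⟨
         (∑ (allFin n) λ x → Σ< n (λ z → ⟦ top? k (toℕ x) z ⟧))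
           ≡⟨ ∑-cong (allFin n) (λ x → ∑-allFin n (λ z → ⟦ top? k (toℕ x) z ⟧)) ⟨
         (∑ (allFin n) λ x → ∑ (allFin n) λ z → ⟦ top? k (toℕ x) (toℕ z) ⟧)
           ≤⟨ ∑-mono (allFin n) (λ x → ∑-mono (allFin n) λ z → witness x z) ⟩
         (∑³ (allFin n) λ x z y → w x y z)
           ≡⟨ ∑³-swap₂ (allFin n) w ⟩
         ∑³ (allFin n) w
           ≡⟨ ∑-triangles n (λ T → ⟦ rainbow? (cube n) T ⟧) ⟨
         # (triangles n) (rainbow? (cube n))
           ≡⟨ length-# (rainbow? (cube n)) (triangles n) ⟨
         #rainbow (cube n) ∎)) ⟩
  2 * #rainbow (cube n) + 2 ^ k ∎
  where
  open ≤-Reasoning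
  k = L n
  k≤n : k ≤ n
  k≤n = L-≤ {n} {n} (n<2^n n)
  N : ℕ → ℕ
  N x = Σ< (n ∸ k) (λ i → ⟦ bit x i Bool.≟ true ⟧)
  double : ∀ k f → Σ< k (λ x → 2 * f x) ≡ 2 * Σ< k f
  double zero    f = refl
  double (suc k) f = trans (cong (_+ 2 * f k) (double k f)) (sym (*-distribˡ-+ 2 (Σ< k f) (f k)))
  geometric : ∀ k → Σ< k (2 ^_) ≤ 2 ^ k
  geometric zero    = z≤n
  geometric (suc k) = ≤-trans (+-monoˡ-≤ (2 ^ k) (geometric k)) (≤-reflexive (sym (2*-suc k)))
  shift : ∀ x → x < k → N x ≤ Σ< n (λ z → ⟦ top? k x z ⟧)
  shift x x<k = begin
    Σ< (n ∸ k) (λ i → ⟦ bit x i Bool.≟ true ⟧)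
      ≤⟨ Σ<-mono (n ∸ k) (λ i _ → ⟦⟧-mono (bit x i Bool.≟ true) (top? k x (k + i))
           λ b → x<k , m≤m+n k i , trans (cong (bit x) (m+n∸m≡n k i)) b) ⟩
    Σ< (n ∸ k) (λ i → ⟦ top? k x (k + i) ⟧)
      ≤⟨ m≤n+m _ _ ⟩
    Σ< k (λ z → ⟦ top? k x z ⟧) + Σ< (n ∸ k) (λ i → ⟦ top? k x (k + i) ⟧)
      ≡⟨ Σ<-append k (n ∸ k) (λ z → ⟦ top? k x z ⟧) ⟨
    Σ< (k + (n ∸ k)) (λ z → ⟦ top? k x z ⟧)
      ≡⟨ cong (λ t → Σ< t (λ z → ⟦ top? k x z ⟧)) (m+[n∸m]≡n k≤n) ⟩
    Σ< n (λ z → ⟦ top? k x z ⟧) ∎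
  w : Fin n → Fin n → Fin n → ℕ
  w x y z = weigh (λ T → ⟦ rainbow? (cube n) T ⟧) (increasing (x , y , z))
  w≥1 : ∀ x y z → x Fin.< y → y Fin.< z → RainbowColours k (toℕ x) (toℕ y) (toℕ z) → 1 ≤ w x y z
  w≥1 x y z p q r with x Fin.<? y | y Fin.<? z
  ... | yes p′ | yes q′ = 1≤⟦⟧ (rainbow? (cube n) (triangle p′ q′)) r
  ... | yes _  | no ¬q  = ⊥-elim (¬q q)
  ... | no ¬p  | _      = ⊥-elim (¬p p)
  witness : ∀ x z → ⟦ top? k (toℕ x) (toℕ z) ⟧ ≤ ∑ (allFin n) λ y → w x y z
  witness x z = ⟦⟧-≤ (top? k (toℕ x) (toℕ z)) λ t →
    let shape , y<z = top⇒shape t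
        y<n = <-trans y<z (Fin.toℕ<n z)
        y = fromℕ< y<n
        eq = Fin.toℕ-fromℕ< y<n
        shape′ = subst (λ y → Shape k (toℕ x) y (toℕ z)) (sym eq) shape
    in ≤-trans (w≥1 x y z (<-≤-trans (proj₁ shape′) (proj₁ (proj₂ shape′))) (subst (_< toℕ z) (sym eq) y<z)
                  (shape⇒rainbow {k} {toℕ x} {toℕ y} {toℕ z} shape′))
               (∑-member (λ y → w x y z) (∈-allFin y))

-- Existence of the maximum

module _ {n : ℕ} where

  edge-≟ : (e f : Edge n) → Dec (e ≡ f)
  edge-≟ (edge {a} {b} p) (edge {a′} {b′} q) with a ≟ a′ | b ≟ b′
  ... | yes refl | yes refl = yes refl
  ... | no ne    | _        = no λ { refl → ne refl }
  ... | yes _    | no ne    = no λ { refl → ne refl }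

  triangle-≟ : (S T : Triangle n) → Dec (S ≡ T)
  triangle-≟ (triangle {x} {y} {z} p q) (triangle {x′} {y′} {z′} p′ q′) with x ≟ x′ | y ≟ y′ | z ≟ z′
  ... | yes refl | yes refl | yes refl = yes refl
  ... | no ne    | _        | _        = no λ { refl → ne refl }
  ... | yes _    | no ne    | _        = no λ { refl → ne refl }
  ... | yes _    | yes _    | no ne    = no λ { refl → ne refl }

  shareEdge? : ∀ S T → Dec (ShareEdge {n} S T)
  shareEdge? S T = map′ find (λ (_ , e∈S , e∈T) → lose e∈S e∈T)
    (Any.any? (λ e → Any.any? (edge-≟ e) (edges T)) (edges S))

  allTriangles? : ∀ {P : Triangle n → Set} → Decidable P → Dec (∀ T → P T)
  allTriangles? {P} P? = map′
    (λ { h (triangle {x} {y} {z} p q) → h x y z (recompute (x Fin.<? y) p) (recompute (y Fin.<? z) q) })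
    (λ h x y z p q → h (triangle p q))
    (all? λ x → all? λ y → all? λ z → at x y z)
    where
    at : ∀ x y z → Dec ((p : x Fin.< y) (q : y Fin.< z) → P (triangle p q))
    at x y z with x Fin.<? y | y Fin.<? z
    ... | no ¬p | _     = yes λ p → ⊥-elim (¬p p)
    ... | yes _ | no ¬q = yes λ _ q → ⊥-elim (¬q q)
    ... | yes p | yes q = map′ (λ h _ _ → h) (λ h → h p q) (P? (triangle p q))

  almost3Gallai? : ∀ (c : Colouring n) → Dec (Almost3Gallai c)
  almost3Gallai? c = allTriangles? λ S → allTriangles? λ T →
    rainbow? c S →-dec rainbow? c T →-dec ¬? (triangle-≟ S T) →-dec ¬? (shareEdge? S T)

  -- Being rainbow depends only on which edges have equal colours, so colourings that refine each
  -- other have the same rainbow triangles.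
  Refines : Colouring n → Colouring n → Set
  Refines c c′ = ∀ e f → c e ≡ c f → c′ e ≡ c′ f

  rainbow-refines : ∀ {c c′} → Refines c c′ → ∀ T → Rainbow c′ T → Rainbow c T
  rainbow-refines r T (p , q , s) = p ∘ r _ _ , q ∘ r _ _ , s ∘ r _ _

  gallai-refines : ∀ {c c′} → Refines c c′ → Almost3Gallai c → Almost3Gallai c′
  gallai-refines r g S T rS rT = g S T (rainbow-refines r S rS) (rainbow-refines r T rT)

  #rainbow-refines : ∀ {c c′} → Refines c c′ → #rainbow c′ ≤ #rainbow c
  #rainbow-refines {c} {c′} r = ≤-trans (≤-reflexive (length-# (rainbow? c′) (triangles n)))
    (≤-trans (#-mono (rainbow? c′) (rainbow? c) (triangles n) λ {T} _ → rainbow-refines r T)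
             (≤-reflexive (sym (length-# (rainbow? c) (triangles n)))))

-- Renames a colour to the least index carrying it, so that k names suffice for arbitrary natural
-- numbers.
first : ∀ {k} → (Fin k → ℕ) → Fin k → Fin k
first {suc k} g zero    = zero
first {suc k} g (suc i) with g (suc i) ℕ.≟ g zero
... | yes _ = zero
... | no _  = suc (first (g ∘ suc) i)

first-value : ∀ {k} (g : Fin k → ℕ) i → g (first g i) ≡ g i
first-value {suc k} g zero    = refl
first-value {suc k} g (suc i) with g (suc i) ℕ.≟ g zero
... | yes e = sym e
... | no _  = first-value (g ∘ suc) i

first-cong : ∀ {k} (g : Fin k → ℕ) i j → g i ≡ g j → first g i ≡ first g j
first-cong {suc k} g zero    zero    e = refl
first-cong {suc k} g zero    (suc j) e with g (suc j) ℕ.≟ g zero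
... | yes _ = refl
... | no ne = ⊥-elim (ne (sym e))
first-cong {suc k} g (suc i) zero    e with g (suc i) ℕ.≟ g zero
... | yes _ = refl
... | no ne = ⊥-elim (ne e)
first-cong {suc k} g (suc i) (suc j) e with g (suc i) ℕ.≟ g zero | g (suc j) ℕ.≟ g zero
... | yes _ | yes _ = refl
... | yes p | no ne = ⊥-elim (ne (trans (sym e) p))
... | no ne | yes p = ⊥-elim (ne (trans e p))
... | no _  | no _  = cong suc (first-cong (g ∘ suc) i j e)

anyVec? : ∀ {m} k {P : Vec (Fin m) k → Set} → Decidable P → Dec (∃ P)
anyVec? zero    P? = map′ (λ p → [] , p) (λ { ([] , p) → p }) (P? [])
anyVec? (suc k) P? = map′ (λ (x , v , p) → x ∷ v , p) (λ { (x ∷ v , p) → x , v , p })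
  (any? λ x → anyVec? k λ v → P? (x ∷ v))

maximum : ∀ {P : ℕ → Set} → Decidable P → ∀ b → (∀ t → P t → t ≤ b) → ∃ P → ∃ λ t → P t × (∀ t′ → P t′ → t′ ≤ t)
maximum {P} P? zero h (t , p) with P? zero
... | yes p₀ = zero , p₀ , h
... | no ¬p  = ⊥-elim (¬p (subst P (n≤0⇒n≡0 (h t p)) p))
maximum P? (suc b) h e with P? (suc b)
... | yes p = suc b , p , h
... | no ¬p = maximum P? b (λ t p → ≤-pred (≤∧≢⇒< (h t p) λ { refl → ¬p p })) e

module _ (n : ℕ) where

  palette-size = n * n

  decode : Vec (Fin palette-size) palette-size → Colouring n
  decode v e = toℕ (lookup v (combine (Edge.u e) (Edge.v e)))

  module _ (c : Colouring n) where
    private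
      at : Fin n × Fin n → ℕ
      at (a , b) with a Fin.<? b
      ... | yes p = c (edge p)
      -- Pairs that are not increasing share a dummy colour. An edge of colour 0 may be named after
      -- such a pair, which still separates it from the other colours.
      ... | no _  = 0

      g : Fin palette-size → ℕ
      g i = at (remQuot n i)

      code : Vec (Fin palette-size) palette-size
      code = Vec.tabulate (first g)

      at-edge : ∀ e → at (Edge.u e , Edge.v e) ≡ c e
      at-edge (edge {a} {b} p) with a Fin.<? b
      ... | yes _ = refl
      ... | no ¬p = ⊥-elim (¬p (recompute (a Fin.<? b) p))

      g-edge : ∀ e → g (combine (Edge.u e) (Edge.v e)) ≡ c e
      g-edge e = trans (cong at (Fin.remQuot-combine (Edge.u e) (Edge.v e))) (at-edge e)

      decode-code : ∀ e → decode code e ≡ toℕ (first g (combine (Edge.u e) (Edge.v e)))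
      decode-code e = cong toℕ (lookup∘tabulate (first g) _)

    encoded : ∃ λ v → Refines c (decode v) × Refines (decode v) c
    encoded = code , finer , coarser
      where
      finer : Refines c (decode code)
      finer e f eq = trans (decode-code e) (trans (cong toℕ (first-cong g _ _ (trans (g-edge e) (trans eq (sym (g-edge f)))))) (sym (decode-code f)))
      coarser : Refines (decode code) c
      coarser e f eq = trans (sym (value e)) (trans (cong g (Fin.toℕ-injective (trans (sym (decode-code e)) (trans eq (decode-code f))))) (value f))
        where
        value : ∀ e → g (first g (combine (Edge.u e) (Edge.v e))) ≡ c e
        value e = trans (first-value g _) (g-edge e)

  Attained : ℕ → Set
  Attained t = ∃ λ v → Almost3Gallai (decode v) × #rainbow (decode v) ≡ t

  attained? : Decidable Attained
  attained? t = anyVec? palette-size λ v → almost3Gallai? (decode v) ×-dec (#rainbow (decode v) ℕ.≟ t)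

  attain : ∀ c → Almost3Gallai c → Attained (#rainbow c)
  attain c gallai = let v , finer , coarser = encoded c in
    v , gallai-refines finer gallai , ≤-antisym (#rainbow-refines finer) (#rainbow-refines coarser)

  -- Whether a value is attained is decided by a search through finitely many codes, so the maximum
  -- is found constructively. The constant colouring starts the search.
  maxRainbow : ∃ (IsMaxRainbow n)
  maxRainbow = let t , (v , gallai , eq) , largest = maximum attained? (length (triangles n)) small inhabited in
    t , (decode v , gallai , eq) , λ c g → largest _ (attain c g)
    where
    small : ∀ t → Attained t → t ≤ length (triangles n)
    small t (v , _ , eq) = subst (_≤ length (triangles n)) eq (length-filter (rainbow? (decode v)) (triangles n))
    inhabited : ∃ Attained
    inhabited = _ , attain (λ _ → 0) λ S T r → ⊥-elim (proj₁ r refl)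

-- Passage to the real bounds

open import Data.Integer using (+_)

frac-≤ : ∀ {a b c d} → a * suc d ≤ c * suc b → mkℚᵘ (+ a) b ℚ.≤ mkℚᵘ (+ c) d
frac-≤ {a} {b} {c} {d} p = *≤* (subst₂ ℤ._≤_ (ℤ.pos-* a (suc d)) (ℤ.pos-* c (suc b)) (+≤+ p))

frac-< : ∀ {a b c d} → a * suc d < c * suc b → mkℚᵘ (+ a) b ℚ.< mkℚᵘ (+ c) d
frac-< {a} {b} {c} {d} p = *<* (subst₂ ℤ._<_ (ℤ.pos-* a (suc d)) (ℤ.pos-* c (suc b)) (+<+ p))

frac-* : ∀ a b c d → mkℚᵘ (+ a) b ℚ.* mkℚᵘ (+ c) d ≡ mkℚᵘ (+ (a * c)) (d + b * suc d)
frac-* a b c d = cong (λ t → mkℚᵘ t (d + b * suc d)) (sym (ℤ.pos-* a c))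

⊔-lub-< : ∀ p q {r} → p ℚ.< r → q ℚ.< r → p ℚ.⊔ q ℚ.< r
⊔-lub-< p q p<r q<r with ℚ.⊔-sel p q
... | inj₁ e = ℚ.<-respˡ-≃ (ℚ.≃-sym e) p<r
... | inj₂ e = ℚ.<-respˡ-≃ (ℚ.≃-sym e) q<r

-- With k = 16 + j this reads k(k + 9) ≤ 2^(k - 1). For k the bit length of n the right side is at
-- most n, so n absorbs the squares of logarithms.
k²≤2^k : ∀ j → (16 + j) * (25 + j) ≤ 2 ^ (15 + j)
k²≤2^k zero    = ≤ᵇ⇒≤ 400 32768 _
k²≤2^k (suc j) = begin
  (16 + suc j) * (25 + suc j)  ≤⟨ m≤m+n _ (358 + 39 * j + j * j) ⟩
  (16 + suc j) * (25 + suc j) + (358 + 39 * j + j * j)  ≡⟨ lemma j ⟩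
  (16 + j) * (25 + j) + (16 + j) * (25 + j)  ≤⟨ +-mono-≤ (k²≤2^k j) (k²≤2^k j) ⟩
  2 ^ (15 + j) + 2 ^ (15 + j)  ≡⟨ 2*-suc (15 + j) ⟨
  2 ^ suc (15 + j)  ≡⟨ cong (2 ^_) (+-suc 15 j) ⟨
  2 ^ (15 + suc j)  ∎
  where
  open ≤-Reasoning
  lemma : ∀ j → (16 + (1 + j)) * (25 + (1 + j)) + (358 + 39 * j + j * j) ≡ (16 + j) * (25 + j) + (16 + j) * (25 + j)
  lemma = solve-∀

module _ (f n q′ : ℕ) where
  private
    q = suc q′
    k = L n
    m = n ∸ k

  -- Up to the factor 4q this is f ≥ (1/2 - 1/(4q))(n + 1)k. Passing from 2q to 2q - 1 sets aside
  -- one km, which covers the terms of orders qn and qk² because 16q ≤ k.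
  half-n-log-n : 2 ^ (16 * q) ≤ n → k * m ≤ 2 * f + 2 ^ k → suc (2 * q′) * suc n * k ≤ f * (4 * q)
  half-n-log-n n≥ lower = +-cancelʳ-≤ (2 * q * 2 ^ k) _ _ (begin
    suc (2 * q′) * suc n * k + 2 * q * 2 ^ k
      ≤⟨ +-mono-≤ (*-monoˡ-≤ k (*-monoʳ-≤ (suc (2 * q′)) (s≤s (≤-reflexive (sym m+k≡n))))) (*-monoʳ-≤ (2 * q) 2^k≤) ⟩
    suc (2 * q′) * suc (m + k) * k + 2 * q * (2 * (m + k))
      ≤⟨ main ⟩
    2 * q * (k * m)
      ≤⟨ *-monoʳ-≤ (2 * q) lower ⟩
    2 * q * (2 * f + 2 ^ k)
      ≡⟨ lemma₀ q f (2 ^ k) ⟩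
    f * (4 * q) + 2 * q * 2 ^ k ∎)
    where
    open ≤-Reasoning
    lemma₀ : ∀ q f t → 2 * q * (2 * f + t) ≡ f * (4 * q) + 2 * q * t
    lemma₀ = solve-∀
    16q≤k : 16 * q ≤ k
    16q≤k = <⇒≤ (L-> {n} {16 * q} n≥)
    16≤k : 16 ≤ k
    16≤k = ≤-trans (*-monoʳ-≤ 16 (s≤s z≤n)) 16q≤k
    k′ = k ∸ 1
    k≡ : k ≡ suc k′
    k≡ = sym (m+[n∸m]≡n (≤-trans (s≤s z≤n) 16≤k))
    2^k′≤n : 2 ^ k′ ≤ n
    2^k′≤n = L-least n k′ k≡
    k≤n : k ≤ n
    k≤n = ≤-trans (≤-trans (m≤m*n k (9 + k)) square) 2^k′≤n
      where
      square : k * (9 + k) ≤ 2 ^ k′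
      square = subst₂ (λ a b → a * (9 + a) ≤ 2 ^ b) (m+[n∸m]≡n 16≤k) (cong (_∸ 1) (m+[n∸m]≡n 16≤k)) (k²≤2^k (k ∸ 16))
    m+k≡n : m + k ≡ n
    m+k≡n = m∸n+n≡m k≤n
    square′ : k * (8 + k) ≤ m
    square′ = +-cancelʳ-≤ k _ _ (begin
      k * (8 + k) + k   ≡⟨ lemma k ⟩
      k * (9 + k)  ≤⟨ subst₂ (λ a b → a * (9 + a) ≤ 2 ^ b) (m+[n∸m]≡n 16≤k) (cong (_∸ 1) (m+[n∸m]≡n 16≤k)) (k²≤2^k (k ∸ 16)) ⟩
      2 ^ k′  ≤⟨ 2^k′≤n ⟩
      n  ≡⟨ m+k≡n ⟨
      m + k  ∎)
      where
      lemma : ∀ k → k * (8 + k) + k ≡ k * (9 + k)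
      lemma = solve-∀
    2^k≤ : 2 ^ k ≤ 2 * (m + k)
    2^k≤ = ≤-trans (≤-reflexive (cong (2 ^_) k≡)) (*-monoʳ-≤ 2 (≤-trans 2^k′≤n (≤-reflexive (sym m+k≡n))))
    main : suc (2 * q′) * suc (m + k) * k + 2 * q * (2 * (m + k)) ≤ 2 * q * (k * m)
    main = begin
      suc (2 * q′) * suc (m + k) * k + 2 * q * (2 * (m + k))
        ≡⟨ lemma₁ q′ m k ⟩
      suc (2 * q′) * (k * m) + (suc (2 * q′) * (k * suc k) + 4 * q * (m + k))
        ≤⟨ +-monoʳ-≤ (suc (2 * q′) * (k * m)) rest ⟩
      suc (2 * q′) * (k * m) + k * m
        ≡⟨ lemma₂ q′ (k * m) ⟩
      2 * q * (k * m) ∎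
      where
      lemma₁ : ∀ q m k → (1 + 2 * q) * (1 + (m + k)) * k + 2 * (1 + q) * (2 * (m + k)) ≡
               (1 + 2 * q) * (k * m) + ((1 + 2 * q) * (k * (1 + k)) + 4 * (1 + q) * (m + k))
      lemma₁ = solve-∀
      lemma₂ : ∀ q t → (1 + 2 * q) * t + t ≡ 2 * (1 + q) * t
      lemma₂ = solve-∀
      rest : suc (2 * q′) * (k * suc k) + 4 * q * (m + k) ≤ k * m
      rest = *-cancelˡ-≤ 8 (begin
        8 * (suc (2 * q′) * (k * suc k) + 4 * q * (m + k))
          ≤⟨ *-monoʳ-≤ 8 (+-monoˡ-≤ (4 * q * (m + k)) (*-monoˡ-≤ (k * suc k) (≤-trans (n≤1+n _) (≤-reflexive (lemma₃ q′))))) ⟩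
        8 * (2 * q * (k * suc k) + 4 * q * (m + k))
          ≡⟨ lemma₄ q k m ⟩
        16 * q * (k * suc k) + 2 * (16 * q) * (m + k)
          ≤⟨ +-mono-≤ (*-monoˡ-≤ (k * suc k) 16q≤k) (*-monoˡ-≤ (m + k) (*-monoʳ-≤ 2 16q≤k)) ⟩
        k * (k * suc k) + 2 * k * (m + k)
          ≡⟨ lemma₅ k m ⟩
        k * (k * (3 + k)) + 2 * (k * m)
          ≤⟨ +-monoˡ-≤ (2 * (k * m)) (*-monoʳ-≤ k (≤-trans (*-monoʳ-≤ k (+-monoˡ-≤ k (s≤s (s≤s (s≤s (z≤n {5})))))) square′)) ⟩
        k * m + 2 * (k * m)
          ≤⟨ m≤m+n _ (5 * (k * m)) ⟩
        k * m + 2 * (k * m) + 5 * (k * m)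
          ≡⟨ lemma₆ (k * m) ⟩
        8 * (k * m) ∎)
        where
        lemma₃ : ∀ q → 2 + 2 * q ≡ 2 * (1 + q)
        lemma₃ = solve-∀
        lemma₄ : ∀ q k m → 8 * (2 * q * (k * (1 + k)) + 4 * q * (m + k)) ≡ 16 * q * (k * (1 + k)) + 2 * (16 * q) * (m + k)
        lemma₄ = solve-∀
        lemma₅ : ∀ k m → k * (k * (1 + k)) + 2 * k * (m + k) ≡ k * (k * (3 + k)) + 2 * (k * m)
        lemma₅ = solve-∀
        lemma₆ : ∀ t → t + 2 * t + 5 * t ≡ 8 * t
        lemma₆ = solve-∀

at-least : ∀ (f : ℕ → ℕ) → (∀ n → L n * (n ∸ L n) ≤ 2 * f n + 2 ^ L n) → AtLeastHalfNLogN f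
at-least f lower (mkℚᵘ (+ 0) _)       (*<* (+<+ ()))
at-least f lower (mkℚᵘ -[1+ _ ] _)    (*<* ())
at-least f lower ε@(mkℚᵘ (+ (suc p′)) q′) 0<ε = 2 ^ (16 * suc q′) , bound
  where
  -- With q = q′ + 1 the denominator of ε, A is (2q - 1)/(4q) = 1/2 - 1/(4q), above 1/2 - ε because
  -- ε ≥ 1/q.
  A : ℚᵘ
  A = mkℚᵘ (+ suc (2 * q′)) (3 + 4 * q′)
  ½<A+ε : ℚ.½ ℚ.< A ℚ.+ ε
  ½<A+ε = fraction-< (*<* (+<+ z<s)) 1 (≤-trans (m<m+n _ {(1 + q′) * (6 + 8 * p′)} z<s) (≤-reflexive (lemma p′ q′)))
    where
    lemma : ∀ p q → 1 * ((4 + 4 * q) * (1 + q)) + (1 + q) * (6 + 8 * p) ≡ ((1 + 2 * q) * (1 + q) + (1 + p) * (4 + 4 * q)) * 2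
    lemma = solve-∀
  ½-ε<A : ℚ.½ ℚ.- ε ℚ.< A
  ½-ε<A = ℚ.<-respʳ-≃ cancel (ℚ.+-monoˡ-< (ℚ.- ε) ½<A+ε)
    where
    cancel : A ℚ.+ ε ℚ.- ε ℚ.≃ A
    cancel = ℚ.≃-trans (ℚ.+-assoc A ε (ℚ.- ε)) (ℚ.≃-trans (ℚ.+-congʳ A (ℚ.+-inverseʳ ε)) (ℚ.+-identityʳ A))
  bound : ∀ n → 2 ^ (16 * suc q′) ≤ n → fromℚ (ℚ.½ ℚ.- ε) *ʳ fromℕ n *ʳ log₂ n ≤ʳ fromℕ (f n)
  -- A product lies below r once rationals strictly above its factors have product at most r. Those
  -- taken here are A, n + 1 and L n.
  bound n n≥ r f<r = A ℚ.* N₁ , κ , (A , N₁ , ⊔-lub-< 0ℚᵘ (ℚ.½ ℚ.- ε) (*<* (+<+ z<s)) ½-ε<A , above , ℚ.≤-refl) ,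
    (fraction-positive 0 1≤k , subst (_< 2 ^ k) (sym (*-identityʳ n)) (n<2^L n)) ,
    ℚ.≤-trans product (ℚ.≤-trans (ℚ.p≤q⊔p 0ℚᵘ (mkℚᵘ (+ f n) 0)) (ℚ.<⇒≤ f<r))
    where
    k = L n
    N₁ κ : ℚᵘ
    N₁ = mkℚᵘ (+ suc n) 0
    κ = mkℚᵘ (+ k) 0
    1≤k : 0 < k
    1≤k = ≤-<-trans z≤n (L-> {n} {16 * suc q′} n≥)
    above : 0ℚᵘ ℚ.⊔ mkℚᵘ (+ n) 0 ℚ.< N₁
    above = ⊔-lub-< 0ℚᵘ (mkℚᵘ (+ n) 0) (*<* (+<+ z<s)) (frac-< (*-monoˡ-< 1 (n<1+n n)))
    product : A ℚ.* N₁ ℚ.* κ ℚ.≤ mkℚᵘ (+ f n) 0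
    product = subst (ℚ._≤ mkℚᵘ (+ f n) 0)
      (sym (trans (cong (ℚ._* κ) (frac-* (suc (2 * q′)) (3 + 4 * q′) (suc n) 0)) (frac-* (suc (2 * q′) * suc n) ((3 + 4 * q′) * 1) k 0)))
      (frac-≤ (begin
        suc (2 * q′) * suc n * k * 1  ≡⟨ *-identityʳ _ ⟩
        suc (2 * q′) * suc n * k  ≤⟨ half-n-log-n (f n) n q′ n≥ (lower n) ⟩
        f n * (4 * suc q′)  ≡⟨ cong (f n *_) (lemma q′) ⟩
        f n * suc ((3 + 4 * q′) * 1 * 1)  ∎))
      where
      open ≤-Reasoning
      lemma : ∀ q → 4 * (1 + q) ≡ 1 + (3 + 4 * q) * 1 * 1
      lemma = solve-∀

module _ {n k′ : ℕ} (L-eq : L n ≡ suc k′) where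
  private
    k = suc k′
    E = k + δ k
    2^k′≤n = L-least n k′ L-eq
    n≥1 : 1 ≤ n
    n≥1 = ≤-trans (m^n>0 2 k′) 2^k′≤n

  -- In real terms 2^E ≤ 16 n^(p/q) for p/q > √2, from E ≤ √2(k + 1) and 2^(k + 1) ≤ 4n. For p ≤ 2q
  -- the lost factor is 4^(p/q) ≤ 16; for larger p the exponent 2 is used in place of p/q to keep
  -- the constant.
  dyadic-power : ∀ p q → 2 * q ^ 2 < p ^ 2 → (2 ^ E) ^ q ≤ 16 ^ q * n ^ p
  dyadic-power p q √2<p/q with ≤-total p (2 * q)
  ... | inj₁ p≤2q = begin
    (2 ^ E) ^ q  ≡⟨ ^-*-assoc 2 E q ⟩
    2 ^ (E * q)  ≤⟨ ^-monoʳ-≤ 2 Eq≤ ⟩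
    2 ^ ((2 + k′) * p)  ≡⟨ ^-*-assoc 2 (2 + k′) p ⟨
    (2 ^ (2 + k′)) ^ p  ≡⟨ cong (_^ p) (^-distribˡ-+-* 2 2 k′) ⟩
    (4 * 2 ^ k′) ^ p  ≡⟨ ^-distribʳ-* 4 (2 ^ k′) p ⟩
    4 ^ p * (2 ^ k′) ^ p  ≤⟨ *-mono-≤ (^-monoʳ-≤ 4 p≤2q) (^-monoˡ-≤ p 2^k′≤n) ⟩
    4 ^ (2 * q) * n ^ p  ≡⟨ cong (_* n ^ p) (^-*-assoc 4 2 q) ⟨
    16 ^ q * n ^ p  ∎
    where
    open ≤-Reasoning
    Eq≤ : E * q ≤ (2 + k′) * p
    Eq≤ = square-cancel-≤ (begin
      E * q * (E * q)  ≡⟨ lemma₁ E q ⟩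
      E * E * (q * q)  ≤⟨ *-monoˡ-≤ (q * q) (δ-upper k) ⟩
      2 * (suc k * suc k) * (q * q)  ≡⟨ lemma₂ (suc k) q ⟩
      suc k * suc k * (2 * q ^ 2)  ≤⟨ *-monoʳ-≤ (suc k * suc k) (<⇒≤ √2<p/q) ⟩
      suc k * suc k * p ^ 2  ≡⟨ lemma₃ (suc k) p ⟩
      (2 + k′) * p * ((2 + k′) * p)  ∎)
      where
      lemma₁ : ∀ e q → e * q * (e * q) ≡ e * e * (q * q)
      lemma₁ = solve-∀
      lemma₂ : ∀ k q → 2 * (k * k) * (q * q) ≡ k * k * (2 * (q * (q * 1)))
      lemma₂ = solve-∀
      lemma₃ : ∀ k p → k * k * (p * (p * 1)) ≡ k * p * (k * p)
      lemma₃ = solve-∀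
  ... | inj₂ 2q≤p = begin
    (2 ^ E) ^ q  ≤⟨ ^-monoˡ-≤ q (^-monoʳ-≤ 2 E≤) ⟩
    (2 ^ ((2 + k′) * 2)) ^ q  ≡⟨ cong (_^ q) (^-*-assoc 2 (2 + k′) 2) ⟨
    ((2 ^ (2 + k′)) ^ 2) ^ q  ≡⟨ cong (λ t → (t ^ 2) ^ q) (^-distribˡ-+-* 2 2 k′) ⟩
    ((4 * 2 ^ k′) ^ 2) ^ q  ≤⟨ ^-monoˡ-≤ q (^-monoˡ-≤ 2 (*-monoʳ-≤ 4 2^k′≤n)) ⟩
    ((4 * n) ^ 2) ^ q  ≡⟨ cong (_^ q) (^-distribʳ-* 4 n 2) ⟩
    (16 * n ^ 2) ^ q  ≡⟨ ^-distribʳ-* 16 (n ^ 2) q ⟩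
    16 ^ q * (n ^ 2) ^ q  ≡⟨ cong (16 ^ q *_) (^-*-assoc n 2 q) ⟩
    16 ^ q * n ^ (2 * q)  ≤⟨ *-monoʳ-≤ (16 ^ q) (^-monoʳ-≤ n {{ℕ.>-nonZero n≥1}} 2q≤p) ⟩
    16 ^ q * n ^ p  ∎
    where
    open ≤-Reasoning
    E≤ : E ≤ (2 + k′) * 2
    E≤ = square-cancel-≤ (≤-trans (δ-upper k) (≤-trans (m≤m+n _ (2 * (suc k * suc k))) (≤-reflexive (lemma (suc k)))))
      where
      lemma : ∀ k → 2 * (k * k) + 2 * (k * k) ≡ k * 2 * (k * 2)
      lemma = solve-∀

  power-above : ∀ p q → 2 * q ^ 2 < p ^ 2 → ∀ {x y} → n ^ p * y ^ q < x ^ q → 2 ^ E * y < 16 * x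
  power-above p q √2<p/q {x} {y} above = ^-cancelˡ-< q (begin-strict
    (2 ^ E * y) ^ q  ≡⟨ ^-distribʳ-* (2 ^ E) y q ⟩
    (2 ^ E) ^ q * y ^ q  ≤⟨ *-monoˡ-≤ (y ^ q) (dyadic-power p q √2<p/q) ⟩
    16 ^ q * n ^ p * y ^ q  ≡⟨ *-assoc (16 ^ q) (n ^ p) (y ^ q) ⟩
    16 ^ q * (n ^ p * y ^ q)  <⟨ *-monoʳ-< (16 ^ q) {{m^n≢0 16 q}} above ⟩
    16 ^ q * x ^ q  ≡⟨ ^-distribʳ-* 16 x q ⟨
    (16 * x) ^ q  ∎)
    where open ≤-Reasoning

  -- Since n ≥ 2^k′, log n is at least k′, and k + 1 = k′ + 2 ≤ 3k′.
  log-above : 1 ≤ k′ → ∀ {x y} → n ^ y < 2 ^ x → suc k * y ≤ 3 * x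
  log-above 1≤k′ {x} {y} above = begin
    suc k * y  ≤⟨ *-monoˡ-≤ y (≤-trans (+-monoˡ-≤ k′ (*-monoʳ-≤ 2 1≤k′)) (≤-reflexive (lemma k′))) ⟩
    3 * k′ * y  ≡⟨ *-assoc 3 k′ y ⟩
    3 * (k′ * y)  ≤⟨ *-monoʳ-≤ 3 (<⇒≤ (^2-cancel-< {k′ * y} {x} (≤-<-trans (≤-trans (≤-reflexive (sym (^-*-assoc 2 k′ y))) (^-monoˡ-≤ y 2^k′≤n)) above))) ⟩
    3 * x  ∎
    where
    open ≤-Reasoning
    lemma : ∀ k → 2 * k + k ≡ 3 * k
    lemma = solve-∀

  F-bound : ∀ K → Weight.F K n ≤ K * (suc k * 2 ^ E)
  F-bound K = begin
    Weight.F K n  ≤⟨ Weight.F-≤ K {n} {k} (<⇒≤ n<) ⟩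
    n * (K * (suc k * 2 ^ δ k))  ≤⟨ *-monoˡ-≤ _ (<⇒≤ n<) ⟩
    2 ^ k * (K * (suc k * 2 ^ δ k))  ≡⟨ lemma (2 ^ k) K (suc k) (2 ^ δ k) ⟩
    K * (suc k * (2 ^ k * 2 ^ δ k))  ≡⟨ cong (λ t → K * (suc k * t)) (^-distribˡ-+-* 2 k (δ k)) ⟨
    K * (suc k * 2 ^ E)  ∎
    where
    open ≤-Reasoning
    n< : n < 2 ^ k
    n< = subst (λ t → n < 2 ^ t) L-eq (n<2^L n)
    lemma : ∀ a K b c → a * (K * (b * c)) ≡ K * (b * (a * c))
    lemma = solve-∀

at-most : ∀ K (f : ℕ → ℕ) → (∀ n → f n ≤ 9 * Weight.F K n) → BigO f (λ n → n ^ʳ (√ 2) *ʳ log₂ n)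
at-most K f upper = C , 2 , bound
  where
  -- The 9 comes from merging colours, 16 from the rounding in n^√2 and 3 from that in log n.
  C = 9 * (K * (16 * 3))
  nat : ∀ n → 2 ≤ n → ∀ p q → 2 * q ^ 2 < p ^ 2 → ∀ {x₁ y₁ x₂ y₂} →
        n ^ p * y₁ ^ q < x₁ ^ q → n ^ y₂ < 2 ^ x₂ → f n * (y₁ * y₂) ≤ C * (x₁ * x₂)
  nat n 2≤n p q √2<p/q {x₁} {y₁} {x₂} {y₂} above₁ above₂ = go (L n) refl
    where
    open ≤-Reasoning
    go : ∀ l → L n ≡ l → f n * (y₁ * y₂) ≤ C * (x₁ * x₂)
    go zero     eq = ⊥-elim (n≮0 (subst (1 <_) eq (L-> {n} {1} 2≤n)))
    go (suc k′) eq = begin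
      f n * (y₁ * y₂)
        ≤⟨ *-monoˡ-≤ (y₁ * y₂) (≤-trans (upper n) (*-monoʳ-≤ 9 (F-bound eq K))) ⟩
      9 * (K * (suc (suc k′) * 2 ^ E)) * (y₁ * y₂)
        ≡⟨ lemma₁ K (suc (suc k′)) (2 ^ E) y₁ y₂ ⟩
      9 * (K * (2 ^ E * y₁ * (suc (suc k′) * y₂)))
        ≤⟨ *-monoʳ-≤ 9 (*-monoʳ-≤ K (*-mono-≤ (<⇒≤ (power-above eq p q √2<p/q {x₁} {y₁} above₁)) (log-above eq (≤-pred (subst (1 <_) eq (L-> {n} {1} 2≤n))) {x₂} {y₂} above₂))) ⟩
      9 * (K * (16 * x₁ * (3 * x₂)))
        ≡⟨ lemma₂ K x₁ x₂ ⟩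
      C * (x₁ * x₂) ∎
      where
      E = suc k′ + δ (suc k′)
      lemma₁ : ∀ K a b c d → 9 * (K * (a * b)) * (c * d) ≡ 9 * (K * (b * c * (a * d)))
      lemma₁ = solve-∀
      lemma₂ : ∀ K a b → 9 * (K * (16 * a * (3 * b))) ≡ 9 * (K * (16 * 3)) * (a * b)
      lemma₂ = solve-∀
  bound : ∀ n → 2 ≤ n → fromℕ (f n) ≤ʳ fromℕ C *ʳ (n ^ʳ (√ 2) *ʳ log₂ n)
  bound n 2≤n r (a , b , C<a , (mkℚᵘ (+ (suc x₁)) y₁ , mkℚᵘ (+ (suc x₂)) y₂ ,
      (_ , s , (_ , √2<s) , above₁) , (_ , above₂) , b₁b₂≤b) , ab≤r) =
    ⊔-lub-< 0ℚᵘ (mkℚᵘ (+ f n) 0) (ℚ.≤-<-trans 0≤f f<r) f<r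
    where
    b₁b₂ = mkℚᵘ (+ (suc x₁ * suc x₂)) (y₂ + y₁ * suc y₂)
    b₁b₂≡ : mkℚᵘ (+ suc x₁) y₁ ℚ.* mkℚᵘ (+ suc x₂) y₂ ≡ b₁b₂
    b₁b₂≡ = frac-* (suc x₁) y₁ (suc x₂) y₂
    0≤f : 0ℚᵘ ℚ.≤ mkℚᵘ (+ f n) 0
    0≤f = frac-≤ z≤n
    f≤Cb : mkℚᵘ (+ f n) 0 ℚ.≤ mkℚᵘ (+ C) 0 ℚ.* b₁b₂
    f≤Cb = subst (mkℚᵘ (+ f n) 0 ℚ.≤_) (sym (frac-* C 0 (suc x₁ * suc x₂) _)) (frac-≤ (≤-trans
      (≤-reflexive (cong (f n *_) (+-identityʳ (suc (y₂ + y₁ * suc y₂)))))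
      (≤-trans (nat n 2≤n (↥ₙ s) (↧ₙ s) √2<s {suc x₁} {suc y₁} {suc x₂} {suc y₂} above₁ above₂)
        (≤-reflexive (sym (*-identityʳ _))))))
    f<r : mkℚᵘ (+ f n) 0 ℚ.< r
    f<r = ℚ.≤-<-trans f≤Cb (ℚ.<-≤-trans (ℚ.*-monoˡ-<-pos b₁b₂ (ℚ.≤-<-trans (ℚ.p≤q⊔p 0ℚᵘ (mkℚᵘ (+ C) 0)) C<a))
      (ℚ.≤-trans (ℚ.*-monoʳ-≤-nonNeg a {{ℚ.nonNegative (ℚ.<⇒≤ (ℝ₊.positive (fromℕ C) C<a))}} (subst (ℚ._≤ b) b₁b₂≡ b₁b₂≤b)) ab≤r))
  bound n 2≤n r (a , b , C<a , (mkℚᵘ (+ 0) _ , _ , (*<* (+<+ ()) , _) , _ , _) , _)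
  bound n 2≤n r (a , b , C<a , (mkℚᵘ -[1+ _ ] _ , _ , (*<* () , _) , _ , _) , _)
  bound n 2≤n r (a , b , C<a , (mkℚᵘ (+ (suc _)) _ , mkℚᵘ (+ 0) _ , _ , (*<* (+<+ ()) , _) , _) , _)
  bound n 2≤n r (a , b , C<a , (mkℚᵘ (+ (suc _)) _ , mkℚᵘ -[1+ _ ] _ , _ , (*<* () , _) , _) , _)

-- For β = 256: 432 · 256 + 1248 = 111840 ≤ 131072 = 2^17 ≤ 196608 = 3 · 256².
constants : Constants (2 ^ 17) (2 ^ 8)
constants = record
  { K-cut   = ≤ᵇ⇒≤ _ _ _
  ; K-large = ≤ᵇ⇒≤ _ _ _
  ; K-small = ≤ᵇ⇒≤ _ _ _
  }

theorem1p2 : Σ (ℕ → ℕ) λ τ₃ →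
    (∀ n → IsMaxRainbow n (τ₃ n)) ×
    AtLeastHalfNLogN τ₃ ×
    BigO τ₃ (λ n → n ^ʳ (√ 2) *ʳ log₂ n) ×
    Σ (∀ n → Colouring n) λ c →
    (∀ n → Almost3Gallai (c n) × UsesOnlyThreeColours (c n)) ×
    AtLeastHalfNLogN (λ n → #rainbow (c n))
theorem1p2 = τ₃ , isMax , at-least τ₃ lower , at-most (2 ^ 17) τ₃ upper ,
  cube , (λ n → cube-gallai n , cube-three n) , at-least (λ n → #rainbow (cube n)) cube-lower
  where
  τ₃ : ℕ → ℕ
  τ₃ n = proj₁ (maxRainbow n)
  isMax : ∀ n → IsMaxRainbow n (τ₃ n)
  isMax n = proj₂ (maxRainbow n)
  lower : ∀ n → L n * (n ∸ L n) ≤ 2 * τ₃ n + 2 ^ L n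
  lower n = ≤-trans (cube-lower n) (+-monoˡ-≤ (2 ^ L n) (*-monoʳ-≤ 2 (proj₂ (isMax n) (cube n) (cube-gallai n))))
  upper : ∀ n → τ₃ n ≤ 9 * Weight.F (2 ^ 17) n
  upper n = let (c , gallai , eq) , _ = isMax n in
    ≤-trans (≤-reflexive (sym eq)) (upper-bound (2 ^ 17) (2 ^ 8) constants c gallai)
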